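{- For a finite simple graph $G$ the following statements are equivalent: (1) $G$ admits a $\{{}^bP_3,{}^rP_3,{}^bK_3,{}^{rbb}K_3\}$-free $2$-edge-colouring. (2) $G$ admits a $\{{}^bP_3,{}^rP_3,{}^rK_3,{}^{rrb}K_3\}$-free $2$-edge-colouring. (3) Each connected component of $G$ is either a line graph of an incidence graph or a diamond. (4) $G$ is a $\{\text{claw}, 4\text{ -wheel}, \text{gem}, \text{kite}, X_1, X_2, K_5-e, \text{odd-hole}, \text{even-butterfly}\}$-free graph.
   Context: Graphs are finite and simple. A $2$-edge-colouring of $G$ assigns to every edge the colour red or blue (not necessarily properly). For a set $\mathcal F$ of $2$-edge-coloured graphs, a $2$-edge-colouring of $G$ is $\mathcal F$-free if no induced $2$-edge-coloured subgraph is isomorphic (preserving colours) to a member of $\mathcal F$. Patterns on three vertices: ${}^rP_3$ (resp. ${}^bP_3$) is the path on three vertices with both edges red (resp. blue); ${}^rK_3$ (resp. ${}^bK_3$) is the triangle with all edges red (resp. blue); ${}^{rrb}K_3$ is the triangle with two red and one blue edge; ${}^{rbb}K_3$ is the triangle with one red and two blue edges. The line graph of $H$ has vertex set $E(H)$, two vertices being adjacent iff the corresponding edges share an endpoint. A graph is an incidence graph if it is bipartite with a bipartition $(X,Y)$ in which every vertex of $X$ has degree at most $2$. For uncoloured graphs, being free of a set of graphs means containing no induced subgraph isomorphic to a member. Claw: $K_{1,3}$. Diamond: $K_4$ minus an edge. $4$-wheel: join of $C_4$ and $K_1$. Gem: join of $P_4$ and $K_1$. Kite: diamond plus a new vertex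 adjacent to exactly one vertex of the diamond, which has degree $2$ in the diamond. $X_1$: diamond plus a new vertex adjacent to exactly the two vertices of degree $2$ of the diamond. $X_2$: diamond plus a new vertex adjacent to both vertices of degree $3$ and to exactly one vertex of degree $2$ of the diamond. $K_5-e$: $K_5$ minus one edge. An odd-hole is a chordless cycle of odd length at least $5$. For $n\ge 0$, the $n$-butterfly consists of two triangles joined by a path of length $n$ (one vertex of each triangle is an end of the path; for $n=0$ the two triangles share exactly one vertex). An even-butterfly is a $2n$-butterfly for some $n\ge 0$. -}

module Defs where

open import Data.Bool.Base using (Bool; true; false; T; not; _∧_; _∨_)
open import Data.Bool.Properties using (T-irrelevant; ∨-comm)
open import Data.Fin.Base using (Fin; zero; suc; toℕ; _<_)
open import Data.Fin using (#_)
open import Data.Fin.Properties using (_≟_; <-irrelevant)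
open import Data.Fin.Subset using (Subset; _∈_; ∁; ⁅_⁆; _∪_; ⊤; ∣_∣)
open import Data.Nat.Base using (ℕ; suc; _+_; _*_; _≤_; _≡ᵇ_; _<ᵇ_; _%_)
open import Data.Nat.Properties using (+-comm)
open import Data.Product.Base using (Σ; ∃; ∃₂; _×_; _,_; proj₁)
open import Data.Vec.Base using (lookup; tabulate)
open import Function.Base using (_on_)
open import Function.Bundles using (_↔_; Inverse; _⇔_)
open import Level using (0ℓ)
open import Relation.Binary.Construct.Closure.ReflexiveTransitive using (Star)
open import Relation.Binary.Definitions using (DecidableEquality)
open import Relation.Binary.PropositionalEquality using (_≡_; refl; sym; cong; cong₂)
open import Relation.Nullary using (¬_; yes; no; ⌊_⌋; contradiction)
open import Relation.Unary using (Pred)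

-- Simple graphs with vertex type V.  Finite graphs are those with V = Fin n.

record Graph (V : Set) : Set where
  field
    adj        : V → V → Bool
    adj-sym    : ∀ u v → adj u v ≡ adj v u
    adj-irrefl : ∀ v → adj v v ≡ false

  infix 4 _~_
  _~_ : V → V → Set
  u ~ v = T (adj u v)

open Graph public

FinGraph : Set
FinGraph = ∃ λ n → Graph (Fin n)

-- The irreflexive and symmetric closure of r, as a graph.
fromRel : ∀ {V} → DecidableEquality V → (V → V → Bool) → Graph V
fromRel {V} _≟ⱽ_ r = record { adj = a ; adj-sym = a-sym ; adj-irrefl = a-irrefl }
  where
  a : V → V → Bool
  a u v = not ⌊ u ≟ⱽ v ⌋ ∧ (r u v ∨ r v u)

  ≟-sym : ∀ u v → ⌊ u ≟ⱽ v ⌋ ≡ ⌊ v ≟ⱽ u ⌋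
  ≟-sym u v with u ≟ⱽ v | v ≟ⱽ u
  ... | yes _ | yes _ = refl
  ... | no  _ | no  _ = refl
  ... | yes p | no ¬q = contradiction (sym p) ¬q
  ... | no ¬p | yes q = contradiction (sym q) ¬p

  a-sym : ∀ u v → a u v ≡ a v u
  a-sym u v = cong₂ (λ x y → not x ∧ y) (≟-sym u v) (∨-comm (r u v) (r v u))

  a-irrefl : ∀ v → a v v ≡ false
  a-irrefl v with v ≟ⱽ v
  ... | yes _ = refl
  ... | no ¬p = contradiction refl ¬p

record _≅_ {V W} (G : Graph V) (H : Graph W) : Set where
  field
    bijection : V ↔ W
  open Inverse bijection public using (to; from)
  field
    to-adj : ∀ u v → adj G u v ≡ adj H (to u) (to v)

Members : ∀ {n} → Subset n → Set
Members {n} S = Σ (Fin n) (_∈ S)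

induced : ∀ {n} → Graph (Fin n) → (S : Subset n) → Graph (Members S)
induced G S = record
  { adj        = adj G on proj₁
  ; adj-sym    = λ u v → adj-sym G (proj₁ u) (proj₁ v)
  ; adj-irrefl = λ v → adj-irrefl G (proj₁ v)
  }

Free : ∀ {n} → Pred FinGraph 0ℓ → Graph (Fin n) → Set
Free 𝓕 G = ∀ S {k} {F : Graph (Fin k)} → 𝓕 (k , F) → ¬ (induced G S ≅ F)

data Colour : Set where
  red blue : Colour

-- Taking p and q independently makes the colour depend only on the unordered
-- pair {u, v}.
record Colouring {V} (G : Graph V) : Set where
  field
    colour     : ∀ u v → _~_ G u v → Colour
    colour-sym : ∀ u v (p : _~_ G u v) (q : _~_ G v u) → colour u v p ≡ colour v u q

open Colouring public

record ColouredGraph (V : Set) : Set where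
  constructor _,_
  field
    graph     : Graph V
    colouring : Colouring graph

open ColouredGraph public

FinColouredGraph : Set
FinColouredGraph = ∃ λ n → ColouredGraph (Fin n)

record _≅ᶜ_ {V W} (G : ColouredGraph V) (H : ColouredGraph W) : Set where
  field
    iso : graph G ≅ graph H
  open _≅_ iso public
  field
    to-colour : ∀ u v (p : _~_ (graph G) u v) (q : _~_ (graph H) (to u) (to v)) →
                colour (colouring G) u v p ≡ colour (colouring H) (to u) (to v) q

inducedᶜ : ∀ {n} → ColouredGraph (Fin n) → (S : Subset n) → ColouredGraph (Members S)
inducedᶜ (G , c) S = induced G S , record
  { colour     = λ u v → colour c (proj₁ u) (proj₁ v)
  ; colour-sym = λ u v → colour-sym c (proj₁ u) (proj₁ v)
  }

Freeᶜ : ∀ {n} → Pred FinColouredGraph 0ℓ → ColouredGraph (Fin n) → Set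
Freeᶜ 𝓕 G = ∀ S {k} {F : ColouredGraph (Fin k)} → 𝓕 (k , F) → ¬ (inducedᶜ G S ≅ᶜ F)

AdmitsFreeColouring : ∀ {n} → Pred FinColouredGraph 0ℓ → Graph (Fin n) → Set
AdmitsFreeColouring 𝓕 G = ∃ λ (c : Colouring G) → Freeᶜ 𝓕 (G , c)

complete : ∀ n → Graph (Fin n)
complete n = fromRel _≟_ (λ _ _ → true)

edgeless : ∀ n → Graph (Fin n)
edgeless n = fromRel _≟_ (λ _ _ → false)

-- The path 0 – 1 – ⋯ – (n ∸ 1) with n vertices.
path : ∀ n → Graph (Fin n)
path n = fromRel _≟_ (λ i j → suc (toℕ i) ≡ᵇ toℕ j)

-- The path above closed by the edge {0 , n ∸ 1}; a cycle when 3 ≤ n.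
cycle : ∀ n → Graph (Fin n)
cycle n = fromRel _≟_ λ i j →
  (suc (toℕ i) ≡ᵇ toℕ j) ∨ ((toℕ i ≡ᵇ 0) ∧ (suc (toℕ j) ≡ᵇ n))

-- Two distinct vertices are adjacent unless they are 0 and 1.
completeMinusEdge : ∀ n → Graph (Fin n)
completeMinusEdge n = fromRel _≟_ (λ _ j → 1 <ᵇ toℕ j)

-- A new vertex, numbered 0, with neighbourhood N; old vertices are shifted by suc.
addVertex : ∀ {n} → Graph (Fin n) → Subset n → Graph (Fin (suc n))
addVertex {n} G N = record { adj = a ; adj-sym = a-sym ; adj-irrefl = a-irrefl }
  where
  a : Fin (suc n) → Fin (suc n) → Bool
  a zero    zero    = false
  a zero    (suc v) = lookup N v
  a (suc u) zero    = lookup N u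
  a (suc u) (suc v) = adj G u v

  a-sym : ∀ u v → a u v ≡ a v u
  a-sym zero    zero    = refl
  a-sym zero    (suc v) = refl
  a-sym (suc u) zero    = refl
  a-sym (suc u) (suc v) = adj-sym G u v

  a-irrefl : ∀ v → a v v ≡ false
  a-irrefl zero    = refl
  a-irrefl (suc v) = adj-irrefl G v

-- Colours the edges {0,1}, {0,2}, {1,2} with a, b, c respectively: the sum of
-- the endpoints of an edge identifies it.
colour₃ : (G : Graph (Fin 3)) → Colour → Colour → Colour → Colouring G
colour₃ G a b c = record
  { colour     = λ u v _ → pick (toℕ u + toℕ v)
  ; colour-sym = λ u v _ _ → cong pick (+-comm (toℕ u) (toℕ v))
  }
  where
  pick : ℕ → Colour
  pick 1 = a
  pick 2 = b
  pick _ = c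

monochromaticP₃ : Colour → FinColouredGraph
monochromaticP₃ a = 3 , (path 3 , colour₃ (path 3) a a a)

colouredK₃ : Colour → Colour → Colour → FinColouredGraph
colouredK₃ a b c = 3 , (complete 3 , colour₃ (complete 3) a b c)

ʳP₃ ᵇP₃ ʳK₃ ᵇK₃ ʳʳᵇK₃ ʳᵇᵇK₃ : FinColouredGraph
ʳP₃   = monochromaticP₃ red
ᵇP₃   = monochromaticP₃ blue
ʳK₃   = colouredK₃ red red red
ᵇK₃   = colouredK₃ blue blue blue
ʳʳᵇK₃ = colouredK₃ red red blue
ʳᵇᵇK₃ = colouredK₃ red blue blue

-- Its vertices 0 and 1 have degree 2, its vertices 2 and 3 degree 3.
diamondGraph : Graph (Fin 4)
diamondGraph = completeMinusEdge 4

claw 4-wheel gem kite X₁ X₂ K₅-e : FinGraph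
claw    = 4 , addVertex (edgeless 3) ⊤
4-wheel = 5 , addVertex (cycle 4) ⊤
gem     = 5 , addVertex (path 4) ⊤
kite    = 5 , addVertex diamondGraph ⁅ # 0 ⁆
X₁      = 5 , addVertex diamondGraph (⁅ # 0 ⁆ ∪ ⁅ # 1 ⁆)
X₂      = 5 , addVertex diamondGraph (⁅ # 2 ⁆ ∪ ⁅ # 3 ⁆ ∪ ⁅ # 0 ⁆)
K₅-e    = 5 , completeMinusEdge 5

OddHole : Pred FinGraph 0ℓ
OddHole F = ∃ λ k → 5 ≤ k × k % 2 ≡ 1 × F ≡ (k , cycle k)

-- The path 0 – 1 – ⋯ – (n + 4) together with the chords {0 , 2} and
-- {n + 2 , n + 4}.  The triangles are {0 , 1 , 2} and {n + 2 , n + 3 , n + 4},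
-- joined by the path of length n from 2 to n + 2.
butterfly : ∀ n → Graph (Fin (n + 5))
butterfly n = fromRel _≟_ λ i j →
  (suc (toℕ i) ≡ᵇ toℕ j)
    ∨ ((toℕ i ≡ᵇ 0) ∧ (toℕ j ≡ᵇ 2))
    ∨ ((toℕ i ≡ᵇ n + 2) ∧ (toℕ j ≡ᵇ n + 4))

EvenButterfly : Pred FinGraph 0ℓ
EvenButterfly F = ∃ λ n → F ≡ (2 * n + 5 , butterfly (2 * n))

-- An edge is an unordered pair, represented by its increasing enumeration.
record Edge {n} (H : Graph (Fin n)) : Set where
  constructor edge
  field
    end₁ end₂ : Fin n
    ordered   : end₁ < end₂
    adjacent  : _~_ H end₁ end₂

open Edge public

_≟ᴱ_ : ∀ {n} {H : Graph (Fin n)} → DecidableEquality (Edge H)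
edge u v p q ≟ᴱ edge u′ v′ p′ q′ with u ≟ u′ | v ≟ v′
... | no u≢u′  | _        = no λ e≡f → u≢u′ (cong end₁ e≡f)
... | yes _    | no v≢v′  = no λ e≡f → v≢v′ (cong end₂ e≡f)
... | yes refl | yes refl = yes (cong₂ (edge u v) (<-irrelevant p p′) (T-irrelevant q q′))

lineGraph : ∀ {n} (H : Graph (Fin n)) → Graph (Edge H)
lineGraph H = fromRel _≟ᴱ_ λ e f →
  ⌊ end₁ e ≟ end₁ f ⌋ ∨ ⌊ end₁ e ≟ end₂ f ⌋ ∨ ⌊ end₂ e ≟ end₁ f ⌋ ∨ ⌊ end₂ e ≟ end₂ f ⌋

degree : ∀ {n} → Graph (Fin n) → Fin n → ℕ
degree G v = ∣ tabulate (adj G v) ∣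

Independent : ∀ {n} → Graph (Fin n) → Subset n → Set
Independent G S = ∀ u v → u ∈ S → v ∈ S → ¬ (_~_ G u v)

-- The second class of the bipartition (X , Y) is Y = ∁ X.
IsBipartition : ∀ {n} → Graph (Fin n) → Subset n → Set
IsBipartition G X = Independent G X × Independent G (∁ X)

IsIncidenceGraph : ∀ {n} → Graph (Fin n) → Set
IsIncidenceGraph {n} G =
  ∃ λ (X : Subset n) → IsBipartition G X × (∀ x → x ∈ X → degree G x ≤ 2)

IsLineGraphOfIncidenceGraph : ∀ {V} → Graph V → Set
IsLineGraphOfIncidenceGraph G =
  ∃₂ λ m (H : Graph (Fin m)) → IsIncidenceGraph H × (G ≅ lineGraph H)

IsDiamond : ∀ {V} → Graph V → Set
IsDiamond G = G ≅ diamondGraph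

IsComponent : ∀ {n} → Graph (Fin n) → Subset n → Set
IsComponent G S = ∃ λ v → ∀ u → u ∈ S ⇔ Star (_~_ G) v u

{-# OPTIONS --safe #-}
module Submission where

-- All statements are equivalent to the existence of a matching m such that
-- every induced path on three vertices contains an edge of m: colour m with
-- the minority colour.
--
-- (1) ⇒ (3): A diamond of a graph with such an m is a component.  In the other
-- components every edge of m that lies in a triangle joins twins and can be
-- removed from m; then the edges outside m form disjoint cliques, and G is the line graph of the
-- incidence graph between the edges of m (with the unmatched vertices) and these
-- cliques.
--
-- (1) ⇒ (4): m restricts to induced subgraphs, and no forbidden graph has such
-- a matching.
--
-- (4) ⇒ (1): A diamond is a component again.  Elsewhere, m is sought among the
-- edges in no triangle.  By claw-freeness they form paths and cycles whose inner vertices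
-- have degree 2 in G, and m has to alternate along them and to contain the edges
-- that meet a triangle.  These parity constraints are solved component by
-- component; a contradiction is a closed trail of odd length, which yields an odd
-- hole, or a trail of even length between two triangles, which yields an odd
-- hole or an even butterfly.

open import Defs
open import Data.Bool.Base using (Bool; true; false; T; not; _∧_; _∨_; _xor_)
open import Data.Bool.Properties using (T?; T-irrelevant; T-≡; T-∧; T-∨; not-involutive; not-¬; xor-assoc; xor-comm; xor-identityʳ; xor-same; ∨-identityʳ) renaming (_≟_ to _≟ᵇ_)
open import Data.Empty using (⊥; ⊥-elim)
open import Data.Fin.Base using (Fin; zero; suc; splitAt; toℕ; _↑ʳ_; _↑ˡ_)
open import Data.Fin using (#_)
open import Data.Fin.Properties using (_≟_; all?; any?; <-cmp; <-irrelevant; splitAt⁻¹-↑ʳ; splitAt⁻¹-↑ˡ; splitAt-↑ʳ; splitAt-↑ˡ; toℕ<n; toℕ-fromℕ<; toℕ-injective; toℕ-↑ʳ; toℕ-↑ˡ; ↑ʳ-injective; ↑ˡ-injective)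
open import Data.Fin.Subset using (Subset; _∈_; _∉_; _-_; ∁; ∣_∣; ⁅_⁆) renaming (_∪_ to _∪ˢ_)
open import Data.Fin.Subset.Properties using (_∈?_; p⊆p∪q; p⊆q⇒∣p∣≤∣q∣; q⊆p∪q; x∈p∧x≢y⇒x∈p-y; x∈p⇒∣p-x∣<∣p∣; x∈⁅x⁆; x∈∁p⇒x∉p; x∉p⇒x∈∁p; ∣⁅x⁆∣≡1)
open import Data.List.Base using (List; []; _∷_; allFin; cartesianProduct)
import Data.List.Membership.Propositional as List
open import Data.List.Membership.Propositional.Properties using (∈-allFin; ∈-cartesianProduct⁺)
open import Data.List.Relation.Unary.Any using (here; there)
open import Data.Nat.Base using (ℕ; zero; suc; NonZero; _+_; _*_; _∸_; _%_; _<_; _≤_; _≡ᵇ_; s<s; s<s⁻¹; s≤s; s≤s⁻¹; z<s; z≤n)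
open import Data.Nat.DivMod using (_mod_; m<n⇒m%n≡m; m%n<n; [m+n]%n≡m%n)
open import Data.Nat.Induction using (<-wellFounded)
import Data.Nat.Properties as ℕ
open import Data.Product.Base using (Σ; ∃; ∃₂; _×_; _,_; proj₁; proj₂)
open import Data.Product.Properties using (≡-dec)
open import Data.Sum.Base using (_⊎_; inj₁; inj₂; [_,_]′)
open import Data.Sum.Properties using (inj₁-injective)
open import Data.Unit.Base using (⊤; tt)
open import Data.Vec.Base using (Vec; []; _∷_; lookup; tabulate)
open import Data.Vec.Properties using ([]=⇒lookup; lookup⇒[]=; lookup∘tabulate)
open import Data.Vec.Properties.WithK using ([]=-irrelevant)
open import Function.Base using (_∘_; case_of_; id)
open import Function.Bundles using (_⇔_; Equivalence; Inverse; mk⇔; mk⤖)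
open import Function.Consequences.Propositional using (strictlySurjective⇒surjective)
open import Function.Properties.Bijection using (⤖⇒↔)
open import Induction.WellFounded using (Acc; acc)
open import Level using (0ℓ)
open import Relation.Binary.Construct.Closure.Equivalence using (EqClosure; symmetric)
open import Relation.Binary.Construct.Closure.ReflexiveTransitive using (Star; _◅_; _◅◅_; gmap; reverse; ε) renaming (map to map*)
open import Relation.Binary.Construct.Closure.Symmetric using (bwd; fwd)
import Relation.Binary.Core as B
import Relation.Binary.Definitions as B
open import Relation.Binary.Definitions using (tri<; tri>; tri≈)
open import Relation.Binary.PropositionalEquality using (_≡_; _≢_; cong; cong₂; refl; subst; subst₂; sym; trans)
open import Relation.Nullary using (¬_; Dec; no; yes; contradiction; ⌊_⌋)
open import Relation.Nullary.Decidable using (fromWitness; map′; toWitness; ¬?; _×-dec_; _→-dec_; _⊎-dec_)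
open import Relation.Unary using (Decidable; Pred; ｛_｝; _∪_)
open Equivalence using (from; to)

-- Two edges of the minority colour with a common end would span either the path of that colour or a
-- triangle with at least two edges of that colour; the path and the two triangles are all
-- forbidden, so these edges form a matching. Forbidding the path of the other colour is what makes
-- every induced path meet the matching.
--
-- For (3) ⇒ (1), `m` joins two edges of the incidence graph when they share their end in X, where
-- at most two edges meet.
--
-- Diamonds are exceptional because a matched edge of a triangle need not join twins in them. Every
-- way to attach a further vertex to a diamond contains one of the seven forbidden graphs of fixed
-- size.
--
-- In (4) ⇒ (1), edges in triangles can stay unmatched: two of them with a common end and
-- non-adjacent other ends lie in a diamond, as there is no gem and no 0-butterfly. The constraints
-- leave one free bit in each class of edges, and the edges that meet a triangle fix it. This is why
-- there are two kinds of contradiction. A walk of constraints may retrace its steps or run round a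
-- cycle, so it is reduced to a trail without backtracking, from which laps of even length are cut
-- off.

private variable
  V W U : Set
  n k : ℕ

-- Embeddings

T-ext : ∀ {a b} → (T a → T b) → (T b → T a) → a ≡ b
T-ext {true}  {true}  _ _ = refl
T-ext {true}  {false} f _ = ⊥-elim (f tt)
T-ext {false} {true}  _ g = ⊥-elim (g tt)
T-ext {false} {false} _ _ = refl

~-sym : ∀ (G : Graph V) {u v} → _~_ G u v → _~_ G v u
~-sym G {u} {v} = subst T (adj-sym G u v)

~⇒≢ : ∀ (G : Graph V) {u v} → _~_ G u v → u ≢ v
~⇒≢ G {u} u~u refl = subst T (adj-irrefl G u) u~u

module _ {P : Pred (Fin n) 0ℓ} (P? : Decidable P) where

  ⟦_⟧ : Subset n
  ⟦_⟧ = tabulate (λ v → ⌊ P? v ⌋)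

  ∈⟦⟧⁺ : ∀ {v} → P v → v ∈ ⟦_⟧
  ∈⟦⟧⁺ {v} p = lookup⇒[]= v _ (trans (lookup∘tabulate _ v) (to T-≡ (fromWitness p)))

  ∈⟦⟧⁻ : ∀ {v} → v ∈ ⟦_⟧ → P v
  ∈⟦⟧⁻ {v} v∈ = toWitness (from T-≡ (trans (sym (lookup∘tabulate _ v)) ([]=⇒lookup v∈)))

Members-≡ : ∀ {S : Subset n} {x y : Members S} → proj₁ x ≡ proj₁ y → x ≡ y
Members-≡ {x = v , _} {.v , _} refl = cong (v ,_) ([]=-irrelevant _ _)

-- Embeddings as induced subgraphs.
record _↪_ (G : Graph V) (H : Graph W) : Set where
  field
    map       : V → W
    injective : ∀ {u v} → map u ≡ map v → u ≡ v
    map-adj   : ∀ u v → adj G u v ≡ adj H (map u) (map v)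

  map-~ : ∀ {u v} → _~_ G u v → _~_ H (map u) (map v)
  map-~ {u} {v} = subst T (map-adj u v)

  map-~⁻ : ∀ {u v} → _~_ H (map u) (map v) → _~_ G u v
  map-~⁻ {u} {v} = subst T (sym (map-adj u v))

open _↪_ using (map; injective; map-adj; map-~; map-~⁻)

↪-trans : ∀ {G : Graph V} {H : Graph W} {K : Graph U} → G ↪ H → H ↪ K → G ↪ K
↪-trans e f = record
  { map       = map f ∘ map e
  ; injective = injective e ∘ injective f
  ; map-adj   = λ u v → trans (map-adj e u v) (map-adj f _ _)
  }

module _ {G : Graph V} {H : Graph W} where

  ≅⇒↪ : G ≅ H → G ↪ H
  ≅⇒↪ i = record
    { map       = i.to
    ; injective = λ {u} {v} eq → trans (sym (strictlyInverseʳ u)) (trans (cong i.from eq) (strictlyInverseʳ v))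
    ; map-adj   = i.to-adj
    }
    where
    module i = _≅_ i
    open Inverse i.bijection using (strictlyInverseʳ)

  ≅⇒↩ : G ≅ H → H ↪ G
  ≅⇒↩ i = record
    { map       = i.from
    ; injective = λ {u} {v} eq → trans (sym (strictlyInverseˡ u)) (trans (cong i.to eq) (strictlyInverseˡ v))
    ; map-adj   = λ u v → trans (sym (cong₂ (adj H) (strictlyInverseˡ u) (strictlyInverseˡ v)))
                                (sym (i.to-adj (i.from u) (i.from v)))
    }
    where
    module i = _≅_ i
    open Inverse i.bijection using (strictlyInverseˡ)

  surjective-↪⇒≅ : (e : G ↪ H) → (∀ w → ∃ λ v → map e v ≡ w) → G ≅ H
  surjective-↪⇒≅ e surj = record
    { bijection = ⤖⇒↔ (mk⤖ (injective e , strictlySurjective⇒surjective surj))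
    ; to-adj    = map-adj e
    }

induced↪ : ∀ (G : Graph (Fin n)) S → induced G S ↪ G
induced↪ G S = record { map = proj₁ ; injective = Members-≡ ; map-adj = λ _ _ → refl }

module _ {G : Graph (Fin n)} {F : Graph V} (e : F ↪ G) {S : Subset n}
         (S⇒image : ∀ v → v ∈ S → ∃ λ i → map e i ≡ v) (image⇒S : ∀ i → map e i ∈ S) where

  image-≅ : induced G S ≅ F
  image-≅ = surjective-↪⇒≅
    record { map       = λ (v , v∈S) → proj₁ (S⇒image v v∈S)
           ; injective = λ {u} {v} eq → Members-≡
               (trans (sym (preimage u)) (trans (cong (map e) eq) (preimage v)))
           ; map-adj   = λ u v → sym (trans (map-adj e _ _) (cong₂ (adj G) (preimage u) (preimage v)))
           }
    (λ i → (map e i , image⇒S i) , injective e (preimage (map e i , image⇒S i)))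
    where
    preimage : ∀ (v : Members S) → map e (proj₁ (S⇒image (proj₁ v) (proj₂ v))) ≡ proj₁ v
    preimage (v , v∈S) = proj₂ (S⇒image v v∈S)

  image-≅ᶜ : (c : Colouring G) (d : Colouring F) →
             (∀ i j p q → colour c (map e i) (map e j) p ≡ colour d i j q) →
             inducedᶜ (G , c) S ≅ᶜ (F , d)
  image-≅ᶜ c d same = record
    { iso       = image-≅
    ; to-colour = λ (u , u∈S) (v , v∈S) → transport (proj₂ (S⇒image u u∈S)) (proj₂ (S⇒image v v∈S))
    }
    where
    transport : ∀ {i j u v} → map e i ≡ u → map e j ≡ v → (p : _~_ G u v) (q : _~_ F i j) →
                colour c u v p ≡ colour d i j q
    transport refl refl = same _ _

module _ {G : Graph (Fin n)} {F : Graph (Fin k)} (e : F ↪ G) where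

  image : Subset n
  image = ⟦ (λ v → any? (λ i → map e i ≟ v)) ⟧

  image⇒∃ : ∀ v → v ∈ image → ∃ λ i → map e i ≡ v
  image⇒∃ _ = ∈⟦⟧⁻ (λ v → any? (λ i → map e i ≟ v))

  ∈-image : ∀ i → map e i ∈ image
  ∈-image i = ∈⟦⟧⁺ (λ v → any? (λ i → map e i ≟ v)) (i , refl)

  Free⇒¬↪ : ∀ {𝓕 : Pred FinGraph 0ℓ} → Free 𝓕 G → ¬ 𝓕 (k , F)
  Free⇒¬↪ free F∈𝓕 = free image F∈𝓕 (image-≅ e image⇒∃ ∈-image)

  Freeᶜ⇒¬↪ : ∀ {𝓕 : Pred FinColouredGraph 0ℓ} (c : Colouring G) (d : Colouring F) →
             (∀ i j p q → colour c (map e i) (map e j) p ≡ colour d i j q) →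
             Freeᶜ 𝓕 (G , c) → ¬ 𝓕 (k , (F , d))
  Freeᶜ⇒¬↪ c d same free F∈𝓕 = free image F∈𝓕 (image-≅ᶜ e image⇒∃ ∈-image c d same)

Free-by : ∀ {𝓕 : Pred FinGraph 0ℓ} {G : Graph (Fin n)} →
          (∀ {k} {F : Graph (Fin k)} → 𝓕 (k , F) → ¬ (F ↪ G)) → Free 𝓕 G
Free-by {G = G} no-F S F∈𝓕 i = no-F F∈𝓕 (↪-trans (≅⇒↩ i) (induced↪ G S))

module _ (G : Graph V) where

  -- Non-adjacency includes distinctness, so vertices related according to an adjacency matrix are
  -- automatically distinct, and `Rel⇒↪` asks only for the increasing pairs.
  Rel : Bool → V → V → Set
  Rel true  u v = _~_ G u v
  Rel false u v = u ≢ v × ¬ _~_ G u v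

  Rel⇒≢ : ∀ b {u v} → Rel b u v → u ≢ v
  Rel⇒≢ true  = ~⇒≢ G
  Rel⇒≢ false = proj₁

  Rel⇒adj : ∀ b {u v} → Rel b u v → b ≡ adj G u v
  Rel⇒adj true  u~v       = T-ext (λ _ → u~v) _
  Rel⇒adj false (_ , u≁v) = T-ext (λ ()) u≁v

  Rel⇒↪ : ∀ (F : Graph (Fin k)) (f : Fin k → V) →
          (∀ i j → toℕ i < toℕ j → Rel (adj F i j) (f i) (f j)) → F ↪ G
  Rel⇒↪ F f rel = record
    { map       = f
    ; injective = λ {i} {j} → inj i j
    ; map-adj   = eq
    }
    where
    inj : ∀ i j → f i ≡ f j → i ≡ j
    inj i j fi≡fj with <-cmp i j
    ... | tri< i<j _ _ = contradiction fi≡fj (Rel⇒≢ (adj F i j) (rel i j i<j))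
    ... | tri≈ _ i≡j _ = i≡j
    ... | tri> _ _ j<i = contradiction (sym fi≡fj) (Rel⇒≢ (adj F j i) (rel j i j<i))

    eq : ∀ i j → adj F i j ≡ adj G (f i) (f j)
    eq i j with <-cmp i j
    ... | tri< i<j _ _  = Rel⇒adj (adj F i j) (rel i j i<j)
    ... | tri≈ _ refl _ = trans (adj-irrefl F i) (sym (adj-irrefl G (f i)))
    ... | tri> _ _ j<i  = trans (adj-sym F i j)
      (trans (Rel⇒adj (adj F j i) (rel j i j<i)) (adj-sym G (f j) (f i)))

-- The last index has a clause of its own, so that concrete evidence is a tuple without a trailing
-- `tt`.
All : ∀ k → (Fin k → Set) → Set
All zero          P = ⊤
All (suc zero)    P = P zero
All (suc (suc k)) P = P zero × All (suc k) (P ∘ suc)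

lookupAll : ∀ k {P : Fin k → Set} → All k P → ∀ i → P i
lookupAll (suc zero)    p        zero    = p
lookupAll (suc (suc k)) (p , _)  zero    = p
lookupAll (suc (suc k)) (_ , ps) (suc i) = lookupAll (suc k) ps i

-- R at all increasing pairs of indices, as nested tuples.
Pairs : ∀ k → (Fin k → Fin k → Set) → Set
Pairs zero                R = ⊤
Pairs (suc zero)          R = ⊤
Pairs (suc (suc zero))    R = R zero (suc zero)
Pairs (suc (suc (suc k))) R = All (suc (suc k)) (R zero ∘ suc) × Pairs (suc (suc k)) (λ i j → R (suc i) (suc j))

lookupPairs : ∀ k {R : Fin k → Fin k → Set} → Pairs k R → ∀ i j → toℕ i < toℕ j → R i j
lookupPairs (suc (suc zero))    r        zero    (suc zero) _   = r
lookupPairs (suc (suc zero))    _        (suc zero) (suc zero) (s<s ())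
lookupPairs (suc (suc (suc k))) {R} (rs , _) zero    (suc j)    _   = lookupAll (suc (suc k)) {R zero ∘ suc} rs j
lookupPairs (suc (suc (suc k))) (_ , rs) (suc i) (suc j)    i<j = lookupPairs (suc (suc k)) rs i j (s<s⁻¹ i<j)

-- For a concrete `F` the matrix entries evaluate, and the hypothesis becomes a nested tuple of
-- edges and non-edges of `G`, row by row above the diagonal.
tuple-↪ : ∀ (G : Graph V) (F : Graph (Fin k)) (vs : Vec V k) →
          Pairs k (λ i j → Rel G (adj F i j) (lookup vs i) (lookup vs j)) → F ↪ G
tuple-↪ {k = k} G F vs rels = Rel⇒↪ G F (lookup vs) (lookupPairs k rels)

-- Good matchings

-- The minority colour of a colouring as in ⟨1⟩ or ⟨2⟩.
record GoodMatching (G : Graph V) : Set where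
  infix 4 _~ᴳ_
  _~ᴳ_ : V → V → Set
  _~ᴳ_ = _~_ G
  field
    m        : V → V → Bool
    m-sym    : ∀ {u v} → u ~ᴳ v → T (m u v) → T (m v u)
    matching : ∀ {u v w} → v ~ᴳ u → v ~ᴳ w → T (m v u) → T (m v w) → u ≡ w
    covering : ∀ {u v w} → v ~ᴳ u → v ~ᴳ w → u ≢ w → ¬ u ~ᴳ w → T (m v u) ⊎ T (m v w)

pullback : ∀ {G : Graph V} {H : Graph W} → G ↪ H → GoodMatching H → GoodMatching G
pullback e good = record
  { m        = λ u v → m (map e u) (map e v)
  ; m-sym    = m-sym ∘ map-~ e
  ; matching = λ v~u v~w mvu mvw → injective e (matching (map-~ e v~u) (map-~ e v~w) mvu mvw)
  ; covering = λ v~u v~w u≢w u≁w → covering (map-~ e v~u) (map-~ e v~w) (u≢w ∘ injective e) (u≁w ∘ map-~⁻ e)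
  }
  where open GoodMatching good

module _ {G : Graph V} (good : GoodMatching G) where

  open GoodMatching good

  matched₂ : ∀ v {a b c d} → v ~ᴳ a → v ~ᴳ b → v ~ᴳ c → v ~ᴳ d →
             a ≢ c → a ≢ d → b ≢ c → b ≢ d → T (m v a) ⊎ T (m v b) → T (m v c) ⊎ T (m v d) → ⊥
  matched₂ v va vb vc vd a≢c a≢d b≢c b≢d (inj₁ p) (inj₁ q) = a≢c (matching va vc p q)
  matched₂ v va vb vc vd a≢c a≢d b≢c b≢d (inj₁ p) (inj₂ q) = a≢d (matching va vd p q)
  matched₂ v va vb vc vd a≢c a≢d b≢c b≢d (inj₂ p) (inj₁ q) = b≢c (matching vb vc p q)
  matched₂ v va vb vc vd a≢c a≢d b≢c b≢d (inj₂ p) (inj₂ q) = b≢d (matching vb vd p q)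

  -- Each of the two induced paths centred at `v` needs a matched edge at `v`, and the paths share
  -- no end.
  two-forks : ∀ v {a b c d} → v ~ᴳ a → v ~ᴳ b → v ~ᴳ c → v ~ᴳ d →
              a ≢ c → a ≢ d → b ≢ c → b ≢ d → a ≢ b → ¬ a ~ᴳ b → c ≢ d → ¬ c ~ᴳ d → ⊥
  two-forks v va vb vc vd a≢c a≢d b≢c b≢d a≢b a≁b c≢d c≁d =
    matched₂ v va vb vc vd a≢c a≢d b≢c b≢d (covering va vb a≢b a≁b) (covering vc vd c≢d c≁d)

  -- Were `v a` unmatched, the two induced paths through `a` would force both `v b` and `v c` into
  -- the matching.
  paw-matched : ∀ v {a b c} → v ~ᴳ a → v ~ᴳ b → v ~ᴳ c → a ≢ b → a ≢ c → b ≢ c →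
                ¬ a ~ᴳ b → ¬ a ~ᴳ c → T (m v a)
  paw-matched v va vb vc a≢b a≢c b≢c a≁b a≁c
    with covering va vb a≢b a≁b | covering va vc a≢c a≁c
  ... | inj₁ p | _      = p
  ... | _      | inj₁ p = p
  ... | inj₂ p | inj₂ q = contradiction (matching vb vc p q) b≢c

  matchingʳ : ∀ {u v w} → u ~ᴳ v → w ~ᴳ v → T (m u v) → T (m w v) → u ≡ w
  matchingʳ uv wv p q = matching (~-sym G uv) (~-sym G wv) (m-sym uv p) (m-sym wv q)

  other-unmatched : ∀ {u v w} → v ~ᴳ u → v ~ᴳ w → u ≢ w → ¬ u ~ᴳ w → ¬ T (m v u) → T (m v w)
  other-unmatched vu vw u≢w u≁w ¬p = [ (λ p → contradiction p ¬p) , id ]′ (covering vu vw u≢w u≁w)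

-- The small forbidden graphs have no good matching

module _ (good : GoodMatching (proj₂ claw)) where

  open GoodMatching good

  -- Any two of the three edges at the centre contain a matched one, so at least two of them are
  -- matched.
  bad-claw : ⊥
  bad-claw with covering {# 1} {# 0} {# 2} tt tt (λ ()) (λ ()) | covering {# 1} {# 0} {# 3} tt tt (λ ()) (λ ())
              | covering {# 2} {# 0} {# 3} tt tt (λ ()) (λ ())
  ... | inj₁ p | _      | inj₁ q = case matching {# 1} {# 0} {# 2} tt tt p q of λ ()
  ... | inj₁ p | _      | inj₂ q = case matching {# 1} {# 0} {# 3} tt tt p q of λ ()
  ... | inj₂ p | inj₁ q | _      = case matching {# 2} {# 0} {# 1} tt tt p q of λ ()
  ... | inj₂ p | inj₂ q | _      = case matching {# 2} {# 0} {# 3} tt tt p q of λ ()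

bad-4-wheel : ¬ GoodMatching (proj₂ 4-wheel)
bad-4-wheel good = two-forks good (# 0) {# 1} {# 3} {# 2} {# 4} tt tt tt tt
  (λ ()) (λ ()) (λ ()) (λ ()) (λ ()) (λ ()) (λ ()) (λ ())

bad-gem : ¬ GoodMatching (proj₂ gem)
bad-gem good = two-forks good (# 0) {# 1} {# 3} {# 2} {# 4} tt tt tt tt
  (λ ()) (λ ()) (λ ()) (λ ()) (λ ()) (λ ()) (λ ()) (λ ())

module _ (good : GoodMatching (proj₂ kite)) where

  open GoodMatching good

  -- The pendant edge is matched, so `# 1` is matched to neither `# 3` nor `# 4`; the induced paths
  -- from `# 1` to `# 2` then match both of these to `# 2`.
  bad-kite : ⊥
  bad-kite = case matchingʳ good {# 3} {# 2} {# 4} tt tt (to-2 (# 3) tt tt tt) (to-2 (# 4) tt tt tt) of λ ()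
    where
    matched-10 : T (m (# 1) (# 0))
    matched-10 = paw-matched good (# 1) {# 0} {# 3} {# 4} tt tt tt (λ ()) (λ ()) (λ ()) (λ ()) (λ ())

    to-2 : ∀ i → (# 1) ~ᴳ i → i ~ᴳ (# 1) → i ~ᴳ (# 2) → T (m i (# 2))
    to-2 zero      _   _   ()
    to-2 i@(suc _) 1~i i~1 i~2 = other-unmatched good {# 1} {i} {# 2} i~1 i~2 (λ ()) (λ ())
      (λ p → case matching {# 0} {# 1} {i} tt 1~i matched-10 (m-sym i~1 p) of λ ())

-- By `paw-matched`, each of the two neighbours of `# 0` would be matched to it.
bad-X₁ : ¬ GoodMatching (proj₂ X₁)
bad-X₁ good = case matchingʳ good {# 1} {# 0} {# 2} tt tt
    (paw-matched good (# 1) {# 0} {# 3} {# 4} tt tt tt (λ ()) (λ ()) (λ ()) (λ ()) (λ ()))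
    (paw-matched good (# 2) {# 0} {# 3} {# 4} tt tt tt (λ ()) (λ ()) (λ ()) (λ ()) (λ ()))
  of λ ()

module _ (good : GoodMatching (proj₂ X₂)) where

  open GoodMatching good

  -- The vertices other than `# 2` form a complete graph, and `# 2` sees only `# 3` and `# 4`. Each
  -- of these two is the centre of induced paths from `# 2` to `# 0` and to `# 1`, and so has to be
  -- matched to `# 2`.
  bad-X₂ : ⊥
  bad-X₂ with covering {# 0} {# 3} {# 2} tt tt (λ ()) (λ ()) | covering {# 0} {# 4} {# 2} tt tt (λ ()) (λ ())
            | covering {# 1} {# 3} {# 2} tt tt (λ ()) (λ ()) | covering {# 1} {# 4} {# 2} tt tt (λ ()) (λ ())
  ... | inj₁ p | _      | inj₁ q | _      = case matching {# 0} {# 3} {# 1} tt tt p q of λ ()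
  ... | inj₁ p | _      | inj₂ q | _      = case matching {# 0} {# 3} {# 2} tt tt p q of λ ()
  ... | inj₂ p | _      | inj₁ q | _      = case matching {# 2} {# 3} {# 1} tt tt p q of λ ()
  ... | _      | inj₁ p | _      | inj₁ q = case matching {# 0} {# 4} {# 1} tt tt p q of λ ()
  ... | _      | inj₁ p | _      | inj₂ q = case matching {# 0} {# 4} {# 2} tt tt p q of λ ()
  ... | _      | inj₂ p | _      | inj₁ q = case matching {# 2} {# 4} {# 1} tt tt p q of λ ()
  ... | inj₂ p | inj₂ q | _      | _      = case matchingʳ good {# 3} {# 2} {# 4} tt tt p q of λ ()

module _ (good : GoodMatching (proj₂ K₅-e)) where

  open GoodMatching good

  -- Each of the three vertices `# 2`, `# 3`, `# 4` has to be matched to one of the two non-adjacent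
  -- vertices; two of them choose the same one.
  bad-K₅-e : ⊥
  bad-K₅-e with covering {# 0} {# 2} {# 1} tt tt (λ ()) (λ ()) | covering {# 0} {# 3} {# 1} tt tt (λ ()) (λ ())
              | covering {# 0} {# 4} {# 1} tt tt (λ ()) (λ ())
  ... | inj₁ p | inj₁ q | _      = case matchingʳ good {# 2} {# 0} {# 3} tt tt p q of λ ()
  ... | inj₁ p | _      | inj₁ q = case matchingʳ good {# 2} {# 0} {# 4} tt tt p q of λ ()
  ... | _      | inj₁ p | inj₁ q = case matchingʳ good {# 3} {# 0} {# 4} tt tt p q of λ ()
  ... | inj₂ p | inj₂ q | _      = case matchingʳ good {# 2} {# 1} {# 3} tt tt p q of λ ()
  ... | inj₂ p | _      | inj₂ q = case matchingʳ good {# 2} {# 1} {# 4} tt tt p q of λ ()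
  ... | _      | inj₂ p | inj₂ q = case matchingʳ good {# 3} {# 1} {# 4} tt tt p q of λ ()

odd : ℕ → Bool
odd zero    = false
odd (suc n) = not (odd n)

odd⇒%2 : ∀ n → odd n ≡ true → n % 2 ≡ 1
odd⇒%2 (suc zero)    _  = refl
odd⇒%2 (suc (suc n)) eq = odd⇒%2 n (trans (sym (not-involutive (odd n))) eq)

%2⇒odd : ∀ n → n % 2 ≡ 1 → odd n ≡ true
%2⇒odd (suc zero)    _  = refl
%2⇒odd (suc (suc n)) eq = trans (not-involutive (odd n)) (%2⇒odd n eq)

odd-+ : ∀ m n → odd (m + n) ≡ odd m xor odd n
odd-+ zero    n = refl
odd-+ (suc m) n rewrite odd-+ m n with odd m
... | true  = not-involutive (odd n)
... | false = refl

even-2* : ∀ n → odd (2 * n) ≡ false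
even-2* n rewrite ℕ.+-identityʳ n = trans (odd-+ n n) (xor-same (odd n))

even⇒2* : ∀ n → odd n ≡ false → ∃ λ h → n ≡ 2 * h
even⇒2* zero          _  = 0 , refl
even⇒2* (suc (suc n)) eq with even⇒2* n (trans (sym (not-involutive (odd n))) eq)
... | h , refl = suc h , cong suc (sym (ℕ.+-suc h (h + 0)))

-- Paths, cycles and butterflies in terms of the numbers of the vertices

fromRel-< : ∀ (r : Fin k → Fin k → Bool) {i j} → toℕ i < toℕ j → ¬ T (r j i) → adj (fromRel _≟_ r) i j ≡ r i j
fromRel-< r {i} {j} i<j ¬rji with i ≟ j
... | yes refl = contradiction i<j (ℕ.<-irrefl refl)
... | no  _ with r j i
...   | true  = ⊥-elim (¬rji _)
...   | false = ∨-identityʳ _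

CycleEdge : ℕ → ℕ → ℕ → Set
CycleEdge k i j = suc i ≡ j ⊎ i ≡ 0 × suc j ≡ k

ButterflyEdge : ℕ → ℕ → ℕ → Set
ButterflyEdge n i j = suc i ≡ j ⊎ i ≡ 0 × j ≡ 2 ⊎ i ≡ n + 2 × j ≡ n + 4

module _ {k} {i j : Fin k} (i<j : toℕ i < toℕ j) where

  private
    r : Fin k → Fin k → Bool
    r i j = (suc (toℕ i) ≡ᵇ toℕ j) ∨ ((toℕ i ≡ᵇ 0) ∧ (suc (toℕ j) ≡ᵇ k))

    r⇒CycleEdge : ∀ {i j} → T (r i j) → CycleEdge k (toℕ i) (toℕ j)
    r⇒CycleEdge {i} {j} e with to T-∨ e
    ... | inj₁ p = inj₁ (ℕ.≡ᵇ⇒≡ _ _ p)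
    ... | inj₂ p with to T-∧ p
    ...   | q , q′ = inj₂ (ℕ.≡ᵇ⇒≡ _ _ q , ℕ.≡ᵇ⇒≡ _ _ q′)

    CycleEdge⇒r : CycleEdge k (toℕ i) (toℕ j) → T (r i j)
    CycleEdge⇒r (inj₁ p)        = from T-∨ (inj₁ (ℕ.≡⇒≡ᵇ _ _ p))
    CycleEdge⇒r (inj₂ (p , p′)) = from T-∨ (inj₂ (from T-∧ (ℕ.≡⇒≡ᵇ _ _ p , ℕ.≡⇒≡ᵇ _ _ p′)))

    ¬rji : ¬ T (r j i)
    ¬rji e with r⇒CycleEdge e
    ... | inj₁ eq       = ℕ.<-asym i<j (ℕ.≤-reflexive eq)
    ... | inj₂ (eq , _) = ℕ.n≮0 (subst (toℕ i <_) eq i<j)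

  cycle-~⁻ : _~_ (cycle k) i j → CycleEdge k (toℕ i) (toℕ j)
  cycle-~⁻ e = r⇒CycleEdge (subst T (fromRel-< r i<j ¬rji) e)

  cycle-~⁺ : CycleEdge k (toℕ i) (toℕ j) → _~_ (cycle k) i j
  cycle-~⁺ e = subst T (sym (fromRel-< r i<j ¬rji)) (CycleEdge⇒r e)

module _ n {i j : Fin (n + 5)} (i<j : toℕ i < toℕ j) where

  private
    r : Fin (n + 5) → Fin (n + 5) → Bool
    r i j = (suc (toℕ i) ≡ᵇ toℕ j) ∨ ((toℕ i ≡ᵇ 0) ∧ (toℕ j ≡ᵇ 2)) ∨ ((toℕ i ≡ᵇ n + 2) ∧ (toℕ j ≡ᵇ n + 4))

    r⇒ButterflyEdge : ∀ {i j} → T (r i j) → ButterflyEdge n (toℕ i) (toℕ j)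
    r⇒ButterflyEdge {i} {j} e with to T-∨ e
    ... | inj₁ p = inj₁ (ℕ.≡ᵇ⇒≡ _ _ p)
    ... | inj₂ p with to T-∨ p
    ...   | inj₁ q = let q₁ , q₂ = to T-∧ q in inj₂ (inj₁ (ℕ.≡ᵇ⇒≡ _ _ q₁ , ℕ.≡ᵇ⇒≡ _ _ q₂))
    ...   | inj₂ q = let q₁ , q₂ = to T-∧ q in inj₂ (inj₂ (ℕ.≡ᵇ⇒≡ _ _ q₁ , ℕ.≡ᵇ⇒≡ _ _ q₂))

    ButterflyEdge⇒r : ButterflyEdge n (toℕ i) (toℕ j) → T (r i j)
    ButterflyEdge⇒r (inj₁ p) = from T-∨ (inj₁ (ℕ.≡⇒≡ᵇ _ _ p))
    ButterflyEdge⇒r (inj₂ (inj₁ (p , q))) = from (T-∨ {suc (toℕ i) ≡ᵇ toℕ j}) (inj₂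
      (from T-∨ (inj₁ (from T-∧ (ℕ.≡⇒≡ᵇ _ _ p , ℕ.≡⇒≡ᵇ _ _ q)))))
    ButterflyEdge⇒r (inj₂ (inj₂ (p , q))) = from (T-∨ {suc (toℕ i) ≡ᵇ toℕ j}) (inj₂
      (from (T-∨ {(toℕ i ≡ᵇ 0) ∧ (toℕ j ≡ᵇ 2)}) (inj₂ (from T-∧ (ℕ.≡⇒≡ᵇ _ _ p , ℕ.≡⇒≡ᵇ _ _ q)))))

    ¬rji : ¬ T (r j i)
    ¬rji e with r⇒ButterflyEdge e
    ... | inj₁ eq               = ℕ.<-asym i<j (ℕ.≤-reflexive eq)
    ... | inj₂ (inj₁ (eq , _))  = ℕ.n≮0 (subst (toℕ i <_) eq i<j)
    ... | inj₂ (inj₂ (eq , eq′)) = ℕ.<-asym i<j (subst₂ _<_ (sym eq) (sym eq′) (ℕ.+-monoʳ-< n (s<s (s<s z<s))))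

  butterfly-~⁻ : _~_ (butterfly n) i j → ButterflyEdge n (toℕ i) (toℕ j)
  butterfly-~⁻ e = r⇒ButterflyEdge (subst T (fromRel-< r i<j ¬rji) e)

  butterfly-~⁺ : ButterflyEdge n (toℕ i) (toℕ j) → _~_ (butterfly n) i j
  butterfly-~⁺ e = subst T (sym (fromRel-< r i<j ¬rji)) (ButterflyEdge⇒r e)

module Numbered (k : ℕ) .{{_ : NonZero k}} (F : Graph (Fin k)) (E : ℕ → ℕ → Set)
  (~⁺ : ∀ {i j} → toℕ i < toℕ j → E (toℕ i) (toℕ j) → _~_ F i j)
  (~⁻ : ∀ {i j} → toℕ i < toℕ j → _~_ F i j → E (toℕ i) (toℕ j)) where

  -- Numbers count modulo `k`, so that a walk round a cycle can continue past its starting point.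
  q : ℕ → Fin k
  q i = i mod k

  toℕ-q : ∀ {i} → i < k → toℕ (q i) ≡ i
  toℕ-q {i} i<k = trans (toℕ-fromℕ< (m%n<n i k)) (m<n⇒m%n≡m i<k)

  q-wrap : ∀ i → q (i + k) ≡ q i
  q-wrap i = toℕ-injective
    (trans (toℕ-fromℕ< (m%n<n (i + k) k)) (trans ([m+n]%n≡m%n i k) (sym (toℕ-fromℕ< (m%n<n i k)))))

  q-≢ : ∀ {i j} → i < j → j < k → q i ≢ q j
  q-≢ i<j j<k eq = ℕ.<-irrefl (trans (sym (toℕ-q (ℕ.<-trans i<j j<k))) (trans (cong toℕ eq) (toℕ-q j<k))) i<j

  q-< : ∀ {i j} → i < j → j < k → toℕ (q i) < toℕ (q j)
  q-< i<j j<k = subst₂ _<_ (sym (toℕ-q (ℕ.<-trans i<j j<k))) (sym (toℕ-q j<k)) i<j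

  q-edge : ∀ {i j} → i < j → j < k → E i j → _~_ F (q i) (q j)
  q-edge i<j j<k e = ~⁺ (q-< i<j j<k) (subst₂ E (sym (toℕ-q (ℕ.<-trans i<j j<k))) (sym (toℕ-q j<k)) e)

  q-chord : ∀ {i j} → i < j → j < k → ¬ E i j → q i ≢ q j × ¬ _~_ F (q i) (q j)
  q-chord i<j j<k ¬e = q-≢ i<j j<k ,
    (λ e → ¬e (subst₂ E (toℕ-q (ℕ.<-trans i<j j<k)) (toℕ-q j<k) (~⁻ (q-< i<j j<k) e)))

  q-edgeʳ : ∀ {i j} → i < j → j < k → E i j → _~_ F (q j) (q i)
  q-edgeʳ i<j j<k e = ~-sym F (q-edge i<j j<k e)

  q-chordʳ : ∀ {i j} → i < j → j < k → ¬ E i j → q j ≢ q i × ¬ _~_ F (q j) (q i)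
  q-chordʳ i<j j<k ¬e = let q≢ , q≁ = q-chord i<j j<k ¬e in q≢ ∘ sym , q≁ ∘ ~-sym F

-- Alternation along paths: odd cycles and even butterflies

module _ {G : Graph V} (good : GoodMatching G) where

  open GoodMatching good

  m-comm : ∀ {u v} → u ~ᴳ v → m u v ≡ m v u
  m-comm uv = T-ext (m-sym uv) (m-sym (~-sym G uv))

  m-alternates : ∀ {u v w} → v ~ᴳ u → v ~ᴳ w → u ≢ w → ¬ u ~ᴳ w → m v w ≡ not (m v u)
  m-alternates {u} {v} {w} vu vw u≢w u≁w
    with m v u | m v w | covering vu vw u≢w u≁w | matching vu vw
  ... | true  | true  | _       | unique = contradiction (unique _ _) u≢w
  ... | true  | false | _       | _      = refl
  ... | false | true  | _       | _      = refl
  ... | false | false | inj₁ () | _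
  ... | false | false | inj₂ () | _

  -- Only vertices two steps apart are required to be distinct and non-adjacent; the sequence may
  -- therefore close up, as it does in `bad-cycle`.
  path-alternates : ∀ (p : ℕ → V) m′ → (∀ i → i < m′ → p i ~ᴳ p (suc i)) →
                    (∀ i → suc i < m′ → p i ≢ p (2 + i) × ¬ p i ~ᴳ p (2 + i)) →
                    ∀ i → i < m′ → m (p i) (p (suc i)) ≡ odd i xor m (p 0) (p 1)
  path-alternates p m′ edges chords zero    _    = refl
  path-alternates p m′ edges chords (suc i) i+1<m′ = trans
    (m-alternates (~-sym G p~) (edges (suc i) i+1<m′) (proj₁ (chords i i+1<m′)) (proj₂ (chords i i+1<m′)))
    (trans (cong not (trans (sym (m-comm p~)) (path-alternates p m′ edges chords i (ℕ.<⇒≤ i+1<m′))))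
           (not-xor (odd i)))
    where
    p~ : p i ~ᴳ p (suc i)
    p~ = edges i (ℕ.<⇒≤ i+1<m′)

    not-xor : ∀ a {b} → not (a xor b) ≡ not a xor b
    not-xor true  = not-involutive _
    not-xor false = refl

-- After `k` alternations the walk is back at its first edge with the opposite value. In a triangle
-- vertices two steps apart are adjacent, hence the bound.
bad-cycle : ∀ k → 4 ≤ k → odd k ≡ true → ¬ GoodMatching (cycle k)
bad-cycle k@(suc k′) 4≤k odd-k good = not-¬ refl (sym wrap)
  where
  open GoodMatching good

  open Numbered k (cycle k) (CycleEdge k) cycle-~⁺ cycle-~⁻

  edges : ∀ i → i < suc k → q i ~ᴳ q (suc i)
  edges i (s≤s i≤k) with ℕ.m≤n⇒m<n∨m≡n i≤k
  ... | inj₂ refl = subst₂ _~ᴳ_ (sym (q-wrap 0)) (sym (q-wrap 1))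
                      (q-edge z<s (ℕ.≤-trans (s≤s (s≤s z≤n)) 4≤k) (inj₁ refl))
  ... | inj₁ i<k with ℕ.m≤n⇒m<n∨m≡n i<k
  ...   | inj₁ i+1<k = q-edge (ℕ.n<1+n i) i+1<k (inj₁ refl)
  ...   | inj₂ refl  = subst (q i ~ᴳ_) (sym (q-wrap 0))
                         (q-edgeʳ (ℕ.≤-trans (s≤s z≤n) (s≤s⁻¹ 4≤k)) (ℕ.n<1+n i) (inj₂ (refl , refl)))

  chords : ∀ i → suc i < suc k → q i ≢ q (2 + i) × ¬ q i ~ᴳ q (2 + i)
  chords i (s≤s i<k) with ℕ.m≤n⇒m<n∨m≡n i<k
  ... | inj₂ refl = subst (λ x → q i ≢ x × ¬ q i ~ᴳ x) (sym (q-wrap 1))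
        (q-chordʳ 1<i (ℕ.n<1+n i) λ { (inj₁ eq) → ℕ.<-irrefl eq (s≤s⁻¹ 4≤k) ; (inj₂ (() , _)) })
    where
    1<i : 1 < i
    1<i = ℕ.<⇒≤ (s≤s⁻¹ 4≤k)
  ... | inj₁ i+1<k with ℕ.m≤n⇒m<n∨m≡n i+1<k
  ...   | inj₁ i+2<k = q-chord (ℕ.m<n⇒m<1+n (ℕ.n<1+n i)) i+2<k
        λ { (inj₁ eq) → ℕ.<-irrefl eq (ℕ.n<1+n (suc i)) ; (inj₂ (refl , refl)) → ℕ.<-irrefl refl 4≤k }
  ...   | inj₂ refl = subst (λ x → q i ≢ x × ¬ q i ~ᴳ x) (sym (q-wrap 0))
        (q-chordʳ (ℕ.<⇒≤ 1<i) i+1<k′ λ { (inj₁ eq) → ℕ.<-irrefl eq 1<i ; (inj₂ (_ , eq)) → ℕ.<-irrefl eq (ℕ.n<1+n (suc i)) })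
    where
    1<i : 1 < i
    1<i = s≤s⁻¹ (s≤s⁻¹ 4≤k)
    i+1<k′ : i < 2 + i
    i+1<k′ = ℕ.m<n⇒m<1+n (ℕ.n<1+n i)

  wrap : not (m (q 0) (q 1)) ≡ m (q 0) (q 1)
  wrap = trans (sym (trans (path-alternates good q (suc k) edges chords k (ℕ.n<1+n k)) (cong (_xor m (q 0) (q 1)) odd-k)))
               (cong₂ m (q-wrap 0) (q-wrap 1))

bad-0-butterfly : ¬ GoodMatching (butterfly 0)
bad-0-butterfly good = two-forks good (# 2) {# 0} {# 3} {# 1} {# 4} tt tt tt tt
  (λ ()) (λ ()) (λ ()) (λ ()) (λ ()) (λ ()) (λ ()) (λ ())

-- By `paw-matched`, the connecting path starts and ends with a matched edge, but its last edge is
-- an odd number of alternations away from the first. For `n = 0` there is no such edge, and the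
-- common vertex of the triangles gives the contradiction.
bad-even-butterfly : ∀ n → odd n ≡ false → ¬ GoodMatching (butterfly n)
bad-even-butterfly zero            _      = bad-0-butterfly
bad-even-butterfly n@(suc (suc n′)) even-n good = last-unmatched last-matched
  where
  open GoodMatching good

  open Numbered (n + 5) (butterfly n) (ButterflyEdge n) (butterfly-~⁺ n) (butterfly-~⁻ n)

  -- The connecting path leaves the first triangle at vertex 2.
  p : ℕ → Fin (n + 5)
  p i = q (2 + i)

  bound : ∀ {i} j → j < 5 → i ≤ n → i + j < n + 5
  bound j j<5 i≤n = ℕ.+-mono-≤-< i≤n j<5

  bound′ : ∀ {i} j → j < 5 → i ≤ n → j + i < n + 5
  bound′ {i} j j<5 i≤n = subst (_< n + 5) (ℕ.+-comm i j) (bound j j<5 i≤n)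

  edges : ∀ i → i < n → p i ~ᴳ p (suc i)
  edges i i<n = q-edge (ℕ.n<1+n _) (bound′ 3 (s<s (s<s (s<s z<s))) (ℕ.<⇒≤ i<n)) (inj₁ refl)

  chords : ∀ i → suc i < n → p i ≢ p (2 + i) × ¬ p i ~ᴳ p (2 + i)
  chords i i+1<n = q-chord (ℕ.m<n⇒m<1+n (ℕ.n<1+n _)) (bound′ 4 (s<s (s<s (s<s (s<s z<s)))) (ℕ.<⇒≤ (ℕ.<⇒≤ i+1<n)))
    λ { (inj₁ eq)              → ℕ.<-irrefl eq (ℕ.n<1+n _)
      ; (inj₂ (inj₁ (() , _)))
      ; (inj₂ (inj₂ (eq , _))) → ℕ.<-irrefl (trans eq (ℕ.+-comm n 2)) (s<s (s<s (ℕ.<⇒≤ i+1<n))) }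

  first-matched : T (m (p 0) (p 1))
  first-matched = paw-matched good (q 2) {q 3} {q 0} {q 1}
    (q-edge (s<s (s<s z<s)) (bound 3 (s<s (s<s (s<s z<s))) z≤n) (inj₁ refl))
    (q-edgeʳ z<s (bound 2 (s<s (s<s z<s)) z≤n) (inj₂ (inj₁ (refl , refl))))
    (q-edgeʳ (s<s z<s) (bound 2 (s<s (s<s z<s)) z≤n) (inj₁ refl))
    (proj₁ 3-0) (proj₁ 3-1) (q-≢ z<s (s<s z<s)) (proj₂ 3-0) (proj₂ 3-1)
    where
    3-0 : q 3 ≢ q 0 × ¬ q 3 ~ᴳ q 0
    3-0 = q-chordʳ z<s (bound 3 (s<s (s<s (s<s z<s))) z≤n)
      λ { (inj₁ ()) ; (inj₂ (inj₁ (_ , ()))) ; (inj₂ (inj₂ (() , _))) }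
    3-1 : q 3 ≢ q 1 × ¬ q 3 ~ᴳ q 1
    3-1 = q-chordʳ (s<s z<s) (bound 3 (s<s (s<s (s<s z<s))) z≤n)
      λ { (inj₁ ()) ; (inj₂ (inj₁ (() , _))) ; (inj₂ (inj₂ (() , _))) }

  last-matched : T (m (p (suc n′)) (p n))
  last-matched = m-sym {q (2 + n)} {q (1 + n)} v-a (paw-matched good (q (2 + n)) {q (1 + n)} {q (3 + n)} {q (4 + n)}
    v-a
    (q-edge (ℕ.n<1+n _) (bound′ 3 (s<s (s<s (s<s z<s))) ℕ.≤-refl) (inj₁ refl))
    (q-edge (ℕ.m<n⇒m<1+n (ℕ.n<1+n _)) (bound′ 4 (ℕ.n<1+n 4) ℕ.≤-refl) (inj₂ (inj₂ (ℕ.+-comm 2 n , ℕ.+-comm 4 n))))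
    (proj₁ a-b) (proj₁ a-c)
    (q-≢ (ℕ.n<1+n _) (bound′ 4 (ℕ.n<1+n 4) ℕ.≤-refl))
    (proj₂ a-b) (proj₂ a-c))
    where
    v-a : q (2 + n) ~ᴳ q (1 + n)
    v-a = q-edgeʳ (ℕ.n<1+n _) (bound′ 2 (s<s (s<s z<s)) ℕ.≤-refl) (inj₁ refl)
    a-b : q (1 + n) ≢ q (3 + n) × ¬ q (1 + n) ~ᴳ q (3 + n)
    a-b = q-chord (ℕ.m<n⇒m<1+n (ℕ.n<1+n _)) (bound′ 3 (s<s (s<s (s<s z<s))) ℕ.≤-refl)
      λ { (inj₁ eq) → ℕ.<-irrefl eq (ℕ.n<1+n _) ; (inj₂ (inj₁ (() , _)))
        ; (inj₂ (inj₂ (eq , _))) → ℕ.<-irrefl (trans eq (ℕ.+-comm n 2)) (ℕ.n<1+n (1 + n)) }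
    a-c : q (1 + n) ≢ q (4 + n) × ¬ q (1 + n) ~ᴳ q (4 + n)
    a-c = q-chord (ℕ.m<n⇒m<1+n (ℕ.m<n⇒m<1+n (ℕ.n<1+n _))) (bound′ 4 (ℕ.n<1+n 4) ℕ.≤-refl)
      λ { (inj₁ eq) → ℕ.<-irrefl eq (ℕ.m<n⇒m<1+n (ℕ.n<1+n _)) ; (inj₂ (inj₁ (() , _)))
        ; (inj₂ (inj₂ (eq , _))) → ℕ.<-irrefl (trans eq (ℕ.+-comm n 2)) (ℕ.n<1+n (1 + n)) }

  last-unmatched : ¬ T (m (p (suc n′)) (p n))
  last-unmatched = subst (λ b → ¬ T b) (sym (trans (path-alternates good p n edges chords (suc n′) (ℕ.n<1+n _))
    (cong₂ _xor_ odd-n′ (to T-≡ first-matched)))) id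
    where
    odd-n′ : odd (suc n′) ≡ true
    odd-n′ = trans (sym (not-involutive (odd (suc n′)))) (cong not even-n)

-- Colourings

_≟ᶜ_ : ∀ (a b : Colour) → Dec (a ≡ b)
red  ≟ᶜ red  = yes refl
red  ≟ᶜ blue = no λ ()
blue ≟ᶜ red  = no λ ()
blue ≟ᶜ blue = yes refl

opposite : Colour → Colour
opposite red  = blue
opposite blue = red

opposite-≢ : ∀ a → opposite a ≢ a
opposite-≢ red  ()
opposite-≢ blue ()

≢⇒opposite : ∀ {a b} → b ≢ a → b ≡ opposite a
≢⇒opposite {red}  {red}  b≢a = contradiction refl b≢a
≢⇒opposite {red}  {blue} _   = refl
≢⇒opposite {blue} {red}  _   = refl
≢⇒opposite {blue} {blue} b≢a = contradiction refl b≢a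

module _ {G : Graph V} (c : Colouring G) where

  colour-irrelevant : ∀ {u v u′ v′} → u ≡ u′ → v ≡ v′ → (p : _~_ G u v) (q : _~_ G u′ v′) → colour c u v p ≡ colour c u′ v′ q
  colour-irrelevant {u} {v} refl refl p q = cong (colour c u v) (T-irrelevant p q)

  colour-flip : ∀ {u v a} (p : _~_ G u v) (q : _~_ G v u) → colour c u v p ≡ a → colour c v u q ≡ a
  colour-flip {u} {v} p q = trans (sym (colour-sym c u v p q))

record _↪ᶜ_ (F : ColouredGraph V) (G : ColouredGraph W) : Set where
  field
    embedding  : graph F ↪ graph G
    map-colour : ∀ i j p q → colour (colouring G) (map embedding i) (map embedding j) p ≡ colour (colouring F) i j q

≅ᶜ⇒↩ᶜ : ∀ {G : Graph (Fin n)} {c : Colouring G} {S} {F : Graph V} {d : Colouring F} →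
        inducedᶜ (G , c) S ≅ᶜ (F , d) → (F , d) ↪ᶜ (G , c)
≅ᶜ⇒↩ᶜ {G = G} {c} {S} {F} {d} i = record
  { embedding  = ↪-trans (≅⇒↩ i.iso) (induced↪ G S)
  ; map-colour = λ x y p q → trans (i.to-colour (i.from x) (i.from y) p (to-~ q))
                                   (colour-irrelevant d (strictlyInverseˡ x) (strictlyInverseˡ y) (to-~ q) q)
  }
  where
  module i = _≅ᶜ_ i
  open Inverse (i.bijection) using (strictlyInverseˡ)
  to-~ : ∀ {x y} → _~_ F x y → _~_ F (i.to (i.from x)) (i.to (i.from y))
  to-~ = subst₂ (_~_ F) (sym (strictlyInverseˡ _)) (sym (strictlyInverseˡ _))

module _ {G : Graph (Fin n)} {c : Colouring G} {𝓕 : Pred FinColouredGraph 0ℓ} (free : Freeᶜ 𝓕 (G , c)) where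

  private
    _~ᴳ_ = _~_ G

    module _ (F : Graph (Fin 3)) (d : Colouring F) (vs : Vec (Fin n) 3) where

      SameColour : Fin 3 → Fin 3 → Set
      SameColour i j = (p : lookup vs i ~ᴳ lookup vs j) (q : _~_ F i j) → colour c _ _ p ≡ colour d i j q

      Freeᶜ⇒¬tuple : Pairs 3 (λ i j → Rel G (adj F i j) (lookup vs i) (lookup vs j)) → Pairs 3 SameColour → ¬ 𝓕 (3 , (F , d))
      Freeᶜ⇒¬tuple rels cols = Freeᶜ⇒¬↪ (tuple-↪ G F vs rels) c d same free
        where
        same : ∀ i j → SameColour i j
        same i j p q with <-cmp i j
        ... | tri< i<j _ _  = lookupPairs 3 {SameColour} cols i j i<j p q
        ... | tri≈ _ refl _ = contradiction refl (~⇒≢ F q)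
        ... | tri> _ _ j<i  = trans (colour-sym c _ _ p (~-sym G p))
          (trans (lookupPairs 3 {SameColour} cols j i j<i (~-sym G p) (~-sym F q)) (colour-sym d j i (~-sym F q) q))

  ¬monochromaticP₃ : ∀ {a u v w} (u~v : u ~ᴳ v) (v~w : v ~ᴳ w) → u ≢ w → ¬ u ~ᴳ w →
                     colour c u v u~v ≡ a → colour c v w v~w ≡ a → ¬ 𝓕 (monochromaticP₃ a)
  ¬monochromaticP₃ {a} {u} {v} {w} u~v v~w u≢w u≁w uv vw = Freeᶜ⇒¬tuple (path 3) (colour₃ (path 3) a a a) (u ∷ v ∷ w ∷ [])
    ((u~v , (u≢w , u≁w)) , v~w)
    (((λ p _ → trans (colour-irrelevant c refl refl p u~v) uv) , λ p _ → contradiction p u≁w) ,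
     λ p _ → trans (colour-irrelevant c refl refl p v~w) vw)

  ¬colouredK₃ : ∀ {a₁ a₂ a₃ u v w} (u~v : u ~ᴳ v) (u~w : u ~ᴳ w) (v~w : v ~ᴳ w) →
                colour c u v u~v ≡ a₁ → colour c u w u~w ≡ a₂ → colour c v w v~w ≡ a₃ → ¬ 𝓕 (colouredK₃ a₁ a₂ a₃)
  ¬colouredK₃ {a₁} {a₂} {a₃} {u} {v} {w} u~v u~w v~w uv uw vw = Freeᶜ⇒¬tuple (complete 3) (colour₃ (complete 3) a₁ a₂ a₃) (u ∷ v ∷ w ∷ [])
    ((u~v , u~w) , v~w)
    (((λ p _ → trans (colour-irrelevant c refl refl p u~v) uv) , λ p _ → trans (colour-irrelevant c refl refl p u~w) uw) ,
     λ p _ → trans (colour-irrelevant c refl refl p v~w) vw)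

  module _ (μ : Colour) (P₃∈ : ∀ a → 𝓕 (monochromaticP₃ a))
           (¬two-μ : ∀ {u v w} (v~u : v ~ᴳ u) (v~w : v ~ᴳ w) → u ~ᴳ w → colour c v u v~u ≡ μ → ¬ colour c v w v~w ≡ μ) where

    private
      μ-edge : Fin n → Fin n → Bool
      μ-edge u v with T? (adj G u v)
      ... | yes p = ⌊ colour c u v p ≟ᶜ μ ⌋
      ... | no  _ = false

      μ-edge⁻ : ∀ {u v} (p : u ~ᴳ v) → T (μ-edge u v) → colour c u v p ≡ μ
      μ-edge⁻ {u} {v} p e with T? (adj G u v)
      ... | yes q = trans (colour-irrelevant c refl refl p q) (toWitness e)

      μ-edge⁺ : ∀ {u v} (p : u ~ᴳ v) → colour c u v p ≡ μ → T (μ-edge u v)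
      μ-edge⁺ {u} {v} p e with T? (adj G u v)
      ... | yes q = fromWitness (trans (colour-irrelevant c refl refl q p) e)
      ... | no ¬p = contradiction p ¬p

    -- Two edges of colour `μ` at a vertex are excluded by `¬two-μ` if their other ends are adjacent
    -- and by the path of colour `μ` otherwise. The path of the opposite colour gives `covering`.
    colouring⇒good : GoodMatching G
    colouring⇒good = record
      { m        = μ-edge
      ; m-sym    = λ uv e → μ-edge⁺ (~-sym G uv) (colour-flip c uv _ (μ-edge⁻ uv e))
      ; matching = match
      ; covering = cover
      }
      where
      match : ∀ {u v w} → v ~ᴳ u → v ~ᴳ w → T (μ-edge v u) → T (μ-edge v w) → u ≡ w
      match {u} {v} {w} vu vw p q with u ≟ w | T? (adj G u w)
      ... | yes u≡w | _ = u≡w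
      ... | no _    | yes uw = contradiction (μ-edge⁻ vw q) (¬two-μ vu vw uw (μ-edge⁻ vu p))
      ... | no u≢w  | no u≁w = contradiction (P₃∈ μ)
        (¬monochromaticP₃ (~-sym G vu) vw u≢w u≁w (colour-flip c vu _ (μ-edge⁻ vu p)) (μ-edge⁻ vw q))

      cover : ∀ {u v w} → v ~ᴳ u → v ~ᴳ w → u ≢ w → ¬ u ~ᴳ w → T (μ-edge v u) ⊎ T (μ-edge v w)
      cover vu vw u≢w u≁w with colour c _ _ vu ≟ᶜ μ | colour c _ _ vw ≟ᶜ μ
      ... | yes p | _     = inj₁ (μ-edge⁺ vu p)
      ... | no _  | yes q = inj₂ (μ-edge⁺ vw q)
      ... | no ¬p | no ¬q = contradiction (P₃∈ (opposite μ))
        (¬monochromaticP₃ (~-sym G vu) vw u≢w u≁w (colour-flip c vu _ (≢⇒opposite ¬p)) (≢⇒opposite ¬q))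

module _ {G : Graph (Fin n)} (good : GoodMatching G) (μ : Colour) where

  open GoodMatching good

  colour-by : Bool → Colour
  colour-by true  = μ
  colour-by false = opposite μ

  good⇒colouring : Colouring G
  good⇒colouring = record
    { colour     = λ u v _ → colour-by (m u v)
    ; colour-sym = λ u v p _ → cong colour-by (m-comm good p)
    }

  private
    colour-by⁻ : ∀ {b} → colour-by b ≡ μ → T b
    colour-by⁻ {true}  _  = tt
    colour-by⁻ {false} eq = opposite-≢ μ eq

    colour-by⁺ : ∀ {b} → T b → colour-by b ≡ μ
    colour-by⁺ {true} _ = refl

  monochromaticP₃-↪̸ : ∀ a → ¬ (proj₂ (monochromaticP₃ a) ↪ᶜ (G , good⇒colouring))
  monochromaticP₃-↪̸ a e with a ≟ᶜ μ
  ... | yes refl = case injective f {zero} {suc (suc zero)} (matching (map-~ f {suc zero} {zero} tt) (map-~ f {suc zero} {suc (suc zero)} tt)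
      (colour-by⁻ (map-colour (suc zero) zero (map-~ f {suc zero} {zero} tt) tt))
      (colour-by⁻ (map-colour (suc zero) (suc (suc zero)) (map-~ f {suc zero} {suc (suc zero)} tt) tt))) of λ ()
    where open _↪ᶜ_ e renaming (embedding to f)
  ... | no a≢μ with covering (map-~ f {suc zero} {zero} tt) (map-~ f {suc zero} {suc (suc zero)} tt)
                    (λ eq → case injective f {zero} {suc (suc zero)} eq of λ ()) (map-~⁻ f {zero} {suc (suc zero)})
    where open _↪ᶜ_ e renaming (embedding to f)
  ...   | inj₁ p = a≢μ (trans (sym (map-colour (suc zero) zero (map-~ f {suc zero} {zero} tt) tt)) (colour-by⁺ p))
    where open _↪ᶜ_ e renaming (embedding to f)
  ...   | inj₂ p = a≢μ (trans (sym (map-colour (suc zero) (suc (suc zero)) (map-~ f {suc zero} {suc (suc zero)} tt) tt)) (colour-by⁺ p))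
    where open _↪ᶜ_ e renaming (embedding to f)

  -- Each of the four forbidden triangles has a vertex `j` at which two edges of its minority colour
  -- meet: vertex 2 for the two with blue as minority colour, vertex 0 for the two with red.
  K₃-↪̸ : ∀ {F : Graph (Fin 3)} {d : Colouring F} i j k → i ≢ k → (p : _~_ F j i) (q : _~_ F j k) →
         colour d j i p ≡ μ → colour d j k q ≡ μ → ¬ ((F , d) ↪ᶜ (G , good⇒colouring))
  K₃-↪̸ i j k i≢k p q ji jk e = i≢k (injective f (matching (map-~ f p) (map-~ f q)
    (colour-by⁻ (trans (map-colour j i (map-~ f p) p) ji))
    (colour-by⁻ (trans (map-colour j k (map-~ f q) q) jk))))
    where open _↪ᶜ_ e renaming (embedding to f)

𝓕₁ 𝓕₂ : Pred FinColouredGraph 0ℓ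
𝓕₁ = ｛ ᵇP₃ ｝ ∪ ｛ ʳP₃ ｝ ∪ ｛ ᵇK₃ ｝ ∪ ｛ ʳᵇᵇK₃ ｝
𝓕₂ = ｛ ᵇP₃ ｝ ∪ ｛ ʳP₃ ｝ ∪ ｛ ʳK₃ ｝ ∪ ｛ ʳʳᵇK₃ ｝

module _ {G : Graph (Fin n)} where

  𝓕₁-free⇒good : AdmitsFreeColouring 𝓕₁ G → GoodMatching G
  𝓕₁-free⇒good (c , free) = colouring⇒good free blue (λ { red → inj₂ (inj₁ refl) ; blue → inj₁ refl }) ¬two-blue
    where
    ¬two-blue : ∀ {u v w} (v~u : _~_ G v u) (v~w : _~_ G v w) → _~_ G u w → colour c v u v~u ≡ blue → ¬ colour c v w v~w ≡ blue
    ¬two-blue vu vw uw p q with colour c _ _ uw in eq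
    ... | blue = ¬colouredK₃ free vu vw uw p q eq (inj₂ (inj₂ (inj₁ refl)))
    ... | red  = ¬colouredK₃ free uw (~-sym G vu) (~-sym G vw) eq (colour-flip c vu _ p) (colour-flip c vw _ q)
                   (inj₂ (inj₂ (inj₂ refl)))

  𝓕₂-free⇒good : AdmitsFreeColouring 𝓕₂ G → GoodMatching G
  𝓕₂-free⇒good (c , free) = colouring⇒good free red (λ { red → inj₂ (inj₁ refl) ; blue → inj₁ refl }) ¬two-red
    where
    ¬two-red : ∀ {u v w} (v~u : _~_ G v u) (v~w : _~_ G v w) → _~_ G u w → colour c v u v~u ≡ red → ¬ colour c v w v~w ≡ red
    ¬two-red vu vw uw p q with colour c _ _ uw in eq
    ... | red  = ¬colouredK₃ free vu vw uw p q eq (inj₂ (inj₂ (inj₁ refl)))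
    ... | blue = ¬colouredK₃ free vu vw uw p q eq (inj₂ (inj₂ (inj₂ refl)))

  good⇒𝓕₁-free : GoodMatching G → AdmitsFreeColouring 𝓕₁ G
  good⇒𝓕₁-free good = good⇒colouring good blue , λ where
    S (inj₁ refl)               i → monochromaticP₃-↪̸ good blue blue (≅ᶜ⇒↩ᶜ i)
    S (inj₂ (inj₁ refl))        i → monochromaticP₃-↪̸ good blue red (≅ᶜ⇒↩ᶜ i)
    S (inj₂ (inj₂ (inj₁ refl))) i → K₃-↪̸ good blue (# 0) (# 2) (# 1) (λ ()) tt tt refl refl (≅ᶜ⇒↩ᶜ i)
    S (inj₂ (inj₂ (inj₂ refl))) i → K₃-↪̸ good blue (# 0) (# 2) (# 1) (λ ()) tt tt refl refl (≅ᶜ⇒↩ᶜ i)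

  good⇒𝓕₂-free : GoodMatching G → AdmitsFreeColouring 𝓕₂ G
  good⇒𝓕₂-free good = good⇒colouring good red , λ where
    S (inj₁ refl)               i → monochromaticP₃-↪̸ good red blue (≅ᶜ⇒↩ᶜ i)
    S (inj₂ (inj₁ refl))        i → monochromaticP₃-↪̸ good red red (≅ᶜ⇒↩ᶜ i)
    S (inj₂ (inj₂ (inj₁ refl))) i → K₃-↪̸ good red (# 1) (# 0) (# 2) (λ ()) tt tt refl refl (≅ᶜ⇒↩ᶜ i)
    S (inj₂ (inj₂ (inj₂ refl))) i → K₃-↪̸ good red (# 1) (# 0) (# 2) (λ ()) tt tt refl refl (≅ᶜ⇒↩ᶜ i)

-- Forbidden subgraphs

𝓕₄ : Pred FinGraph 0ℓ
𝓕₄ = ｛ claw ｝ ∪ ｛ 4-wheel ｝ ∪ ｛ gem ｝ ∪ ｛ kite ｝ ∪ ｛ X₁ ｝ ∪ ｛ X₂ ｝ ∪ ｛ K₅-e ｝ ∪ OddHole ∪ EvenButterfly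

good⇒𝓕₄-free : ∀ {G : Graph (Fin n)} → GoodMatching G → Free 𝓕₄ G
good⇒𝓕₄-free good = Free-by λ F∈ e → bad F∈ (pullback e good)
  where
  bad : ∀ {k} {F : Graph (Fin k)} → 𝓕₄ (k , F) → ¬ GoodMatching F
  bad (inj₁ refl) = bad-claw
  bad (inj₂ (inj₁ refl)) = bad-4-wheel
  bad (inj₂ (inj₂ (inj₁ refl))) = bad-gem
  bad (inj₂ (inj₂ (inj₂ (inj₁ refl)))) = bad-kite
  bad (inj₂ (inj₂ (inj₂ (inj₂ (inj₁ refl))))) = bad-X₁
  bad (inj₂ (inj₂ (inj₂ (inj₂ (inj₂ (inj₁ refl)))))) = bad-X₂
  bad (inj₂ (inj₂ (inj₂ (inj₂ (inj₂ (inj₂ (inj₁ refl))))))) = bad-K₅-e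
  bad (inj₂ (inj₂ (inj₂ (inj₂ (inj₂ (inj₂ (inj₂ (inj₁ (k , 5≤k , odd-k , refl))))))))) =
    bad-cycle k (ℕ.<⇒≤ 5≤k) (%2⇒odd k odd-k)
  bad (inj₂ (inj₂ (inj₂ (inj₂ (inj₂ (inj₂ (inj₂ (inj₂ (h , refl))))))))) = bad-even-butterfly (2 * h) (even-2* h)

module Forbidden {G : Graph (Fin n)} (free : Free 𝓕₄ G) where

  ¬claw : ¬ (proj₂ claw ↪ G)
  ¬claw e = Free⇒¬↪ e free (inj₁ refl)

  ¬4-wheel : ¬ (proj₂ 4-wheel ↪ G)
  ¬4-wheel e = Free⇒¬↪ e free (inj₂ (inj₁ refl))

  ¬gem : ¬ (proj₂ gem ↪ G)
  ¬gem e = Free⇒¬↪ e free (inj₂ (inj₂ (inj₁ refl)))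

  ¬kite : ¬ (proj₂ kite ↪ G)
  ¬kite e = Free⇒¬↪ e free (inj₂ (inj₂ (inj₂ (inj₁ refl))))

  ¬X₁ : ¬ (proj₂ X₁ ↪ G)
  ¬X₁ e = Free⇒¬↪ e free (inj₂ (inj₂ (inj₂ (inj₂ (inj₁ refl)))))

  ¬X₂ : ¬ (proj₂ X₂ ↪ G)
  ¬X₂ e = Free⇒¬↪ e free (inj₂ (inj₂ (inj₂ (inj₂ (inj₂ (inj₁ refl))))))

  ¬K₅-e : ¬ (proj₂ K₅-e ↪ G)
  ¬K₅-e e = Free⇒¬↪ e free (inj₂ (inj₂ (inj₂ (inj₂ (inj₂ (inj₂ (inj₁ refl)))))))

  ¬odd-hole : ∀ k → 5 ≤ k → odd k ≡ true → ¬ (cycle k ↪ G)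
  ¬odd-hole k 5≤k odd-k e = Free⇒¬↪ e free
    (inj₂ (inj₂ (inj₂ (inj₂ (inj₂ (inj₂ (inj₂ (inj₁ (k , 5≤k , odd⇒%2 k odd-k , refl)))))))))

  ¬even-butterfly : ∀ n → odd n ≡ false → ¬ (butterfly n ↪ G)
  ¬even-butterfly n even-n e with even⇒2* n even-n
  ... | h , refl = Free⇒¬↪ e free (inj₂ (inj₂ (inj₂ (inj₂ (inj₂ (inj₂ (inj₂ (inj₂ (h , refl)))))))))

-- Diamonds and the vertices around them

module Adjacency (G : Graph V) where

  infix 4 _—_ _⌿_
  _—_ : V → V → Set
  _—_ = _~_ G

  _⌿_ : V → V → Set
  _⌿_ = Rel G false

  —-sym : ∀ {u v} → u — v → v — u
  —-sym = ~-sym G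

  ⌿-sym : ∀ {u v} → u ⌿ v → v ⌿ u
  ⌿-sym (u≢v , u≁v) = u≢v ∘ sym , u≁v ∘ —-sym

  record Diamond (a b c d : V) : Set where
    field
      a⌿b : a ⌿ b
      a—c : a — c
      a—d : a — d
      b—c : b — c
      b—d : b — d
      c—d : c — d

    swap₁ : Diamond b a c d
    swap₁ = record { a⌿b = ⌿-sym a⌿b ; a—c = b—c ; a—d = b—d ; b—c = a—c ; b—d = a—d ; c—d = c—d }

    swap₂ : Diamond a b d c
    swap₂ = record { a⌿b = a⌿b ; a—c = a—d ; a—d = a—c ; b—c = b—d ; b—d = b—c ; c—d = —-sym c—d }

    embedding : diamondGraph ↪ G
    embedding = tuple-↪ G diamondGraph (a ∷ b ∷ c ∷ d ∷ []) ((a⌿b , a—c , a—d) , (b—c , b—d) , c—d)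

  ↪⇒Diamond : (e : diamondGraph ↪ G) → Diamond (map e (# 0)) (map e (# 1)) (map e (# 2)) (map e (# 3))
  ↪⇒Diamond e = record
    { a⌿b = (λ eq → case injective e {# 0} {# 1} eq of λ ()) , map-~⁻ e {# 0} {# 1}
    ; a—c = map-~ e {# 0} {# 2} tt
    ; a—d = map-~ e {# 0} {# 3} tt
    ; b—c = map-~ e {# 1} {# 2} tt
    ; b—d = map-~ e {# 1} {# 3} tt
    ; c—d = map-~ e {# 2} {# 3} tt
    }

module DiamondClosed {G : Graph (Fin n)} (free : Free 𝓕₄ G) where

  open Forbidden free
  open Adjacency G

  module _ {a b c d : Fin n} (D : Diamond a b c d) {y : Fin n} where

    open Diamond D

    ¬only-a : y — a → y ⌿ b → y ⌿ c → y ⌿ d → ⊥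
    ¬only-a ya yb yc yd = ¬kite (tuple-↪ G _ (y ∷ a ∷ b ∷ c ∷ d ∷ [])
      ((ya , yb , yc , yd) , (a⌿b , a—c , a—d) , (b—c , b—d) , c—d))

    ¬c-not-ab : y — c → y ⌿ a → y ⌿ b → ⊥
    ¬c-not-ab yc ya yb = ¬claw (tuple-↪ G _ (c ∷ a ∷ b ∷ y ∷ [])
      ((—-sym a—c , —-sym b—c , —-sym yc) , (a⌿b , ⌿-sym ya) , ⌿-sym yb))

    ¬only-ab : y — a → y — b → y ⌿ c → y ⌿ d → ⊥
    ¬only-ab ya yb yc yd = ¬X₁ (tuple-↪ G _ (y ∷ a ∷ b ∷ c ∷ d ∷ [])
      ((ya , yb , yc , yd) , (a⌿b , a—c , a—d) , (b—c , b—d) , c—d))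

    ¬only-ac : y — a → y ⌿ b → y — c → y ⌿ d → ⊥
    ¬only-ac ya yb yc yd = ¬gem (tuple-↪ G _ (c ∷ y ∷ a ∷ d ∷ b ∷ [])
      ((—-sym yc , —-sym a—c , c—d , —-sym b—c) , (ya , yd , yb) , (a—d , a⌿b) , —-sym b—d))

    ¬only-abc : y — a → y — b → y — c → y ⌿ d → ⊥
    ¬only-abc ya yb yc yd = ¬4-wheel (tuple-↪ G _ (c ∷ y ∷ a ∷ d ∷ b ∷ [])
      ((—-sym yc , —-sym a—c , c—d , —-sym b—c) , (ya , yd , yb) , (a—d , a⌿b) , —-sym b—d))

    ¬only-acd : y — a → y ⌿ b → y — c → y — d → ⊥
    ¬only-acd ya yb yc yd = ¬X₂ (tuple-↪ G _ (y ∷ a ∷ b ∷ c ∷ d ∷ [])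
      ((ya , yb , yc , yd) , (a⌿b , a—c , a—d) , (b—c , b—d) , c—d))

    ¬abcd : y — a → y — b → y — c → y — d → ⊥
    ¬abcd ya yb yc yd = ¬K₅-e (tuple-↪ G _ (a ∷ b ∷ c ∷ d ∷ y ∷ [])
      ((a⌿b , a—c , a—d , —-sym ya) , (b—c , b—d , —-sym yb) , (c—d , —-sym yc) , —-sym yd))

  module _ {a b c d : Fin n} (D : Diamond a b c d) {y : Fin n} where

    open Diamond D

    -- All sixteen neighbourhoods of `y` in the diamond are inspected. Up to the symmetries `swap₁`
    -- and `swap₂`, each non-empty one produces a kite, claw, `X₁`, gem, 4-wheel, `X₂` or `K₅-e`.
    outside-diamond : y ≢ a → y ≢ b → y ≢ c → y ≢ d → y ⌿ a × y ⌿ b × y ⌿ c × y ⌿ d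
    outside-diamond y≢a y≢b y≢c y≢d
      with T? (adj G y a) | T? (adj G y b) | T? (adj G y c) | T? (adj G y d)
    ... | no  ya | no  yb | no  yc | no  yd = (y≢a , ya) , (y≢b , yb) , (y≢c , yc) , (y≢d , yd)
    ... | yes ya | no  yb | no  yc | no  yd = ⊥-elim (¬only-a D ya (y≢b , yb) (y≢c , yc) (y≢d , yd))
    ... | no  ya | yes yb | no  yc | no  yd = ⊥-elim (¬only-a swap₁ yb (y≢a , ya) (y≢c , yc) (y≢d , yd))
    ... | no  ya | no  yb | yes yc | _      = ⊥-elim (¬c-not-ab D yc (y≢a , ya) (y≢b , yb))
    ... | no  ya | no  yb | no  yc | yes yd = ⊥-elim (¬c-not-ab swap₂ yd (y≢a , ya) (y≢b , yb))
    ... | yes ya | yes yb | no  yc | no  yd = ⊥-elim (¬only-ab D ya yb (y≢c , yc) (y≢d , yd))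
    ... | yes ya | no  yb | yes yc | no  yd = ⊥-elim (¬only-ac D ya (y≢b , yb) yc (y≢d , yd))
    ... | yes ya | no  yb | no  yc | yes yd = ⊥-elim (¬only-ac swap₂ ya (y≢b , yb) yd (y≢c , yc))
    ... | no  ya | yes yb | yes yc | no  yd = ⊥-elim (¬only-ac swap₁ yb (y≢a , ya) yc (y≢d , yd))
    ... | no  ya | yes yb | no  yc | yes yd = ⊥-elim (¬only-ac (Diamond.swap₂ swap₁) yb (y≢a , ya) yd (y≢c , yc))
    ... | yes ya | yes yb | yes yc | no  yd = ⊥-elim (¬only-abc D ya yb yc (y≢d , yd))
    ... | yes ya | yes yb | no  yc | yes yd = ⊥-elim (¬only-abc swap₂ ya yb yd (y≢c , yc))
    ... | yes ya | no  yb | yes yc | yes yd = ⊥-elim (¬only-acd D ya (y≢b , yb) yc yd)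
    ... | no  ya | yes yb | yes yc | yes yd = ⊥-elim (¬only-acd swap₁ yb (y≢a , ya) yc yd)
    ... | yes ya | yes yb | yes yc | yes yd = ⊥-elim (¬abcd D ya yb yc yd)

  diamond-closed : (e : diamondGraph ↪ G) → ∀ i {y} → map e i — y → ∃ λ j → map e j ≡ y
  diamond-closed e i {y} i—y with any? (λ j → map e j ≟ y)
  ... | yes ∃j = ∃j
  ... | no ∄j  = contradiction (—-sym i—y) (proj₂ (y⌿ i))
    where
    y≢ : ∀ j → y ≢ map e j
    y≢ j eq = ∄j (j , sym eq)
    all⌿ : y ⌿ map e (# 0) × y ⌿ map e (# 1) × y ⌿ map e (# 2) × y ⌿ map e (# 3)
    all⌿ = outside-diamond (↪⇒Diamond e) (y≢ _) (y≢ _) (y≢ _) (y≢ _)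
    y⌿ : ∀ i → y ⌿ map e i
    y⌿ zero                   = proj₁ all⌿
    y⌿ (suc zero)             = proj₁ (proj₂ all⌿)
    y⌿ (suc (suc zero))       = proj₁ (proj₂ (proj₂ all⌿))
    y⌿ (suc (suc (suc zero))) = proj₂ (proj₂ (proj₂ all⌿))

  diamond-component : (e : diamondGraph ↪ G) → ∀ {S} → IsComponent G S → ∀ i → map e i ∈ S → IsDiamond (induced G S)
  diamond-component e {S} (r , S⇔) i ei∈S = image-≅ e S⇒image image⇒S
    where
    reach : ∀ {u v} → (∃ λ j → map e j ≡ u) → Star _—_ u v → ∃ λ j → map e j ≡ v
    reach p          ε        = p
    reach (j , refl) (e₁ ◅ w) = reach (diamond-closed e j e₁) w

    r∈image : ∃ λ j → map e j ≡ r
    r∈image = reach (i , refl) (reverse —-sym (to (S⇔ _) ei∈S))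

    S⇒image : ∀ v → v ∈ S → ∃ λ j → map e j ≡ v
    S⇒image v v∈S = reach r∈image (to (S⇔ v) v∈S)

    _~ᴰ_ = _~_ diamondGraph

    connected : ∀ i j → Star _~ᴰ_ i j
    connected i j = to-2 i ◅◅ reverse (λ {i j} → ~-sym diamondGraph {i} {j}) (to-2 j)
      where
      to-2 : ∀ i → Star _~ᴰ_ i (# 2)
      to-2 zero                   = tt ◅ ε
      to-2 (suc zero)             = tt ◅ ε
      to-2 (suc (suc zero))       = ε
      to-2 (suc (suc (suc zero))) = tt ◅ ε

    image⇒S : ∀ j → map e j ∈ S
    image⇒S j = from (S⇔ _) (to (S⇔ _) ei∈S ◅◅ gmap (map e) (map-~ e) (connected i j))

-- Line graphs of incidence graphs

∣p∪q∣≤∣p∣+∣q∣ : ∀ (p q : Subset n) → ∣ p ∪ˢ q ∣ ≤ ∣ p ∣ + ∣ q ∣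
∣p∪q∣≤∣p∣+∣q∣ []          []          = z≤n
∣p∪q∣≤∣p∣+∣q∣ (false ∷ p) (false ∷ q) = ∣p∪q∣≤∣p∣+∣q∣ p q
∣p∪q∣≤∣p∣+∣q∣ (false ∷ p) (true ∷ q)  = subst (suc ∣ p ∪ˢ q ∣ ≤_) (sym (ℕ.+-suc ∣ p ∣ ∣ q ∣)) (s≤s (∣p∪q∣≤∣p∣+∣q∣ p q))
∣p∪q∣≤∣p∣+∣q∣ (true ∷ p)  (false ∷ q) = s≤s (∣p∪q∣≤∣p∣+∣q∣ p q)
∣p∪q∣≤∣p∣+∣q∣ (true ∷ p)  (true ∷ q)  = s≤s (ℕ.≤-trans (∣p∪q∣≤∣p∣+∣q∣ p q) (ℕ.+-monoʳ-≤ ∣ p ∣ (ℕ.n≤1+n ∣ q ∣)))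

covered⇒∣p∣≤2 : ∀ {p : Subset n} a b → (∀ {x} → x ∈ p → x ≡ a ⊎ x ≡ b) → ∣ p ∣ ≤ 2
covered⇒∣p∣≤2 {p = p} a b cover = ℕ.≤-trans
  (p⊆q⇒∣p∣≤∣q∣ {q = ⁅ a ⁆ ∪ˢ ⁅ b ⁆} (λ x∈p → [ (λ { refl → p⊆p∪q ⁅ b ⁆ (x∈⁅x⁆ a) }) , (λ { refl → q⊆p∪q ⁅ a ⁆ ⁅ b ⁆ (x∈⁅x⁆ b) }) ]′ (cover x∈p)))
  (ℕ.≤-trans (∣p∪q∣≤∣p∣+∣q∣ ⁅ a ⁆ ⁅ b ⁆) (ℕ.≤-reflexive (cong₂ _+_ (∣⁅x⁆∣≡1 a) (∣⁅x⁆∣≡1 b))))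

∣p∣≤2⇒repetition : ∀ {p : Subset n} {a b c} → a ∈ p → b ∈ p → c ∈ p → ∣ p ∣ ≤ 2 → a ≡ b ⊎ a ≡ c ⊎ b ≡ c
∣p∣≤2⇒repetition {p = p} {a} {b} {c} a∈p b∈p c∈p ∣p∣≤2 with a ≟ b | a ≟ c | b ≟ c
... | yes a≡b | _ | _ = inj₁ a≡b
... | no _ | yes a≡c | _ = inj₂ (inj₁ a≡c)
... | no _ | no _ | yes b≡c = inj₂ (inj₂ b≡c)
... | no a≢b | no a≢c | no b≢c = contradiction ∣p∣≤2 (ℕ.<⇒≱ (begin-strict
  2                     ≤⟨ s≤s (s≤s z≤n) ⟩
  2 + ∣ p - a - b - c ∣ <⟨ s<s (s<s (x∈p⇒∣p-x∣<∣p∣ (x∈p∧x≢y⇒x∈p-y (x∈p∧x≢y⇒x∈p-y c∈p (a≢c ∘ sym)) (b≢c ∘ sym)))) ⟩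
  2 + ∣ p - a - b ∣     ≤⟨ s≤s (x∈p⇒∣p-x∣<∣p∣ (x∈p∧x≢y⇒x∈p-y b∈p (a≢b ∘ sym))) ⟩
  1 + ∣ p - a ∣         ≤⟨ x∈p⇒∣p-x∣<∣p∣ a∈p ⟩
  ∣ p ∣                 ∎))
  where open ℕ.≤-Reasoning

-- G as the line graph of an incidence graph with classes A and B: the vertex v
-- of G is the edge {x v , y v}.
record IncidenceStructure (G : Graph V) (A B : Set) : Set where
  field
    x          : V → A
    y          : V → B
    injective₂ : ∀ {u v} → x u ≡ x v → y u ≡ y v → u ≡ v
    ~⇒share    : ∀ {u v} → _~_ G u v → x u ≡ x v ⊎ y u ≡ y v
    share⇒~    : ∀ {u v} → u ≢ v → x u ≡ x v ⊎ y u ≡ y v → _~_ G u v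
    x-degree≤2 : ∀ {u v w} → x u ≡ x v → x u ≡ x w → u ≡ v ⊎ u ≡ w ⊎ v ≡ w

-- The matched pairs are those that share their end in the class of degree at most 2. If `v` shares
-- that end with neither neighbour, all three vertices share their end in the other class, so the
-- neighbours are adjacent.
incidence⇒good : ∀ {G : Graph V} {B : Set} {m} → IncidenceStructure G (Fin m) B → GoodMatching G
incidence⇒good {G = G} I = record
  -- This is true on the diagonal as well; `GoodMatching` constrains `m` on edges only.
  { m        = λ u v → ⌊ x u ≟ x v ⌋
  ; m-sym    = λ _ p → fromWitness (sym (toWitness p))
  ; matching = λ vu vw p q → case x-degree≤2 (toWitness p) (toWitness q) of λ where
      (inj₁ v≡u)        → contradiction v≡u (~⇒≢ G vu)
      (inj₂ (inj₁ v≡w)) → contradiction v≡w (~⇒≢ G vw)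
      (inj₂ (inj₂ u≡w)) → u≡w
  ; covering = λ vu vw u≢w u≁w → cover u≢w u≁w (~⇒share vu) (~⇒share vw)
  }
  where
  open IncidenceStructure I
  cover : ∀ {u v w} → u ≢ w → ¬ _~_ G u w → x v ≡ x u ⊎ y v ≡ y u → x v ≡ x w ⊎ y v ≡ y w → T ⌊ x v ≟ x u ⌋ ⊎ T ⌊ x v ≟ x w ⌋
  cover _   _   (inj₁ p) _        = inj₁ (fromWitness p)
  cover _   _   (inj₂ _) (inj₁ q) = inj₂ (fromWitness q)
  cover u≢w u≁w (inj₂ p) (inj₂ q) = contradiction (share⇒~ u≢w (inj₂ (trans (sym p) q))) u≁w

module _ {m} {H : Graph (Fin m)} where

  edge-≡ : ∀ {e f : Edge H} → end₁ e ≡ end₁ f → end₂ e ≡ end₂ f → e ≡ f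
  edge-≡ {edge u v p q} {edge .u .v p′ q′} refl refl = cong₂ (edge u v) (<-irrelevant p p′) (T-irrelevant q q′)

  ShareEnd : Edge H → Edge H → Set
  ShareEnd e f = end₁ e ≡ end₁ f ⊎ end₁ e ≡ end₂ f ⊎ end₂ e ≡ end₁ f ⊎ end₂ e ≡ end₂ f

  private
    share : Edge H → Edge H → Bool
    share e f = ⌊ end₁ e ≟ end₁ f ⌋ ∨ ⌊ end₁ e ≟ end₂ f ⌋ ∨ ⌊ end₂ e ≟ end₁ f ⌋ ∨ ⌊ end₂ e ≟ end₂ f ⌋

    share⁻ : ∀ e f → T (share e f) → ShareEnd e f
    share⁻ e f p with end₁ e ≟ end₁ f | end₁ e ≟ end₂ f | end₂ e ≟ end₁ f | end₂ e ≟ end₂ f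
    ... | yes q | _ | _ | _ = inj₁ q
    ... | no _ | yes q | _ | _ = inj₂ (inj₁ q)
    ... | no _ | no _ | yes q | _ = inj₂ (inj₂ (inj₁ q))
    ... | no _ | no _ | no _ | yes q = inj₂ (inj₂ (inj₂ q))

    share⁺ : ∀ e f → ShareEnd e f → T (share e f)
    share⁺ e f p with end₁ e ≟ end₁ f | end₁ e ≟ end₂ f | end₂ e ≟ end₁ f | end₂ e ≟ end₂ f
    ... | yes _ | _ | _ | _ = tt
    ... | no _ | yes _ | _ | _ = tt
    ... | no _ | no _ | yes _ | _ = tt
    ... | no _ | no _ | no _ | yes _ = tt
    ... | no ¬a | no ¬b | no ¬c | no ¬d = [ ¬a , [ ¬b , [ ¬c , ¬d ]′ ]′ ]′ p

  lineGraph-~⁻ : ∀ {e f} → _~_ (lineGraph H) e f → e ≢ f × ShareEnd e f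
  lineGraph-~⁻ {e} {f} e~f with e ≟ᴱ f
  ... | no e≢f = e≢f , [ share⁻ e f , flip ∘ share⁻ f e ]′ (to T-∨ e~f)
    where
    flip : ShareEnd f e → ShareEnd e f
    flip (inj₁ p) = inj₁ (sym p)
    flip (inj₂ (inj₁ p)) = inj₂ (inj₂ (inj₁ (sym p)))
    flip (inj₂ (inj₂ (inj₁ p))) = inj₂ (inj₁ (sym p))
    flip (inj₂ (inj₂ (inj₂ p))) = inj₂ (inj₂ (inj₂ (sym p)))

  lineGraph-~⁺ : ∀ {e f} → e ≢ f → ShareEnd e f → _~_ (lineGraph H) e f
  lineGraph-~⁺ {e} {f} e≢f s with e ≟ᴱ f
  ... | yes e≡f = contradiction e≡f e≢f
  ... | no _    = from T-∨ (inj₁ (share⁺ e f s))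

  module _ (X : Subset m) (bip : IsBipartition H X) (deg : ∀ x → x ∈ X → degree H x ≤ 2) where

    private
      -- The ends of an `Edge` are ordered by number, not by side of the bipartition, and have to be
      -- sorted into the classes.
      xy-ends : ∀ (e : Edge H) → Σ (Fin m × Fin m) λ (x , y) → x ∈ X × y ∉ X × _~_ H x y ×
                (end₁ e ≡ x × end₂ e ≡ y ⊎ end₁ e ≡ y × end₂ e ≡ x)
      xy-ends (edge u v _ u~v) with u ∈? X | v ∈? X
      ... | yes u∈ | yes v∈ = contradiction u~v (proj₁ bip u v u∈ v∈)
      ... | yes u∈ | no v∉  = (u , v) , u∈ , v∉ , u~v , inj₁ (refl , refl)
      ... | no u∉  | yes v∈ = (v , u) , v∈ , u∉ , ~-sym H u~v , inj₂ (refl , refl)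
      ... | no u∉  | no v∉  = contradiction u~v (proj₂ bip u v (x∉p⇒x∈∁p u∉) (x∉p⇒x∈∁p v∉))

      xᴱ yᴱ : Edge H → Fin m
      xᴱ e = proj₁ (proj₁ (xy-ends e))
      yᴱ e = proj₂ (proj₁ (xy-ends e))

      crossed : ∀ {e f : Edge H} → end₁ e ≡ end₂ f → end₂ e ≡ end₁ f → ⊥
      crossed {e} {f} p q = ℕ.<-asym (ordered e) (subst₂ (λ a b → toℕ a < toℕ b) (sym q) (sym p) (ordered f))

      inj : ∀ {e f} → xᴱ e ≡ xᴱ f → yᴱ e ≡ yᴱ f → e ≡ f
      inj {e} {f} p q with xy-ends e | xy-ends f
      ... | _ , _ , _ , _ , inj₁ (a , b) | _ , _ , _ , _ , inj₁ (c , d) = edge-≡ (trans a (trans p (sym c))) (trans b (trans q (sym d)))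
      ... | _ , _ , _ , _ , inj₂ (a , b) | _ , _ , _ , _ , inj₂ (c , d) = edge-≡ (trans a (trans q (sym c))) (trans b (trans p (sym d)))
      ... | _ , _ , _ , _ , inj₁ (a , b) | _ , _ , _ , _ , inj₂ (c , d) = ⊥-elim (crossed {e} {f} (trans a (trans p (sym d))) (trans b (trans q (sym c))))
      ... | _ , _ , _ , _ , inj₂ (a , b) | _ , _ , _ , _ , inj₁ (c , d) = ⊥-elim (crossed {e} {f} (trans a (trans q (sym d))) (trans b (trans p (sym c))))

      IsEnd : Fin m → Edge H → Set
      IsEnd z e = z ≡ xᴱ e ⊎ z ≡ yᴱ e

      end₁-IsEnd : ∀ e → IsEnd (end₁ e) e
      end₁-IsEnd e with xy-ends e
      ... | _ , _ , _ , _ , inj₁ (a , _) = inj₁ a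
      ... | _ , _ , _ , _ , inj₂ (a , _) = inj₂ a

      end₂-IsEnd : ∀ e → IsEnd (end₂ e) e
      end₂-IsEnd e with xy-ends e
      ... | _ , _ , _ , _ , inj₁ (_ , b) = inj₂ b
      ... | _ , _ , _ , _ , inj₂ (_ , b) = inj₁ b

      xᴱ∈X : ∀ e → xᴱ e ∈ X
      xᴱ∈X e = proj₁ (proj₂ (xy-ends e))

      yᴱ∉X : ∀ e → yᴱ e ∉ X
      yᴱ∉X e = proj₁ (proj₂ (proj₂ (xy-ends e)))

      common-end : ∀ {z e f} → IsEnd z e → IsEnd z f → xᴱ e ≡ xᴱ f ⊎ yᴱ e ≡ yᴱ f
      common-end (inj₁ p) (inj₁ q) = inj₁ (trans (sym p) q)
      common-end (inj₂ p) (inj₂ q) = inj₂ (trans (sym p) q)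
      common-end {e = e} {f} (inj₁ p) (inj₂ q) = contradiction (subst (_∈ X) (trans (sym p) q) (xᴱ∈X e)) (yᴱ∉X f)
      common-end {e = e} {f} (inj₂ p) (inj₁ q) = contradiction (subst (_∈ X) (trans (sym q) p) (xᴱ∈X f)) (yᴱ∉X e)

      share⇒xy : ∀ {e f} → ShareEnd e f → xᴱ e ≡ xᴱ f ⊎ yᴱ e ≡ yᴱ f
      share⇒xy {e} {f} (inj₁ p) = common-end {e = e} {f} (end₁-IsEnd e) (subst (λ z → IsEnd z f) (sym p) (end₁-IsEnd f))
      share⇒xy {e} {f} (inj₂ (inj₁ p)) = common-end {e = e} {f} (end₁-IsEnd e) (subst (λ z → IsEnd z f) (sym p) (end₂-IsEnd f))
      share⇒xy {e} {f} (inj₂ (inj₂ (inj₁ p))) = common-end {e = e} {f} (end₂-IsEnd e) (subst (λ z → IsEnd z f) (sym p) (end₁-IsEnd f))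
      share⇒xy {e} {f} (inj₂ (inj₂ (inj₂ p))) = common-end {e = e} {f} (end₂-IsEnd e) (subst (λ z → IsEnd z f) (sym p) (end₂-IsEnd f))

      xy⇒share : ∀ {e f} → xᴱ e ≡ xᴱ f ⊎ yᴱ e ≡ yᴱ f → ShareEnd e f
      xy⇒share {e} {f} s with xy-ends e | xy-ends f | s
      ... | _ , _ , _ , _ , inj₁ (a , b) | _ , _ , _ , _ , inj₁ (c , d) | inj₁ p = inj₁ (trans a (trans p (sym c)))
      ... | _ , _ , _ , _ , inj₁ (a , b) | _ , _ , _ , _ , inj₁ (c , d) | inj₂ q = inj₂ (inj₂ (inj₂ (trans b (trans q (sym d)))))
      ... | _ , _ , _ , _ , inj₁ (a , b) | _ , _ , _ , _ , inj₂ (c , d) | inj₁ p = inj₂ (inj₁ (trans a (trans p (sym d))))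
      ... | _ , _ , _ , _ , inj₁ (a , b) | _ , _ , _ , _ , inj₂ (c , d) | inj₂ q = inj₂ (inj₂ (inj₁ (trans b (trans q (sym c)))))
      ... | _ , _ , _ , _ , inj₂ (a , b) | _ , _ , _ , _ , inj₁ (c , d) | inj₁ p = inj₂ (inj₂ (inj₁ (trans b (trans p (sym c)))))
      ... | _ , _ , _ , _ , inj₂ (a , b) | _ , _ , _ , _ , inj₁ (c , d) | inj₂ q = inj₂ (inj₁ (trans a (trans q (sym d))))
      ... | _ , _ , _ , _ , inj₂ (a , b) | _ , _ , _ , _ , inj₂ (c , d) | inj₁ p = inj₂ (inj₂ (inj₂ (trans b (trans p (sym d)))))
      ... | _ , _ , _ , _ , inj₂ (a , b) | _ , _ , _ , _ , inj₂ (c , d) | inj₂ q = inj₁ (trans a (trans q (sym c)))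

      neighbour : ∀ {e x} → x ≡ xᴱ e → yᴱ e ∈ tabulate (adj H x)
      neighbour {e} refl = lookup⇒[]= _ _ (trans (lookup∘tabulate (adj H (xᴱ e)) (yᴱ e)) (to T-≡ (proj₁ (proj₂ (proj₂ (proj₂ (xy-ends e)))))))

      degree≤2 : ∀ {e f g} → xᴱ e ≡ xᴱ f → xᴱ e ≡ xᴱ g → e ≡ f ⊎ e ≡ g ⊎ f ≡ g
      degree≤2 {e} {f} {g} p q
        with ∣p∣≤2⇒repetition (neighbour {e} refl) (neighbour {f} p) (neighbour {g} q) (deg _ (xᴱ∈X e))
      ... | inj₁ r        = inj₁ (inj {e} {f} p r)
      ... | inj₂ (inj₁ r) = inj₂ (inj₁ (inj {e} {g} q r))
      ... | inj₂ (inj₂ r) = inj₂ (inj₂ (inj {f} {g} (trans (sym p) q) r))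

    lineGraph-incidence : IncidenceStructure (lineGraph H) (Fin m) (Fin m)
    lineGraph-incidence = record
      { x = xᴱ ; y = yᴱ ; injective₂ = λ {e} {f} → inj {e} {f}
      ; ~⇒share = λ {e} {f} e~f → share⇒xy {e} {f} (proj₂ (lineGraph-~⁻ {e} {f} e~f))
      ; share⇒~ = λ {e} {f} e≢f s → lineGraph-~⁺ {e} {f} e≢f (xy⇒share {e} {f} s)
      ; x-degree≤2 = λ {e} {f} {g} → degree≤2 {e} {f} {g}
      }

-- From incidence structures to line graphs

anyMember? : ∀ (S : Subset n) {P : Members S → Set} → Decidable P → Dec (∃ P)
anyMember? S {P} P? = map′ (λ (u , u∈S , p) → (u , u∈S) , p) (λ ((u , u∈S) , p) → u , u∈S , p) (any? member)
  where
  member : ∀ u → Dec (Σ (u ∈ S) λ u∈S → P (u , u∈S))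
  member u with u ∈? S
  ... | no u∉S = no (u∉S ∘ proj₁)
  ... | yes u∈S = map′ (u∈S ,_) (λ (_ , p) → subst P (Members-≡ refl) p) (P? (u , u∈S))

module _ {G : Graph V} (searchable : ∀ {P : V → Set} → Decidable P → Dec (∃ P)) {a b}
         (I : IncidenceStructure G (Fin a) (Fin b)) where

  open IncidenceStructure I

  private
    present? : ∀ i j → Dec (∃ λ v → x v ≡ i × y v ≡ j)
    present? i j = searchable λ v → x v ≟ i ×-dec y v ≟ j

    incident : Fin a ⊎ Fin b → Fin a ⊎ Fin b → Bool
    incident (inj₁ i) (inj₂ j) = ⌊ present? i j ⌋
    incident (inj₂ j) (inj₁ i) = ⌊ present? i j ⌋
    incident _        _        = false

    incident⁻ : ∀ s t → T (incident s t) →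
                (∃₂ λ i j → s ≡ inj₁ i × t ≡ inj₂ j × ∃ λ v → x v ≡ i × y v ≡ j) ⊎
                (∃₂ λ i j → s ≡ inj₂ j × t ≡ inj₁ i)
    incident⁻ (inj₁ i) (inj₂ j) p = inj₁ (i , j , refl , refl , toWitness p)
    incident⁻ (inj₂ j) (inj₁ i) _ = inj₂ (i , j , refl , refl)

    incident-sym : ∀ s t → incident s t ≡ incident t s
    incident-sym (inj₁ _) (inj₁ _) = refl
    incident-sym (inj₁ _) (inj₂ _) = refl
    incident-sym (inj₂ _) (inj₁ _) = refl
    incident-sym (inj₂ _) (inj₂ _) = refl

    incident-irrefl : ∀ s → incident s s ≡ false
    incident-irrefl (inj₁ _) = refl
    incident-irrefl (inj₂ _) = refl

    -- The numbers of the first class precede those of the second, so the increasing enumeration of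
    -- an edge always begins with its end in the first class, and `toEdge` needs no case
    -- distinction.
    H : Graph (Fin (a + b))
    H = record
      { adj        = λ s t → incident (splitAt a {b} s) (splitAt a {b} t)
      ; adj-sym    = λ s t → incident-sym (splitAt a {b} s) (splitAt a {b} t)
      ; adj-irrefl = λ s → incident-irrefl (splitAt a {b} s)
      }

    left? : ∀ s → Dec (∃ λ i → splitAt a {b} s ≡ inj₁ i)
    left? s with splitAt a {b} s
    ... | inj₁ i = yes (i , refl)
    ... | inj₂ _ = no λ ()

    X : Subset (a + b)
    X = ⟦ left? ⟧

    X-independent : Independent H X
    X-independent s t s∈ t∈ with splitAt a {b} s | splitAt a {b} t | ∈⟦⟧⁻ left? s∈ | ∈⟦⟧⁻ left? t∈
    ... | inj₁ _ | inj₁ _ | _ | _ = id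
    ... | inj₂ _ | _ | _ , () | _
    ... | inj₁ _ | inj₂ _ | _ | _ , ()

    ∁X-independent : Independent H (∁ X)
    ∁X-independent s t s∈ t∈ with splitAt a {b} s in eq | splitAt a {b} t in eq′
    ... | inj₁ i | _ = λ _ → x∈∁p⇒x∉p s∈ (∈⟦⟧⁺ left? (i , eq))
    ... | inj₂ _ | inj₁ j = λ _ → x∈∁p⇒x∉p t∈ (∈⟦⟧⁺ left? (j , eq′))
    ... | inj₂ _ | inj₂ _ = id

    neighbours : ∀ {s t i} → splitAt a {b} s ≡ inj₁ i → t ∈ tabulate (adj H s) → ∃ λ v → x v ≡ i × t ≡ a ↑ʳ y v
    neighbours {s} {t} eq t∈ with incident⁻ (splitAt a {b} s) (splitAt a {b} t)
                                    (from T-≡ (trans (sym (lookup∘tabulate (adj H s) t)) ([]=⇒lookup t∈)))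
    ... | inj₁ (_ , _ , eq′ , eq″ , v , refl , refl) =
      v , inj₁-injective (trans (sym eq′) eq) , sym (splitAt⁻¹-↑ʳ eq″)
    ... | inj₂ (_ , _ , eq′ , _) = case trans (sym eq′) eq of λ ()

    X-degree≤2 : ∀ s → s ∈ X → degree H s ≤ 2
    X-degree≤2 s s∈X with ∈⟦⟧⁻ left? s∈X
    ... | i , eq with searchable (λ v → x v ≟ i)
    -- Nothing has its first end at `s`, which is then isolated; the covering pair is arbitrary.
    ...   | no ∄v = covered⇒∣p∣≤2 s s λ t∈ → let v , p , _ = neighbours eq t∈ in contradiction (v , p) ∄v
    ...   | yes (v , xv) with searchable (λ w → x w ≟ i ×-dec ¬? (y w ≟ y v))
    -- Every vertex with first end `s` has the second end of `v`; the single neighbour is listed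
    -- twice.
    ...     | no ∄w = covered⇒∣p∣≤2 (a ↑ʳ y v) (a ↑ʳ y v) cover
      where
      cover : ∀ {t} → t ∈ tabulate (adj H s) → t ≡ a ↑ʳ y v ⊎ t ≡ a ↑ʳ y v
      cover t∈ with neighbours eq t∈
      ... | u , xu , refl with y u ≟ y v
      ...   | yes p = inj₁ (cong (a ↑ʳ_) p)
      ...   | no ¬p = contradiction (u , xu , ¬p) ∄w
    ...     | yes (w , xw , yw≢yv) = covered⇒∣p∣≤2 (a ↑ʳ y v) (a ↑ʳ y w) cover
      where
      cover : ∀ {t} → t ∈ tabulate (adj H s) → t ≡ a ↑ʳ y v ⊎ t ≡ a ↑ʳ y w
      cover t∈ with neighbours eq t∈
      ... | u , xu , refl with x-degree≤2 (trans xv (sym xw)) (trans xv (sym xu))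
      ...   | inj₁ v≡w = contradiction (cong y (sym v≡w)) yw≢yv
      ...   | inj₂ (inj₁ refl) = inj₁ refl
      ...   | inj₂ (inj₂ refl) = inj₂ refl

    left<right : ∀ (i : Fin a) (j : Fin b) → toℕ (i ↑ˡ b) < toℕ (a ↑ʳ j)
    left<right i j = subst₂ _<_ (sym (toℕ-↑ˡ i b)) (sym (toℕ-↑ʳ a j)) (ℕ.<-≤-trans (toℕ<n i) (ℕ.m≤m+n a (toℕ j)))

    incident-xy : ∀ v → _~_ H (x v ↑ˡ b) (a ↑ʳ y v)
    incident-xy v rewrite splitAt-↑ˡ a (x v) b | splitAt-↑ʳ a b (y v) = fromWitness {a? = present? (x v) (y v)} (v , refl , refl)

    toEdge : V → Edge H
    toEdge v = edge (x v ↑ˡ b) (a ↑ʳ y v) (left<right (x v) (y v)) (incident-xy v)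

    toEdge-injective : ∀ {u v} → toEdge u ≡ toEdge v → u ≡ v
    toEdge-injective eq = injective₂ (↑ˡ-injective b _ _ (cong end₁ eq)) (↑ʳ-injective a _ _ (cong end₂ eq))

    toEdge-surjective : ∀ e → ∃ λ v → toEdge v ≡ e
    toEdge-surjective (edge s t s<t s~t) with incident⁻ (splitAt a {b} s) (splitAt a {b} t) s~t
    ... | inj₁ (i , j , eq , eq′ , v , refl , refl) = v , edge-≡ (splitAt⁻¹-↑ˡ eq) (splitAt⁻¹-↑ʳ eq′)
    ... | inj₂ (i , j , eq , eq′) = contradiction s<t
      (ℕ.<-asym (subst₂ (λ s t → toℕ t < toℕ s) (splitAt⁻¹-↑ʳ eq) (splitAt⁻¹-↑ˡ eq′) (left<right i j)))

    left≢right : ∀ {i : Fin a} {j : Fin b} → i ↑ˡ b ≢ a ↑ʳ j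
    left≢right {i} {j} eq = ℕ.<-irrefl (cong toℕ eq) (left<right i j)

    share⁺ : ∀ {u v} → x u ≡ x v ⊎ y u ≡ y v → ShareEnd (toEdge u) (toEdge v)
    share⁺ (inj₁ p) = inj₁ (cong (_↑ˡ b) p)
    share⁺ (inj₂ p) = inj₂ (inj₂ (inj₂ (cong (a ↑ʳ_) p)))

    share⁻ : ∀ {u v} → ShareEnd (toEdge u) (toEdge v) → x u ≡ x v ⊎ y u ≡ y v
    share⁻ (inj₁ p) = inj₁ (↑ˡ-injective b _ _ p)
    share⁻ (inj₂ (inj₁ p)) = contradiction p left≢right
    share⁻ (inj₂ (inj₂ (inj₁ p))) = contradiction (sym p) left≢right
    share⁻ (inj₂ (inj₂ (inj₂ p))) = inj₂ (↑ʳ-injective a _ _ p)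

  incidence⇒lineGraph : IsLineGraphOfIncidenceGraph G
  incidence⇒lineGraph = a + b , H , (X , (X-independent , ∁X-independent) , X-degree≤2) ,
    surjective-↪⇒≅ record
      { map       = toEdge
      ; injective = toEdge-injective
      ; map-adj   = λ u v → T-ext
          (λ u~v → lineGraph-~⁺ (~⇒≢ G u~v ∘ toEdge-injective) (share⁺ (~⇒share u~v)))
          (λ e~f → let e≢f , s = lineGraph-~⁻ e~f in share⇒~ (e≢f ∘ cong toEdge) (share⁻ s))
      }
      toEdge-surjective

lineGraph⇒good : ∀ {G : Graph V} → IsLineGraphOfIncidenceGraph G → GoodMatching G
lineGraph⇒good (m , H , (X , bip , deg) , i) = pullback (≅⇒↪ i) (incidence⇒good (lineGraph-incidence X bip deg))

diamond⇒good : ∀ {G : Graph V} → IsDiamond G → GoodMatching G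
diamond⇒good i = pullback (≅⇒↪ i) record
  { m        = m
  ; m-sym    = λ {u} {v} _ → toWitness {a? = all? λ u → all? λ v → T? (m u v) →-dec T? (m v u)} tt u v
  ; matching = λ {u} {v} {w} → toWitness
      {a? = all? λ u → all? λ v → all? λ w → T? (adj D v u) →-dec (T? (adj D v w) →-dec
             (T? (m v u) →-dec (T? (m v w) →-dec u ≟ w)))}
      tt u v w
  ; covering = λ {u} {v} {w} → toWitness
      {a? = all? λ u → all? λ v → all? λ w → T? (adj D v u) →-dec (T? (adj D v w) →-dec
             (¬? (u ≟ w) →-dec (¬? (T? (adj D u w)) →-dec
             (T? (m v u) ⊎-dec T? (m v w)))))}
      tt u v w
  }
  where
  D = diamondGraph
  -- The perfect matching with edges {0, 2} and {1, 3}. The induced paths on three vertices are 0 -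
  -- 2 - 1 and 0 - 3 - 1, and each contains one of these edges.
  m : Fin 4 → Fin 4 → Bool
  m zero                   (suc (suc zero))       = true
  m (suc (suc zero))       zero                   = true
  m (suc zero)             (suc (suc (suc zero))) = true
  m (suc (suc (suc zero))) (suc zero)             = true
  m _                      _                      = false

-- Parity constraints

-- Parity constraints: R x s y demands that f x ≡ s xor f y.
module Constraints {X : Set} (R : X → Bool → X → Set) where

  -- A walk that uses constraints in either direction, with their signs added up to `s`. The sum is
  -- given by an equation instead of an index, so that walks of a prescribed parity can still be
  -- taken apart by pattern matching.
  data Conn (x : X) (s : Bool) (z : X) : Set where
    stop : x ≡ z → s ≡ false → Conn x s z
    step : ∀ {y t u} → R x t y ⊎ R y t x → Conn y u z → s ≡ t xor u → Conn x s z

  Conn-trans : ∀ {x y z s t} → Conn x s y → Conn y t z → Conn x (s xor t) z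
  Conn-trans (stop refl refl) d = d
  Conn-trans {t = t} (step {t = s₁} {u = s₂} r c refl) d = step r (Conn-trans c d) (xor-assoc s₁ s₂ t)

  Conn-step : ∀ {x y s} → R x s y ⊎ R y s x → Conn x s y
  Conn-step {s = s} r = step r (stop refl refl) (sym (xor-identityʳ s))

  Conn-sym : ∀ {x y s} → Conn x s y → Conn y s x
  Conn-sym (stop refl refl) = stop refl refl
  Conn-sym (step {t = t} {u = u} r c refl) = subst (λ s → Conn _ s _) (xor-comm u t)
    (Conn-trans (Conn-sym c) (Conn-step ([ inj₂ , inj₁ ]′ r)))

  -- The state of a union-find with parities after the constraints in `cs`. Every parity is
  -- witnessed by a walk to the root, so that a clash can be turned into a closed walk of odd sign.
  record Labelling (cs : List (X × Bool × X)) : Set where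
    field
      root      : X → X
      parity    : X → Bool
      connected : ∀ x → Conn x (parity x) (root x)
      respects  : ∀ {x s y} → (x , s , y) List.∈ cs → R x s y → root x ≡ root y × parity x ≡ s xor parity y

  -- The roots are kept along with the values, since complementing `parity` on a whole class gives
  -- another solution.
  record Solution : Set where
    field
      root      : X → X
      parity    : X → Bool
      connected : ∀ x → Conn x (parity x) (root x)
      respects  : ∀ {x s y} → R x s y → root x ≡ root y × parity x ≡ s xor parity y

  xor-cancel : ∀ {a b c} → a xor (b xor c) ≢ true → b ≡ a xor c
  xor-cancel {true}  {true}  {true}  h = ⊥-elim (h refl)
  xor-cancel {true}  {true}  {false} h = refl
  xor-cancel {true}  {false} {true}  h = refl
  xor-cancel {true}  {false} {false} h = ⊥-elim (h refl)
  xor-cancel {false} {true}  {true}  h = refl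
  xor-cancel {false} {true}  {false} h = ⊥-elim (h refl)
  xor-cancel {false} {false} {true}  h = ⊥-elim (h refl)
  xor-cancel {false} {false} {false} h = refl

  module _ (_≟ˣ_ : B.DecidableEquality X) (R? : ∀ x s y → Dec (R x s y))
           (consistent : ∀ {x} → ¬ Conn x true x) where

    -- If the roots agree, the new constraint closes a walk at `x`; `consistent` makes its sign
    -- even, which is the required equation. Otherwise the class of `x` is hung below the root of
    -- `y`.
    add : ∀ {cs} x s y → R x s y → Labelling cs → Labelling ((x , s , y) ∷ cs)
    add {cs} x s y r labelling with Labelling.root labelling x ≟ˣ Labelling.root labelling y
    ... | yes eq = record
      { root      = root
      ; parity    = parity
      ; connected = connected
      ; respects  = λ { (here refl) _ → eq , xor-cancel {s} (λ odd → consistent (subst (λ t → Conn x t x) (lemma odd) loop))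
                      ; (there c∈) → respects c∈ }
      }
      where
      open Labelling labelling
      loop : Conn x (parity x xor (parity y xor s)) x
      loop = Conn-trans (subst (Conn x (parity x)) eq (connected x))
                        (Conn-trans (Conn-sym (connected y)) (Conn-step (inj₂ r)))
      lemma : s xor (parity x xor parity y) ≡ true → parity x xor (parity y xor s) ≡ true
      lemma odd = trans (sym (xor-assoc (parity x) _ s)) (trans (xor-comm _ s) odd)
    ... | no ≢ = record
      { root      = λ z → proj₁ (new z (root z ≟ˣ root x))
      ; parity    = λ z → proj₂ (new z (root z ≟ˣ root x))
      ; connected = λ z → new-connected z (root z ≟ˣ root x)
      ; respects  = λ { (here refl) _ → joined (root x ≟ˣ root x) (root y ≟ˣ root x)
                      ; {x = u} {s = t} {y = v} (there c∈) r → preserved {t = t} (respects c∈ r) (root u ≟ˣ root x) (root v ≟ˣ root x) }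
      }
      where
      open Labelling labelling
      -- The sign of the walk from `root x` to `x`, across the new constraint to `y`, and on to
      -- `root y`.
      link : Bool
      link = parity x xor (s xor parity y)

      new : ∀ z → Dec (root z ≡ root x) → X × Bool
      new z (yes _) = root y , parity z xor link
      new z (no _)  = root z , parity z

      new-connected : ∀ z (d : Dec (root z ≡ root x)) → Conn z (proj₂ (new z d)) (proj₁ (new z d))
      new-connected z (yes eq) = Conn-trans (subst (Conn z _) eq (connected z))
        (Conn-trans (Conn-sym (connected x)) (Conn-trans (Conn-step (inj₁ r)) (connected y)))
      new-connected z (no _) = connected z

      joined : ∀ (d : Dec (root x ≡ root x)) (e : Dec (root y ≡ root x)) →
               proj₁ (new x d) ≡ proj₁ (new y e) × proj₂ (new x d) ≡ s xor proj₂ (new y e)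
      joined (no x≢x) _       = contradiction refl x≢x
      joined (yes _) (yes eq) = contradiction (sym eq) ≢
      joined (yes _) (no _)   = refl ,
        trans (sym (xor-assoc (parity x) (parity x) (s xor parity y))) (cong (_xor (s xor parity y)) (xor-same (parity x)))

      preserved : ∀ {u v t} → root u ≡ root v × parity u ≡ t xor parity v →
                  (d : Dec (root u ≡ root x)) (e : Dec (root v ≡ root x)) →
                  proj₁ (new u d) ≡ proj₁ (new v e) × proj₂ (new u d) ≡ t xor proj₂ (new v e)
      preserved (eq , eq′) (no _)  (no _)  = eq , eq′
      preserved {t = t} (eq , eq′) (yes _) (yes _) = refl , trans (cong (_xor link) eq′) (xor-assoc t _ _)
      preserved (eq , _) (yes p) (no ¬p) = contradiction (trans (sym eq) p) ¬p
      preserved (eq , _) (no ¬p) (yes p) = contradiction (trans eq p) ¬p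

    label : ∀ cs → Labelling cs
    label [] = record
      { root = id ; parity = λ _ → false ; connected = λ _ → stop refl refl ; respects = λ () }
    label ((x , s , y) ∷ cs) with R? x s y
    ... | yes r = add x s y r (label cs)
    ... | no ¬r = record
      { root = root ; parity = parity ; connected = connected
      ; respects = λ { (here refl) r → contradiction r ¬r ; (there c∈) → respects c∈ } }
      where open Labelling (label cs)

    -- Abstract, because conversion checking would otherwise unfold the labelling.
    abstract
      solve : ∀ (xs : List X) → (∀ x → x List.∈ xs) → Solution
      solve xs ∈-xs = record
        { root      = root
        ; parity    = parity
        ; connected = connected
        ; respects  = λ {x} {s} {y} → respects
            (∈-cartesianProduct⁺ (∈-xs x) (∈-cartesianProduct⁺ (∈-Bool s) (∈-xs y)))
        }
        where
        open Labelling (label (cartesianProduct xs (cartesianProduct (true ∷ false ∷ []) xs)))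

        ∈-Bool : ∀ b → b List.∈ (true ∷ false ∷ [])
        ∈-Bool true  = here refl
        ∈-Bool false = there (here refl)

-- Canonical representatives of the classes of the equivalence relation generated by E.
module Classes {E : B.Rel (Fin n) 0ℓ} (E? : B.Decidable E) where

  private
    -- With the sign `false` throughout, no closed walk is odd, and the solver reduces to plain
    -- union-find.
    data R : Fin n → Bool → Fin n → Set where
      same : ∀ {x y} → E x y → R x false y

    R? : ∀ x s y → Dec (R x s y)
    R? x true  y = no λ ()
    R? x false y with E? x y
    ... | yes e = yes (same e)
    ... | no ¬e = no λ { (same e) → ¬e e }

    open Constraints R

    Conn⇒≡false : ∀ {x s y} → Conn x s y → s ≡ false
    Conn⇒≡false (stop _ eq) = eq
    Conn⇒≡false (step (inj₁ (same _)) c refl) = Conn⇒≡false c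
    Conn⇒≡false (step (inj₂ (same _)) c refl) = Conn⇒≡false c

    Conn⇒EqClosure : ∀ {x s y} → Conn x s y → EqClosure E x y
    Conn⇒EqClosure (stop refl _) = ε
    Conn⇒EqClosure (step (inj₁ (same e)) c _) = fwd e ◅ Conn⇒EqClosure c
    Conn⇒EqClosure (step (inj₂ (same e)) c _) = bwd e ◅ Conn⇒EqClosure c

    module S = Solution (solve _≟_ R? (λ c → case Conn⇒≡false c of λ ()) (allFin n) ∈-allFin)

  open S public using (root)

  root-connected : ∀ x → EqClosure E x (root x)
  root-connected x = Conn⇒EqClosure (S.connected x)

  root-cong : ∀ {x y} → E x y → root x ≡ root y
  root-cong e = proj₁ (S.respects (same e))

-- Components

module _ {E : B.Rel (Fin n) 0ℓ} (E? : B.Decidable E) (E-sym : ∀ {u v} → E u v → E v u)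
         (E-trans : ∀ {u v w} → E u v → E v w → u ≡ w ⊎ E u w) where

  open Classes E?

  private
    collapse : ∀ {u v} → EqClosure E u v → u ≡ v ⊎ E u v
    collapse ε = inj₁ refl
    collapse (fwd e ◅ c) = [ (λ { refl → inj₂ e }) , E-trans e ]′ (collapse c)
    collapse (bwd e ◅ c) = [ (λ { refl → inj₂ (E-sym e) }) , E-trans (E-sym e) ]′ (collapse c)

  -- `E` is transitive up to coincidence of the ends, like an equivalence relation without its
  -- diagonal, so its closure adds nothing but equality.
  root-≡⇒ : ∀ {u v} → root u ≡ root v → u ≡ v ⊎ E u v
  root-≡⇒ {u} {v} eq = collapse (root-connected u ◅◅ subst (λ r → EqClosure E r v) (sym eq) (symmetric E (root-connected v)))

-- From a good matching to the structure of the components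

module _ {G : Graph (Fin n)} where

  open Adjacency G

  ⌿? : B.Decidable _⌿_
  ⌿? u v = ¬? (u ≟ v) ×-dec ¬? (T? (adj G u v))

  —? : B.Decidable _—_
  —? u v = T? (adj G u v)

  Diamond? : ∀ a b c d → Dec (Diamond a b c d)
  Diamond? a b c d = map′
    (λ (p , q , r , s , t , u) → record { a⌿b = p ; a—c = q ; a—d = r ; b—c = s ; b—d = t ; c—d = u })
    (λ D → let open Diamond D in a⌿b , a—c , a—d , b—c , b—d , c—d)
    (⌿? a b ×-dec —? a c ×-dec —? a d ×-dec —? b c ×-dec —? b d ×-dec —? c d)

  Triangular : Fin n → Fin n → Set
  Triangular u v = ∃ λ w → u — w × v — w

  triangular? : B.Decidable Triangular
  triangular? u v = any? λ w → —? u w ×-dec —? v w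

  triangular-sym : ∀ {u v} → Triangular u v → Triangular v u
  triangular-sym (w , uw , vw) = w , vw , uw

  module _ (good : GoodMatching G) (S : Subset n)
           (no-diamond : ∀ {a b c d} → c ∈ S → ¬ Diamond a b c d) where

    open GoodMatching good using (m; m-sym; matching; covering)

    -- A matched edge {u , v} of a triangle joins twins, so it may be moved to the
    -- unmatched edges.
    twins : ∀ {u v w} → u ∈ S → u — v → Triangular u v → T (m u v) → u — w → w ≢ v → w — v
    twins {u} {v} {w} u∈S uv (t , ut , vt) muv uw w≢v with —? w v
    ... | yes wv = wv
    ... | no w≁v = ⊥-elim (no-diamond u∈S record
      { a⌿b = (w≢v ∘ sym) , w≁v ∘ —-sym ; a—c = —-sym uv ; a—d = vt ; b—c = —-sym uw ; b—d = wt ; c—d = ut })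
      where
      unmatched : ∀ {x} → u — x → v ≢ x → ¬ T (m u x)
      unmatched ux v≢x mux = v≢x (matching uv ux muv mux)
      -- Since `u v` is matched, neither `u w` nor `u t` is, and `covering` at `u` leaves only the
      -- possibility that `w` and `t` are adjacent.
      wt : w — t
      wt with —? w t
      ... | yes wt = wt
      ... | no w≁t with covering uw ut (λ { refl → w≁v (—-sym vt) }) w≁t
      ...   | inj₁ p = contradiction p (unmatched uw (w≢v ∘ sym))
      ...   | inj₂ p = contradiction p (unmatched ut (~⇒≢ G vt))

    Kept Clique : Fin n → Fin n → Set
    Kept   u v = u ∈ S × v ∈ S × u — v × T (m u v) × ¬ Triangular u v
    Clique u v = u ∈ S × v ∈ S × u — v × (¬ T (m u v) ⊎ Triangular u v)

    kept? : B.Decidable Kept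
    kept? u v = (u ∈? S) ×-dec (v ∈? S) ×-dec —? u v ×-dec T? (m u v) ×-dec ¬? (triangular? u v)

    clique? : B.Decidable Clique
    clique? u v = (u ∈? S) ×-dec (v ∈? S) ×-dec —? u v ×-dec (¬? (T? (m u v)) ⊎-dec triangular? u v)

    kept-sym : ∀ {u v} → Kept u v → Kept v u
    kept-sym (u∈ , v∈ , uv , muv , ¬t) = v∈ , u∈ , —-sym uv , m-sym uv muv , ¬t ∘ triangular-sym

    clique-sym : ∀ {u v} → Clique u v → Clique v u
    clique-sym (u∈ , v∈ , uv , inj₁ ¬muv) = v∈ , u∈ , —-sym uv , inj₁ (¬muv ∘ m-sym (—-sym uv))
    clique-sym (u∈ , v∈ , uv , inj₂ t)    = v∈ , u∈ , —-sym uv , inj₂ (triangular-sym t)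

    kept-unique : ∀ {u v w} → Kept v u → Kept v w → u ≡ w
    kept-unique (_ , _ , vu , mvu , _) (_ , _ , vw , mvw , _) = matching vu vw mvu mvw

    -- If `u` and `w` were distinct and non-adjacent, one of the edges `v u` and `v w` would be
    -- matched. A matched edge in `Clique` lies in a triangle, so `twins` makes `u` and `w` adjacent
    -- after all.
    clique-trans : ∀ {u v w} → Clique u v → Clique v w → u ≡ w ⊎ Clique u w
    clique-trans {u} {v} {w} c@(u∈ , v∈ , uv , p) (_ , w∈ , vw , q) with u ≟ w | —? u w
    ... | yes u≡w | _ = inj₁ u≡w
    ... | no _    | yes uw = inj₂ (u∈ , w∈ , uw , inj₂ (v , uv , —-sym vw))
    ... | no u≢w  | no u≁w with covering (—-sym uv) vw u≢w u≁w
    ...   | inj₁ mvu with clique-sym c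
    ...     | _ , _ , vu , inj₁ ¬mvu = contradiction mvu ¬mvu
    ...     | _ , _ , vu , inj₂ t    = contradiction (—-sym (twins v∈ vu t mvu vw (u≢w ∘ sym))) u≁w
    clique-trans {u} {v} {w} (u∈ , v∈ , uv , p) (_ , w∈ , vw , inj₁ ¬mvw)
      | no u≢w | no u≁w | inj₂ mvw = contradiction mvw ¬mvw
    clique-trans {u} {v} {w} (u∈ , v∈ , uv , p) (_ , w∈ , vw , inj₂ t)
      | no u≢w | no u≁w | inj₂ mvw = contradiction (twins v∈ vw t mvw (—-sym uv) u≢w) u≁w

    kept-trans : ∀ {u v w} → Kept u v → Kept v w → u ≡ w ⊎ Kept u w
    kept-trans p q = inj₁ (kept-unique (kept-sym p) q)

    private
      module K = Classes kept?
      module C = Classes clique?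

      sameK : ∀ {u v} → K.root u ≡ K.root v → u ≡ v ⊎ Kept u v
      sameK = root-≡⇒ kept? kept-sym kept-trans

      sameC : ∀ {u v} → C.root u ≡ C.root v → u ≡ v ⊎ Clique u v
      sameC = root-≡⇒ clique? clique-sym clique-trans

      disjoint : ∀ {u v} → Kept u v → ¬ Clique u v
      disjoint (_ , _ , _ , muv , _)   (_ , _ , _ , inj₁ ¬muv) = ¬muv muv
      disjoint (_ , _ , _ , _ , ¬t) (_ , _ , _ , inj₂ t)    = ¬t t

      split : ∀ {u v} → u ∈ S → v ∈ S → u — v → Kept u v ⊎ Clique u v
      split {u} {v} u∈ v∈ uv with T? (m u v) | triangular? u v
      ... | no ¬muv | _      = inj₂ (u∈ , v∈ , uv , inj₁ ¬muv)
      ... | yes _   | yes t  = inj₂ (u∈ , v∈ , uv , inj₂ t)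
      ... | yes muv | no ¬t  = inj₁ (u∈ , v∈ , uv , muv , ¬t)

    good⇒incidence : IncidenceStructure (induced G S) (Fin n) (Fin n)
    good⇒incidence = record
      { x = K.root ∘ proj₁
      ; y = C.root ∘ proj₁
      ; injective₂ = λ p q → Members-≡ ([ id , (λ κ → [ id , (λ c → contradiction c (disjoint κ)) ]′ (sameC q)) ]′ (sameK p))
      ; ~⇒share = λ { {_ , u∈} {_ , v∈} uv → [ inj₁ ∘ K.root-cong , inj₂ ∘ C.root-cong ]′ (split u∈ v∈ uv) }
      ; share⇒~ = λ u≢v → [ (λ p → [ (λ u≡v → contradiction (Members-≡ u≡v) u≢v) , proj₁ ∘ proj₂ ∘ proj₂ ]′ (sameK p))
                          , (λ q → [ (λ u≡v → contradiction (Members-≡ u≡v) u≢v) , proj₁ ∘ proj₂ ∘ proj₂ ]′ (sameC q)) ]′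
      ; x-degree≤2 = λ p q → case sameK p of λ where
          (inj₁ u≡v) → inj₁ (Members-≡ u≡v)
          (inj₂ κ)   → case sameK q of λ where
            (inj₁ u≡w) → inj₂ (inj₁ (Members-≡ u≡w))
            (inj₂ κ′)  → inj₂ (inj₂ (Members-≡ (kept-unique κ κ′)))
      }

  good⇒components : GoodMatching G → ∀ S → IsComponent G S →
                    IsLineGraphOfIncidenceGraph (induced G S) ⊎ IsDiamond (induced G S)
  good⇒components good S comp
    with any? (λ a → any? λ b → any? λ c → any? λ d → (c ∈? S) ×-dec Diamond? a b c d)
  ... | yes (a , b , c , d , c∈S , D) = inj₂ (diamond-component (Diamond.embedding D) comp (# 2) c∈S)
    -- That the diamond is closed under adjacency is deduced from the absence of the forbidden
    -- graphs, which the matching guarantees.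
    where open DiamondClosed (good⇒𝓕₄-free good)
  ... | no ∄D = inj₁ (incidence⇒lineGraph (anyMember? S)
    (good⇒incidence good S (λ {a} {b} {c} {d} c∈S D → ∄D (a , b , c , d , c∈S , D))))

  -- Gluing good matchings of the components

  open Classes —?

  component : Fin n → Subset n
  component r = ⟦ (λ v → root v ≟ root r) ⟧

  private
    root-idem : ∀ v → root v ≡ root (root v)
    root-idem v = respect (root-connected v)
      where
      respect : ∀ {u v} → EqClosure _—_ u v → root u ≡ root v
      respect ε           = refl
      respect (fwd e ◅ c) = trans (root-cong e) (respect c)
      respect (bwd e ◅ c) = trans (sym (root-cong e)) (respect c)

    EqClosure⇒Star : ∀ {u v} → EqClosure _—_ u v → Star _—_ u v
    EqClosure⇒Star = map* λ { (fwd e) → e ; (bwd e) → —-sym e }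

    Star⇒root : ∀ {u v} → Star _—_ u v → root u ≡ root v
    Star⇒root ε       = refl
    Star⇒root (e ◅ w) = trans (root-cong e) (Star⇒root w)

  component-IsComponent : ∀ r → IsComponent G (component r)
  component-IsComponent r = r , λ u → mk⇔
    (λ u∈ → EqClosure⇒Star (root-connected r ◅◅ subst (λ x → EqClosure _—_ x u) (∈⟦⟧⁻ (λ v → root v ≟ root r) u∈)
                              (symmetric _—_ (root-connected u))))
    (λ w → ∈⟦⟧⁺ (λ v → root v ≟ root r) (sym (Star⇒root w)))

  -- Each condition on a good matching concerns a vertex and some of its neighbours, which lie in
  -- one component. The matching used for an edge is that of the component of its first end;
  -- `root-cong` identifies it with the one of the second end.
  glue : (∀ S → IsComponent G S → GoodMatching (induced G S)) → GoodMatching G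
  glue goods = record
    { m        = λ u v → local (root u) u v
    ; m-sym    = λ {u} {v} uv p →
        subst (λ r → T (local r v u)) (root-cong uv)
          (local-m⁺ (—-root uv) (root-idem u) (m-sym′ uv p))
    ; matching = λ {u} {v} {w} vu vw p q → cong proj₁ (GoodMatching.matching (good (root v))
        {u , ∈comp (—-root vu)} {v , ∈comp (root-idem v)} {w , ∈comp (—-root vw)} vu vw
        (local-m⁻ (root-idem v) (—-root vu) p) (local-m⁻ (root-idem v) (—-root vw) q))
    ; covering = λ {u} {v} {w} vu vw u≢w u≁w → [ inj₁ ∘ local-m⁺ (root-idem v) (—-root vu) , inj₂ ∘ local-m⁺ (root-idem v) (—-root vw) ]′
        (GoodMatching.covering (good (root v))
          {u , ∈comp (—-root vu)} {v , ∈comp (root-idem v)} {w , ∈comp (—-root vw)} vu vw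
          (u≢w ∘ cong proj₁) u≁w)
    }
    where
    good : ∀ r → GoodMatching (induced G (component r))
    good r = goods (component r) (component-IsComponent r)

    ∈comp : ∀ {r v} → root v ≡ root r → v ∈ component r
    ∈comp {r} = ∈⟦⟧⁺ (λ v → root v ≟ root r)

    —-root : ∀ {u v} → u — v → root v ≡ root (root u)
    —-root {u} uv = trans (sym (root-cong uv)) (root-idem u)

    local : Fin n → Fin n → Fin n → Bool
    local r u v with u ∈? component r | v ∈? component r
    ... | yes u∈ | yes v∈ = GoodMatching.m (good r) (u , u∈) (v , v∈)
    -- A default outside the component; it is never met at the ends of an edge when `r` is their
    -- root.
    ... | _      | _      = false

    local-m⁻ : ∀ {r u v} (p : root u ≡ root r) (q : root v ≡ root r) → T (local r u v) →
               T (GoodMatching.m (good r) (u , ∈comp p) (v , ∈comp q))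
    local-m⁻ {r} {u} {v} p q e with u ∈? component r | v ∈? component r
    ... | yes _ | yes _ = subst₂ (λ a b → T (GoodMatching.m (good r) a b)) (Members-≡ refl) (Members-≡ refl) e

    local-m⁺ : ∀ {r u v} (p : root u ≡ root r) (q : root v ≡ root r) →
               T (GoodMatching.m (good r) (u , ∈comp p) (v , ∈comp q)) → T (local r u v)
    local-m⁺ {r} {u} {v} p q e with u ∈? component r | v ∈? component r
    ... | yes _ | yes _ = subst₂ (λ a b → T (GoodMatching.m (good r) a b)) (Members-≡ refl) (Members-≡ refl) e
    ... | no u∉ | _     = contradiction (∈comp p) u∉
    ... | yes _ | no v∉ = contradiction (∈comp q) v∉

    m-sym′ : ∀ {u v} (uv : u — v) → T (local (root u) u v) →
             T (GoodMatching.m (good (root u)) (v , ∈comp (—-root uv)) (u , ∈comp (root-idem u)))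
    m-sym′ {u} {v} uv p = GoodMatching.m-sym (good (root u)) {u , ∈comp (root-idem u)} {v , ∈comp (—-root uv)} uv
      (local-m⁻ (root-idem u) (—-root uv) p)

  components⇒good : (∀ S → IsComponent G S → IsLineGraphOfIncidenceGraph (induced G S) ⊎ IsDiamond (induced G S)) →
                    GoodMatching G
  components⇒good h = glue λ S comp → [ lineGraph⇒good , diamond⇒good ]′ (h S comp)

module _ {G : Graph V} where

  Rel-by : ∀ {u v} b → (T b → Rel G true u v) → (¬ T b → Rel G false u v) → Rel G b u v
  Rel-by true  e _ = e tt
  Rel-by false _ c = c id

-- Triangles and trails of edges that lie in no triangle

module NonTriangular {G : Graph (Fin n)} (free : Free 𝓕₄ G) where

  open Forbidden free
  open Adjacency G
  open DiamondClosed free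

  N : Fin n → Fin n → Set
  N u v = u — v × ¬ Triangular {G = G} u v

  N? : B.Decidable N
  N? u v = —? {G = G} u v ×-dec ¬? (triangular? {G = G} u v)

  N-sym : ∀ {u v} → N u v → N v u
  N-sym (uv , ¬t) = —-sym uv , ¬t ∘ triangular-sym {G = G}

  InTriangle : Fin n → Set
  InTriangle v = ∃₂ λ a b → v — a × v — b × a — b

  inTriangle? : Decidable InTriangle
  inTriangle? v = any? λ a → any? λ b → T? (adj G v a) ×-dec T? (adj G v b) ×-dec T? (adj G a b)

  triangular⇒inTriangle : ∀ {u v} → u — v → Triangular {G = G} u v → InTriangle u
  triangular⇒inTriangle {u} {v} uv (w , uw , vw) = v , w , uv , uw , vw

  -- A third neighbour `x` would form a claw with `u` and `w` at the centre `v`, because neither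
  -- `u v` nor `v w` lies in a triangle.
  N-neighbours : ∀ {u v w x} → N u v → N v w → u ≢ w → v — x → x ≡ u ⊎ x ≡ w
  N-neighbours {u} {v} {w} {x} (uv , ¬uv) (vw , ¬vw) u≢w vx with x ≟ u | x ≟ w
  ... | yes x≡u | _       = inj₁ x≡u
  ... | no _    | yes x≡w = inj₂ x≡w
  ... | no x≢u  | no x≢w  = ⊥-elim (¬claw (tuple-↪ G _ (v ∷ u ∷ w ∷ x ∷ [])
    ((—-sym uv , vw , vx) , ((u≢w , λ uw → ¬uv (w , uw , vw)) , (x≢u ∘ sym , λ ux → ¬uv (x , ux , vx))) ,
     (x≢w ∘ sym , λ wx → ¬vw (x , vx , wx)))))

  N-turn⇒¬inTriangle : ∀ {u v w} → N u v → N v w → u ≢ w → ¬ InTriangle v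
  N-turn⇒¬inTriangle Nuv@(_ , ¬uv) Nvw@(_ , ¬vw) u≢w (a , b , va , vb , ab) with N-neighbours Nuv Nvw u≢w va
  ... | inj₁ refl = ¬uv (b , ab , vb)
  ... | inj₂ refl = ¬vw (b , vb , ab)

  -- Take a triangle `v c d`. If `a` is neither on it nor adjacent to `c`, then `u`, `a`, `c` are
  -- the leaves of a claw at `v`.
  corner : ∀ {u v a} → N u v → InTriangle v → v — a → a ≢ u → Triangular {G = G} v a
  corner {u} {v} {a} (uv , ¬uv) (c , d , vc , vd , cd) va a≢u with a ≟ c | T? (adj G a c)
  ... | yes refl | _      = d , vd , cd
  ... | no _     | yes ac = c , vc , ac
  ... | no a≢c   | no a≁c = ⊥-elim (¬claw (tuple-↪ G _ (v ∷ u ∷ a ∷ c ∷ [])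
    ((—-sym uv , va , vc) , ((a≢u ∘ sym , λ ua → ¬uv (a , ua , va)) , ((λ { refl → ¬uv (d , cd , vd) }) , λ uc → ¬uv (c , uc , vc))) ,
     (a≢c , a≁c))))

  -- For triangles `a u x` and `a w y` without the edges `w x` and `u y`, the five vertices induce a
  -- gem if `x` and `y` are adjacent and a 0-butterfly otherwise.
  two-triangles : ∀ {a u w} → a — u → a — w → u ⌿ w → Triangular {G = G} a u → Triangular {G = G} a w →
                  ∃ λ z → Diamond u w a z
  two-triangles {a} {u} {w} au aw u⌿w (x , ax , ux) (y , ay , wy) with T? (adj G w x) | T? (adj G u y)
  ... | yes wx | _ = x , record { a⌿b = u⌿w ; a—c = —-sym au ; a—d = ux ; b—c = —-sym aw ; b—d = wx ; c—d = ax }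
  ... | no _ | yes uy = y , record { a⌿b = u⌿w ; a—c = —-sym au ; a—d = uy ; b—c = —-sym aw ; b—d = wy ; c—d = ay }
  ... | no w≁x | no u≁y with T? (adj G x y)
  ...   | yes xy = ⊥-elim (¬gem (tuple-↪ G _ (a ∷ u ∷ x ∷ y ∷ w ∷ [])
    ((au , ax , ay , aw) , (ux , u⌿y , u⌿w) , (xy , x⌿w) , —-sym wy)))
    where
    u⌿y : u ⌿ y
    u⌿y = (λ { refl → proj₂ u⌿w (—-sym wy) }) , u≁y
    x⌿w : x ⌿ w
    x⌿w = (λ { refl → proj₂ u⌿w ux }) , w≁x ∘ —-sym
  ...   | no x≁y = ⊥-elim (¬even-butterfly 0 refl (tuple-↪ G _ (u ∷ x ∷ a ∷ w ∷ y ∷ [])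
    ((ux , —-sym au , u⌿w , u⌿y) , (—-sym ax , x⌿w , x⌿y) , (aw , ay) , wy)))
    where
    u⌿y : u ⌿ y
    u⌿y = (λ { refl → proj₂ u⌿w (—-sym wy) }) , u≁y
    x⌿w : x ⌿ w
    x⌿w = (λ { refl → proj₂ u⌿w ux }) , w≁x ∘ —-sym
    x⌿y : x ⌿ y
    x⌿y = (λ { refl → w≁x wy }) , x≁y

  diamond⇒triangular : ∀ {a b c d v} → Diamond a b c d → a — v → Triangular {G = G} a v
  diamond⇒triangular {a} {b} {c} {d} D av with diamond-closed (Diamond.embedding D) (# 0) av
  ... | zero , refl = contradiction refl (~⇒≢ G av)
  ... | suc zero , refl = contradiction av (proj₂ (Diamond.a⌿b D))
  ... | suc (suc zero) , refl = d , Diamond.a—d D , Diamond.c—d D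
  ... | suc (suc (suc zero)) , refl = c , Diamond.a—c D , —-sym (Diamond.c—d D)

  -- `t` counts the turns: the edges run from `p 0`, `p 1` to `p t`, `p (suc t)`, and values of `p`
  -- beyond are irrelevant. Immediate reversal is excluded, but vertices and edges may recur.
  record IsTrail (p : ℕ → Fin n) (t : ℕ) : Set where
    field
      edges : ∀ {i} → i ≤ t → N (p i) (p (suc i))
      turns : ∀ {i} → i < t → p i ≢ p (2 + i)

  module TrailProperties {p t} (trail : IsTrail p t) where

    open IsTrail trail

    interior : ∀ {i x} → i < t → p (suc i) — x → x ≡ p i ⊎ x ≡ p (2 + i)
    interior i<t = N-neighbours (edges (ℕ.<⇒≤ i<t)) (edges i<t) (turns i<t)

    interior-¬inTriangle : ∀ {i} → i < t → ¬ InTriangle (p (suc i))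
    interior-¬inTriangle i<t = N-turn⇒¬inTriangle (edges (ℕ.<⇒≤ i<t)) (edges i<t) (turns i<t)

    -- An inner vertex has no neighbours besides those on the trail, so a coincidence passes on to
    -- adjacent indices: the later index moves one step back, the earlier one moves back or, if the
    -- trail runs there in the opposite direction, forward. This continues until the earlier index
    -- is 0.
    collision⇒return : ∀ j i → i < j → j ≤ suc t → p i ≡ p j → ∃ λ r → r < j × p (suc r) ≡ p 0
    collision⇒return (suc j) zero    _         _         eq = j , ℕ.n<1+n j , sym eq
    collision⇒return (suc j) (suc i) (s≤s i<j) (s≤s j≤t) eq
      with interior (ℕ.<-≤-trans i<j j≤t) (subst (_— p j) (sym eq) (—-sym (proj₁ (edges j≤t))))
    ... | inj₁ pj≡pi = let r , r<j , ret = collision⇒return j i i<j (ℕ.m≤n⇒m≤1+n j≤t) (sym pj≡pi) in r , ℕ.m<n⇒m<1+n r<j , ret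
    ... | inj₂ pj≡pi+2 with ℕ.m≤n⇒m<n∨m≡n i<j
    ...   | inj₂ refl = contradiction eq (~⇒≢ G (proj₁ (edges j≤t)))
    ...   | inj₁ i+1<j with ℕ.m≤n⇒m<n∨m≡n i+1<j
    ...     | inj₂ refl = contradiction eq (turns (ℕ.<-≤-trans (ℕ.n<1+n _) j≤t))
    ...     | inj₁ i+2<j = let r , r<j , ret = collision⇒return j (2 + i) i+2<j (ℕ.m≤n⇒m≤1+n j≤t) (sym pj≡pi+2)
                           in r , ℕ.m<n⇒m<1+n r<j , ret

    NoReturn : ℕ → Set
    NoReturn ℓ = ∀ r → r < ℓ → p (suc r) ≢ p 0

    first-return : ∀ ℓ → NoReturn ℓ ⊎ ∃ λ r → r < ℓ × p (suc r) ≡ p 0 × NoReturn r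
    first-return zero = inj₁ λ _ ()
    first-return (suc ℓ) with first-return ℓ
    ... | inj₂ (r , r<ℓ , found) = inj₂ (r , ℕ.m<n⇒m<1+n r<ℓ , found)
    ... | inj₁ none with p (suc ℓ) ≟ p 0
    ...   | yes eq = inj₂ (ℓ , ℕ.n<1+n ℓ , eq , none)
    ...   | no ≢   = inj₁ λ r r<1+ℓ → [ none r , (λ { refl → ≢ }) ]′ (ℕ.m≤n⇒m<n∨m≡n (s≤s⁻¹ r<1+ℓ))

    module _ {ℓ} (ℓ≤1+t : ℓ ≤ suc t) (no-return : NoReturn ℓ) where

      distinct : ∀ {i j} → i < j → j ≤ ℓ → p i ≢ p j
      distinct {i} {j} i<j j≤ℓ eq =
        let r , r<j , ret = collision⇒return j i i<j (ℕ.≤-trans j≤ℓ ℓ≤1+t) eq in no-return r (ℕ.<-≤-trans r<j j≤ℓ) ret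

      -- A chord has no inner vertex of the trail as an end, so it can only join `p 0` and `p ℓ`.
      chordless : ∀ {i j} → i < j → j ≤ ℓ → p i — p j → suc i ≡ j ⊎ i ≡ 0 × j ≡ ℓ
      chordless {suc i} {j} i+1<j j≤ℓ e with interior (s≤s⁻¹ (ℕ.≤-trans i+1<j (ℕ.≤-trans j≤ℓ ℓ≤1+t))) e
      ... | inj₁ eq = contradiction (sym eq) (distinct (ℕ.<⇒≤ i+1<j) j≤ℓ)
      ... | inj₂ eq with ℕ.m≤n⇒m<n∨m≡n i+1<j
      ...   | inj₁ i+2<j = contradiction (sym eq) (distinct i+2<j j≤ℓ)
      ...   | inj₂ i+2≡j = inj₁ i+2≡j
      chordless {zero} {suc j} _ j<ℓ e with ℕ.m≤n⇒m<n∨m≡n j<ℓ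
      ... | inj₂ 1+j≡ℓ = inj₂ (refl , 1+j≡ℓ)
      ... | inj₁ 1+j<ℓ with interior (s≤s⁻¹ (ℕ.≤-trans 1+j<ℓ ℓ≤1+t)) (—-sym e)
      ...   | inj₂ eq = contradiction eq (distinct z<s 1+j<ℓ)
      ...   | inj₁ eq with j
      ...     | zero  = inj₁ refl
      ...     | suc _ = contradiction eq (distinct z<s (ℕ.<⇒≤ j<ℓ))

      closed-↪ : p ℓ — p 0 → cycle (suc ℓ) ↪ G
      closed-↪ back = Rel⇒↪ G (cycle (suc ℓ)) (p ∘ toℕ) λ i j i<j → Rel-by _ (edge′ i j i<j ∘ cycle-~⁻ i<j) (chord i j i<j ∘ (_∘ cycle-~⁺ i<j))
        where
        edge′ : ∀ (i j : Fin (suc ℓ)) → toℕ i < toℕ j → CycleEdge (suc ℓ) (toℕ i) (toℕ j) → p (toℕ i) — p (toℕ j)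
        edge′ i j i<j (inj₁ eq) = subst (λ x → p (toℕ i) — p x) eq
          (proj₁ (edges (s≤s⁻¹ (ℕ.≤-trans i<j (ℕ.≤-trans (s≤s⁻¹ (toℕ<n j)) ℓ≤1+t)))))
        edge′ i j i<j (inj₂ (eq , eq′)) = subst₂ (λ x y → p x — p y) (sym eq) (sym (ℕ.suc-injective eq′)) (—-sym back)

        chord : ∀ (i j : Fin (suc ℓ)) → toℕ i < toℕ j → ¬ CycleEdge (suc ℓ) (toℕ i) (toℕ j) → p (toℕ i) ⌿ p (toℕ j)
        chord i j i<j ¬e = distinct i<j (s≤s⁻¹ (toℕ<n j)) , λ e → ¬e (case chordless i<j (s≤s⁻¹ (toℕ<n j)) e of λ where
          (inj₁ eq)         → inj₁ eq
          (inj₂ (eq , eq′)) → inj₂ (eq , cong suc eq′))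

    -- The closing edge would complete a chordless closed walk of odd length `suc ℓ`: a loop, a
    -- triangle on an edge that lies in none, or an odd hole.
    ¬odd-closed : ∀ ℓ → ℓ ≤ suc t → NoReturn ℓ → odd ℓ ≡ false → ¬ p ℓ — p 0
    ¬odd-closed 0 _ _ _ back = ~⇒≢ G back refl
    ¬odd-closed 2 2≤1+t _ _ back = proj₂ (edges z≤n) (p 2 , —-sym back , proj₁ (edges (s≤s⁻¹ 2≤1+t)))
    ¬odd-closed ℓ@(suc (suc (suc (suc _)))) ℓ≤1+t no-return even-ℓ back =
      ¬odd-hole (suc ℓ) (s≤s (s≤s (s≤s (s≤s (s≤s z≤n))))) (cong not even-ℓ) (closed-↪ ℓ≤1+t no-return back)

  SameEdge : (d e : Fin n × Fin n) → Set
  SameEdge (u , v) (x , y) = u ≡ x × v ≡ y ⊎ u ≡ y × v ≡ x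

  odd⇒suc : ∀ {t} → odd t ≡ true → ∃ λ t′ → t ≡ suc t′
  odd⇒suc {suc t} _ = t , refl

  -- The trail is cut at its first return to `p 0`, at index `suc r`. For even `r` this lap is an
  -- odd closed walk. For odd `r` the trail cannot stop there or turn back, so it continues along
  -- its first edge; deleting the lap removes the even number `suc r` of turns and leaves a shorter
  -- counterexample.
  ¬closed-trail : ∀ {t} → Acc _<_ t → ∀ p → IsTrail p t → odd t ≡ true → ¬ SameEdge (p 0 , p 1) (p t , p (suc t))
  ¬closed-trail {t} (acc rec) p trail odd-t same with TrailProperties.first-return trail (suc t)
  ... | inj₁ none with same | odd⇒suc {t} odd-t
  ...   | inj₁ (p0≡pt , _) | t′ , eq = none t′ (ℕ.m≤n⇒m≤1+n (ℕ.≤-reflexive (sym eq))) (trans (cong p (sym eq)) (sym p0≡pt))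
  ...   | inj₂ (p0≡p1+t , _) | _     = none t (ℕ.n<1+n t) (sym p0≡p1+t)
  ¬closed-trail {t} (acc rec) p trail odd-t same | inj₂ (r , s≤s r≤t , ret , none) = by-parity (odd r) refl
    where
    open IsTrail trail
    open TrailProperties trail

    p1≢pr : r ≤ t → odd r ≡ true → p 1 ≢ p r
    p1≢pr r≤t odd-r eq with ℕ.m≤n⇒m<n∨m≡n {1} {r} (subst (1 ≤_) (sym (proj₂ (odd⇒suc {r} odd-r))) (s≤s z≤n))
    ... | inj₁ 1<r  = distinct (ℕ.m≤n⇒m≤1+n r≤t) none 1<r ℕ.≤-refl eq
    ... | inj₂ refl = turns r≤t (sym ret)

    by-parity : ∀ b → odd r ≡ b → ⊥
    by-parity false even-r = ¬odd-closed r (ℕ.m≤n⇒m≤1+n r≤t) none even-r (subst (p r —_) ret (proj₁ (edges r≤t)))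
    by-parity true odd-r with ℕ.m≤n⇒m<n∨m≡n r≤t
    ... | inj₂ refl = [ (λ (p0≡pr , _) → let r′ , eq = odd⇒suc {r} odd-r in
                           none r′ (ℕ.≤-reflexive (sym eq)) (trans (cong p (sym eq)) (sym p0≡pr)))
                      , (λ (_ , p1≡pr) → p1≢pr r≤t odd-r p1≡pr) ]′ same
    ... | inj₁ r<t with interior r<t (subst (_— p 1) (sym ret) (proj₁ (edges z≤n)))
    ...   | inj₁ p1≡pr = p1≢pr r≤t odd-r p1≡pr
    ...   | inj₂ p1≡pr+2 = ¬closed-trail (rec (subst (t′ <_) t′+≡t (ℕ.m<m+n t′ z<s))) p′ trail′ odd-t′ same′
      where
      t′ : ℕ
      t′ = t ∸ suc r
      t′+≡t : t′ + suc r ≡ t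
      t′+≡t = ℕ.m∸n+n≡m r<t
      p′ : ℕ → Fin n
      p′ i = p (i + suc r)
      trail′ : IsTrail p′ t′
      trail′ = record
        { edges = λ i≤t′ → edges (subst (_ ≤_) t′+≡t (ℕ.+-monoˡ-≤ (suc r) i≤t′))
        ; turns = λ i<t′ → turns (subst (_ <_) t′+≡t (ℕ.+-monoˡ-< (suc r) i<t′))
        }
      odd-t′ : odd t′ ≡ true
      odd-t′ = trans (sym (xor-identityʳ (odd t′))) (trans (cong (odd t′ xor_) (sym (cong not odd-r)))
        (trans (sym (odd-+ t′ (suc r))) (trans (cong odd t′+≡t) odd-t)))
      same′ : SameEdge (p′ 0 , p′ 1) (p′ t′ , p′ (suc t′))
      same′ rewrite t′+≡t | ret | sym p1≡pr+2 = same

-- The sequence p 0 , … , p ℓ , c , z.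
module Append (p : ℕ → V) (ℓ : ℕ) (c z : V) where

  appended : ℕ → V
  appended i with ℕ.<-cmp i (suc ℓ)
  ... | tri< _ _ _ = p i
  ... | tri≈ _ _ _ = c
  ... | tri> _ _ _ = z

  appended-elim : (Q : ℕ → V → Set) → (∀ {i} → i ≤ ℓ → Q i (p i)) → Q (1 + ℓ) c → Q (2 + ℓ) z →
                  ∀ {i} → i < 3 + ℓ → Q i (appended i)
  appended-elim Q qp qc qz {i} (s≤s i≤2+ℓ) with ℕ.<-cmp i (suc ℓ)
  ... | tri< i<1+ℓ _ _ = qp (s≤s⁻¹ i<1+ℓ)
  ... | tri≈ _ refl _  = qc
  ... | tri> _ _ 1+ℓ<i with ℕ.≤-antisym i≤2+ℓ 1+ℓ<i
  ...   | refl = qz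

  appended-elim₂ : (Q : ℕ → ℕ → V → V → Set) → (∀ {i j} → i < j → j ≤ ℓ → Q i j (p i) (p j)) →
                   (∀ {i} → i ≤ ℓ → Q i (1 + ℓ) (p i) c) → (∀ {i} → i ≤ ℓ → Q i (2 + ℓ) (p i) z) →
                   Q (1 + ℓ) (2 + ℓ) c z → ∀ {i j} → i < j → j < 3 + ℓ → Q i j (appended i) (appended j)
  appended-elim₂ Q qpp qpc qpz qcz {i} {j} i<j j<3+ℓ = appended-elim (λ j v → i < j → Q i j (appended i) v)
    (λ j≤ℓ i<j → appended-elim (λ i u → i < _ → Q i _ u (p _)) (λ _ i<j → qpp i<j j≤ℓ)
      (λ 1+ℓ<j → contradiction (ℕ.≤-trans (ℕ.<⇒≤ 1+ℓ<j) j≤ℓ) (ℕ.<-irrefl refl))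
      (λ 2+ℓ<j → contradiction (ℕ.≤-trans (ℕ.<⇒≤ (ℕ.<⇒≤ 2+ℓ<j)) j≤ℓ) (ℕ.<-irrefl refl))
      (ℕ.<-trans i<j (s≤s (ℕ.m≤n⇒m≤1+n (ℕ.m≤n⇒m≤1+n j≤ℓ)))) i<j)
    (λ i<1+ℓ → appended-elim (λ i u → i < 1 + ℓ → Q i (1 + ℓ) u c) (λ i≤ℓ _ → qpc i≤ℓ)
      (λ 1+ℓ<1+ℓ → contradiction refl (ℕ.<⇒≢ 1+ℓ<1+ℓ))
      (λ 2+ℓ<1+ℓ → contradiction (ℕ.<⇒≤ 2+ℓ<1+ℓ) (ℕ.<-irrefl refl))
      (ℕ.<-trans i<1+ℓ (ℕ.m<n⇒m<1+n (ℕ.n<1+n _))) i<1+ℓ)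
    (λ i<2+ℓ → appended-elim (λ i u → i < 2 + ℓ → Q i (2 + ℓ) u z) (λ i≤ℓ _ → qpz i≤ℓ)
      (λ _ → qcz) (λ 2+ℓ<2+ℓ → contradiction refl (ℕ.<⇒≢ 2+ℓ<2+ℓ))
      (ℕ.m<n⇒m<1+n i<2+ℓ) i<2+ℓ)
    j<3+ℓ i<j

-- Trails of even length between two triangles

module Anchored {G : Graph (Fin n)} (free : Free 𝓕₄ G) where

  open Forbidden free
  open Adjacency G
  open DiamondClosed free
  open NonTriangular free

  module _ {p t} (trail : IsTrail p t) (odd-t : odd t ≡ true)
           (start : InTriangle (p 0)) (end : InTriangle (p (suc t))) where

    open IsTrail trail
    open TrailProperties trail

    private
      ℓ : ℕ
      ℓ = suc t

      no-return-inside : NoReturn t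
      no-return-inside r r<t eq = interior-¬inTriangle r<t (subst InTriangle (sym eq) start)

      1≤t : 1 ≤ t
      1≤t = subst (1 ≤_) (sym (proj₂ (odd⇒suc {t} odd-t))) (s≤s z≤n)

      -- No inner vertex lies in a triangle, so only the last vertex could be `p 0`. Then two
      -- different edges of the trail would meet there, which a vertex of a triangle does not allow,
      -- or the last edge would retrace the first one.
      no-return : NoReturn ℓ
      no-return r (s≤s r≤t) ret with ℕ.m≤n⇒m<n∨m≡n r≤t
      ... | inj₁ r<t = no-return-inside r r<t ret
      ... | inj₂ refl with p 1 ≟ p t
      ...   | no p1≢pt = N-turn⇒¬inTriangle (N-sym (edges z≤n)) (N-sym (subst (N (p t)) ret (edges ℕ.≤-refl))) p1≢pt start
      ...   | yes p1≡pt with ℕ.m≤n⇒m<n∨m≡n 1≤t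
      ...     | inj₂ refl = turns (s≤s z≤n) (sym ret)
      ...     | inj₁ 1<t  = distinct (ℕ.n≤1+n t) no-return-inside 1<t ℕ.≤-refl p1≡pt

      even-ℓ : odd ℓ ≡ false
      even-ℓ = cong not odd-t

      p-distinct : ∀ {i j} → i < j → j ≤ ℓ → p i ≢ p j
      p-distinct = distinct ℕ.≤-refl no-return

      0⌿ℓ : p 0 ⌿ p ℓ
      0⌿ℓ = p-distinct z<s ℕ.≤-refl , ¬odd-closed ℓ ℕ.≤-refl no-return even-ℓ ∘ —-sym

      p-chord : ∀ {i j} → i < j → j ≤ ℓ → suc i ≢ j → p i ⌿ p j
      p-chord i<j j≤ℓ i+1≢j = p-distinct i<j j≤ℓ , λ e → case chordless ℕ.≤-refl no-return i<j j≤ℓ e of λ where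
        (inj₁ eq)            → i+1≢j eq
        (inj₂ (refl , refl)) → proj₂ 0⌿ℓ e

      first : N (p 0) (p 1)
      first = edges z≤n

      last : N (p t) (p ℓ)
      last = edges ℕ.≤-refl

      -- A common neighbour would give a diamond containing `p 0` and `p ℓ`. As diamonds are closed
      -- under adjacency, the first edge of the trail would lie in a triangle.
      ¬common : ∀ {a} → p 0 — a → p ℓ — a → Triangular {G = G} (p 0) a → Triangular {G = G} (p ℓ) a → ⊥
      ¬common 0a ℓa △0 △ℓ = let _ , D = two-triangles (—-sym 0a) (—-sym ℓa) 0⌿ℓ (triangular-sym {G = G} △0) (triangular-sym {G = G} △ℓ) in
        proj₂ first (diamond⇒triangular D (proj₁ first))

      off-start : ∀ {a} → p 0 — a → Triangular {G = G} (p 0) a → ∀ {i} → i ≤ ℓ → a ≢ p i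
      off-start 0a △ {zero} _ refl = ~⇒≢ G 0a refl
      off-start 0a △ {suc i} i<ℓ refl with chordless ℕ.≤-refl no-return z<s i<ℓ 0a
      ... | inj₁ refl = proj₂ first △
      ... | inj₂ (_ , refl) = proj₂ 0⌿ℓ 0a

      off-end : ∀ {c} → p ℓ — c → Triangular {G = G} (p ℓ) c → ∀ {i} → i ≤ ℓ → c ≢ p i
      off-end ℓc △ {i} i≤ℓ refl with ℕ.m≤n⇒m<n∨m≡n i≤ℓ
      ... | inj₂ refl = ~⇒≢ G ℓc refl
      ... | inj₁ i<ℓ with chordless ℕ.≤-refl no-return i<ℓ ℕ.≤-refl (—-sym ℓc)
      ...   | inj₁ refl = proj₂ last (triangular-sym {G = G} △)
      ...   | inj₂ (refl , _) = proj₂ 0⌿ℓ (—-sym ℓc)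

      off-interior : ∀ {x} → (∀ {i} → i ≤ ℓ → x ≢ p i) → ∀ {i} → i < t → ¬ x — p (suc i)
      off-interior off i<t e with interior i<t (—-sym e)
      ... | inj₁ eq = off (ℕ.m≤n⇒m≤1+n (ℕ.<⇒≤ i<t)) eq
      ... | inj₂ eq = off (s≤s i<t) eq

      StartTip EndTip : Fin n → Set
      StartTip a = p 0 — a × (∀ {i} → i < ℓ → a ⌿ p (suc i))
      EndTip   c = p ℓ — c × (∀ {i} → i < ℓ → c ⌿ p i)

      startTip : ∀ {a} → p 0 — a → Triangular {G = G} (p 0) a → StartTip a
      startTip {a} 0a △ = 0a , λ {i} i<ℓ → off-start 0a △ i<ℓ , apart (ℕ.m≤n⇒m<n∨m≡n (s≤s⁻¹ i<ℓ))
        where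
        apart : ∀ {i} → i < t ⊎ i ≡ t → ¬ a — p (suc i)
        apart (inj₁ i<t)  = off-interior (off-start 0a △) i<t
        -- By `corner`, an edge from `a` to `p ℓ` would lie in a triangle too, which is the
        -- situation of `¬common`.
        apart (inj₂ refl) aℓ = ¬common 0a (—-sym aℓ) △ (corner last end (—-sym aℓ) (off-start 0a △ (ℕ.n≤1+n t)))

      endTip : ∀ {c} → p ℓ — c → Triangular {G = G} (p ℓ) c → EndTip c
      endTip {c} ℓc △ = ℓc , λ {i} i<ℓ → off-end ℓc △ (ℕ.<⇒≤ i<ℓ) , apart i i<ℓ
        where
        apart : ∀ i → i < ℓ → ¬ c — p i
        apart zero    _   c0 = ¬common (—-sym c0) ℓc (corner (N-sym first) start (—-sym c0) (off-end ℓc △ (s≤s z≤n))) △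
        apart (suc i) i<t = off-interior (off-end ℓc △) (s≤s⁻¹ i<t)

      p—p : ∀ {i j} → suc i ≡ j → j ≤ ℓ → p i — p j
      p—p refl j≤ℓ = proj₁ (edges (s≤s⁻¹ j≤ℓ))

      StartTip-⌿ : ∀ {a i} → StartTip a → i ≢ 0 → i ≤ ℓ → a ⌿ p i
      StartTip-⌿ {i = zero}  _ i≢0 _ = contradiction refl i≢0
      StartTip-⌿ {i = suc i} A _ i<ℓ = proj₂ A i<ℓ

      tips-≢ : ∀ {a c} → StartTip a → EndTip c → a ≢ c
      tips-≢ A C refl = proj₂ (proj₂ C z<s) (—-sym (proj₁ A))

      -- An edge between the triangles closes the trail to an odd hole.
      ¬tips-adjacent : ∀ {a c} → StartTip a → EndTip c → ¬ a — c
      ¬tips-adjacent {a} {c} A C ac = ¬odd-hole (3 + ℓ) (s≤s (s≤s (s≤s (s≤s 1≤t))))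
        (trans (not-involutive (not (odd ℓ))) (cong not even-ℓ))
        (Rel⇒↪ G (cycle (3 + ℓ)) (appended ∘ toℕ) λ i j i<j →
          let e , ne = related i<j (toℕ<n j) in Rel-by _ (e ∘ cycle-~⁻ i<j) (ne ∘ (_∘ cycle-~⁺ i<j)))
        where
        open Append p ℓ c a
        Related : ℕ → ℕ → Fin n → Fin n → Set
        Related i j u v = (CycleEdge (3 + ℓ) i j → u — v) × (¬ CycleEdge (3 + ℓ) i j → u ⌿ v)
        related : ∀ {i j} → i < j → j < 3 + ℓ → Related i j (appended i) (appended j)
        related = appended-elim₂ Related
          (λ i<j j≤ℓ → (λ { (inj₁ eq) → p—p eq j≤ℓ
                          ; (inj₂ (_ , refl)) → contradiction j≤ℓ (ℕ.<⇒≱ (ℕ.m<n⇒m<1+n (ℕ.n<1+n _))) })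
                      , λ ne → p-chord i<j j≤ℓ (ne ∘ inj₁))
          (λ {i} i≤ℓ → (λ { (inj₁ refl) → proj₁ C ; (inj₂ (_ , eq)) → contradiction eq (ℕ.<⇒≢ (ℕ.n<1+n _)) })
               , λ ne → ⌿-sym (proj₂ C (ℕ.≤∧≢⇒< i≤ℓ (ne ∘ inj₁ ∘ cong suc))))
          (λ {i} i≤ℓ → (λ { (inj₁ refl) → contradiction i≤ℓ (ℕ.<⇒≱ (ℕ.n<1+n _)) ; (inj₂ (refl , _)) → proj₁ A })
               , λ ne → ⌿-sym (StartTip-⌿ A (λ i≡0 → ne (inj₂ (i≡0 , refl))) i≤ℓ))
          ((λ _ → —-sym ac) , λ ne → contradiction (inj₁ refl) ne)

    -- With `t` odd the trail has the even length `ℓ`. The tips of each triangle see only their own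
    -- end of the trail and no tip of the other triangle, so trail and triangles induce an even
    -- butterfly.
    ¬odd-anchored : ⊥
    ¬odd-anchored = ¬triangles start end
     where
     ¬triangles : InTriangle (p 0) → ¬ InTriangle (p ℓ)
     ¬triangles (a , b , 0a , 0b , ab) (c , d , ℓc , ℓd , cd) =
      ¬even-butterfly ℓ even-ℓ (Rel⇒↪ G (butterfly ℓ) (q ∘ toℕ) λ i j i<j →
        let e , ne = related i<j (subst (toℕ j <_) (ℕ.+-comm ℓ 5) (toℕ<n j)) in
        Rel-by _ (e ∘ butterfly-~⁻ ℓ i<j) (ne ∘ (_∘ butterfly-~⁺ ℓ i<j)))
      where
      open Append p ℓ c d

      A : StartTip a
      A = startTip 0a (b , 0b , ab)
      B′ : StartTip b
      B′ = startTip 0b (a , 0a , —-sym ab)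
      C : EndTip c
      C = endTip ℓc (d , ℓd , cd)
      D : EndTip d
      D = endTip ℓd (c , ℓc , —-sym cd)

      -- The order `a`, `b`, `p 0`, ..., `p ℓ`, `c`, `d` is that of `butterfly ℓ`, whose connecting
      -- path runs from vertex 2 to vertex `ℓ + 2`.
      q : ℕ → Fin n
      q zero          = a
      q (suc zero)    = b
      q (suc (suc i)) = appended i

      Related : ℕ → ℕ → Fin n → Fin n → Set
      Related i j u v = (ButterflyEdge ℓ i j → u — v) × (¬ ButterflyEdge ℓ i j → u ⌿ v)

      tips-⌿ : ∀ {a c} → StartTip a → EndTip c → a ⌿ c
      tips-⌿ A C = tips-≢ A C , ¬tips-adjacent A C

      a-related : ∀ {j} → j < 3 + ℓ → Related 0 (2 + j) a (appended j)
      a-related = appended-elim (λ j v → Related 0 (2 + j) a v)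
        (λ { {zero}  j≤ℓ → (λ _ → —-sym 0a) , λ ne → contradiction (inj₂ (inj₁ (refl , refl))) ne
           ; {suc j} j<ℓ → (λ { (inj₁ ()) ; (inj₂ (inj₁ (_ , ()))) ; (inj₂ (inj₂ (() , _))) }) , λ _ → proj₂ A j<ℓ })
        ((λ { (inj₁ ()) ; (inj₂ (inj₁ (_ , ()))) ; (inj₂ (inj₂ (() , _))) }) , λ _ → tips-⌿ A C)
        ((λ { (inj₁ ()) ; (inj₂ (inj₁ (_ , ()))) ; (inj₂ (inj₂ (() , _))) }) , λ _ → tips-⌿ A D)

      b-related : ∀ {j} → j < 3 + ℓ → Related 1 (2 + j) b (appended j)
      b-related = appended-elim (λ j v → Related 1 (2 + j) b v)
        (λ { {zero}  j≤ℓ → (λ _ → —-sym 0b) , λ ne → contradiction (inj₁ refl) ne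
           ; {suc j} j<ℓ → (λ { (inj₁ ()) ; (inj₂ (inj₁ (() , _))) ; (inj₂ (inj₂ (eq , _))) → 1≢ℓ+2 eq }) , λ _ → proj₂ B′ j<ℓ })
        ((λ { (inj₁ ()) ; (inj₂ (inj₁ (() , _))) ; (inj₂ (inj₂ (eq , _))) → 1≢ℓ+2 eq }) , λ _ → tips-⌿ B′ C)
        ((λ { (inj₁ ()) ; (inj₂ (inj₁ (() , _))) ; (inj₂ (inj₂ (eq , _))) → 1≢ℓ+2 eq }) , λ _ → tips-⌿ B′ D)
        where
        1≢ℓ+2 : ∀ {X : Set} → 1 ≡ ℓ + 2 → X
        1≢ℓ+2 eq = case trans (ℕ.suc-injective eq) (ℕ.+-comm t 2) of λ ()

      tail-related : ∀ {i j} → i < j → j < 3 + ℓ → Related (2 + i) (2 + j) (appended i) (appended j)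
      tail-related = appended-elim₂ (λ i j → Related (2 + i) (2 + j))
        (λ i<j j≤ℓ → (λ { (inj₁ eq) → p—p (ℕ.suc-injective (ℕ.suc-injective eq)) j≤ℓ
                        ; (inj₂ (inj₁ (() , _)))
                        ; (inj₂ (inj₂ (eq , _))) → contradiction (ℕ.<-≤-trans i<j j≤ℓ) (ℕ.<-irrefl (i≡ℓ eq)) })
                    , λ ne → p-chord i<j j≤ℓ (ne ∘ inj₁ ∘ cong (2 +_)))
        (λ {i} i≤ℓ → (λ { (inj₁ refl) → ℓc
                        ; (inj₂ (inj₁ (() , _)))
                        ; (inj₂ (inj₂ (_ , eq))) → contradiction (trans eq (ℕ.+-comm ℓ 4)) (ℕ.<⇒≢ (ℕ.n<1+n _)) })
                    , λ ne → ⌿-sym (proj₂ C (ℕ.≤∧≢⇒< i≤ℓ (ne ∘ inj₁ ∘ cong (3 +_)))))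
        (λ {i} i≤ℓ → (λ { (inj₁ refl) → contradiction i≤ℓ (ℕ.<⇒≱ (ℕ.n<1+n _))
                        ; (inj₂ (inj₁ (() , _)))
                        ; (inj₂ (inj₂ (eq , _))) → subst (λ i → p i — d) (sym (i≡ℓ eq)) ℓd })
                    , λ ne → ⌿-sym (proj₂ D (ℕ.≤∧≢⇒< i≤ℓ (λ i≡ℓ → ne (inj₂ (inj₂ (trans (cong (2 +_) i≡ℓ) (ℕ.+-comm 2 ℓ) , ℕ.+-comm 4 ℓ)))))))
        ((λ _ → cd) , λ ne → contradiction (inj₁ refl) ne)
        where
        i≡ℓ : ∀ {i} → 2 + i ≡ ℓ + 2 → i ≡ ℓ
        i≡ℓ eq = ℕ.suc-injective (ℕ.suc-injective (trans eq (ℕ.+-comm ℓ 2)))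

      related : ∀ {i j} → i < j → j < 5 + ℓ → Related i j (q i) (q j)
      related {zero}        {suc zero}    _ _ = (λ _ → ab) , λ ne → contradiction (inj₁ refl) ne
      related {zero}        {suc (suc j)} _ (s<s (s<s j<3+ℓ)) = a-related j<3+ℓ
      related {suc zero}    {suc (suc j)} _ (s<s (s<s j<3+ℓ)) = b-related j<3+ℓ
      related {suc (suc i)} {suc (suc j)} (s<s (s<s i<j)) (s<s (s<s j<3+ℓ)) = tail-related i<j j<3+ℓ
      related {suc zero}    {suc zero}    (s<s ()) _

-- Parity constraints on oriented edges and their solution

module Darts {G : Graph (Fin n)} (free : Free 𝓕₄ G) where

  open Adjacency G
  open NonTriangular free
  open Anchored free

  Dart : Set
  Dart = Fin n × Fin n

  -- Being matched is an unknown bit for every ordered pair, which avoids choosing orientations: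
  -- `rev` equates the two darts of an edge, and `turn` makes consecutive edges alternate.
  data Constraint : Dart → Bool → Dart → Set where
    rev  : ∀ {u v} → N u v → Constraint (u , v) false (v , u)
    turn : ∀ {u v w} → N u v → N v w → u ≢ w → Constraint (u , v) true (v , w)

  constraint? : ∀ d s e → Dec (Constraint d s e)
  constraint? (u , v) false (x , y) = map′ (λ { (refl , refl , Nuv) → rev Nuv }) (λ { (rev Nuv) → refl , refl , Nuv })
    (x ≟ v ×-dec y ≟ u ×-dec N? u v)
  constraint? (u , v) true (x , y) = map′ (λ { (refl , Nuv , Nvw , u≢w) → turn Nuv Nvw u≢w })
    (λ { (turn Nuv Nvw u≢w) → refl , Nuv , Nvw , u≢w })
    (x ≟ v ×-dec N? u v ×-dec N? v y ×-dec ¬? (u ≟ y))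

  open Constraints Constraint

  -- Edges are compared without orientation, because `rev` changes the dart but leaves the trail as
  -- it is; only turns contribute to the sign.
  Linked : Dart → Bool → Dart → Set
  Linked d s e = ∃₂ λ p t → IsTrail p t × odd t ≡ s × SameEdge d (p 0 , p 1) × SameEdge e (p t , p (suc t))

  Linked-reverse : ∀ {u v s e} → Linked (u , v) s e → Linked (v , u) s e
  Linked-reverse (p , t , trail , odd-t , same , same′) =
    p , t , trail , odd-t , [ (λ (q , q′) → inj₂ (q′ , q)) , (λ (q , q′) → inj₁ (q′ , q)) ]′ same , same′

  Linked-refl : ∀ {u v} → N u v → Linked (u , v) false (u , v)
  Linked-refl {u} {v} Nuv = (λ { zero → u ; (suc _) → v }) , 0 ,
    record { edges = λ { z≤n → Nuv } ; turns = λ () } , refl , inj₁ (refl , refl) , inj₁ (refl , refl)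

  -- A trail that leaves `v w` through `w` is extended by `u` in front. One that leaves it through
  -- `v` can only go on to `u`, as `v` has no third neighbour and trails do not turn back; dropping
  -- its first edge changes the parity just as well.
  Linked-turn : ∀ {u v w s e} → N u v → N v w → u ≢ w → Linked (v , w) s e → Linked (u , v) (not s) e
  Linked-turn {u} Nuv Nvw u≢w (p , t , trail , refl , inj₁ (refl , refl) , end) =
    (λ { zero → u ; (suc i) → p i }) , suc t ,
    record { edges = λ { z≤n → Nuv ; (s≤s i≤t) → IsTrail.edges trail i≤t }
           ; turns = λ { {zero} _ → u≢w ; {suc _} (s≤s i<t) → IsTrail.turns trail i<t } } ,
    refl , inj₁ (refl , refl) , end
  -- A single edge has no continuation that could reach `u`, so the trail `u`, `v`, `w` is built
  -- anew.
  Linked-turn {u} {v} {w} Nuv Nvw u≢w (p , zero , trail , refl , inj₂ (refl , refl) , end) =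
    (λ { zero → u ; (suc zero) → v ; (suc (suc _)) → w }) , 1 ,
    record { edges = λ { z≤n → Nuv ; (s≤s z≤n) → Nvw } ; turns = λ { (s≤s z≤n) → u≢w } } ,
    refl , inj₁ (refl , refl) , [ (λ (q , q′) → inj₂ (q , q′)) , (λ (q , q′) → inj₁ (q , q′)) ]′ end
  Linked-turn {u} Nuv Nvw u≢w (p , suc t , trail , refl , inj₂ (refl , refl) , end)
    with N-neighbours Nuv Nvw u≢w (proj₁ (IsTrail.edges trail {1} (s≤s z≤n)))
  ... | inj₂ p2≡w = contradiction (sym p2≡w) (IsTrail.turns trail (s≤s z≤n))
  ... | inj₁ p2≡u = p ∘ suc , t ,
    record { edges = IsTrail.edges trail ∘ s≤s ; turns = IsTrail.turns trail ∘ s≤s } ,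
    sym (not-involutive (odd t)) , inj₂ (sym p2≡u , refl) , end

  Conn⇒Linked : ∀ {u v s e} → N u v → Conn (u , v) s e → Linked (u , v) s e
  Conn⇒Linked Nuv (stop refl refl) = Linked-refl Nuv
  Conn⇒Linked Nuv (step (inj₁ (rev _)) c refl) = Linked-reverse (Conn⇒Linked (N-sym Nuv) c)
  Conn⇒Linked Nuv (step (inj₂ (rev Nvu)) c refl) = Linked-reverse (Conn⇒Linked Nvu c)
  Conn⇒Linked _   (step (inj₁ (turn Nuv Nvw u≢w)) c refl) = Linked-turn Nuv Nvw u≢w (Conn⇒Linked Nvw c)
  Conn⇒Linked _   (step (inj₂ (turn Nuv Nvw u≢w)) c refl) =
    Linked-reverse (Linked-turn (N-sym Nvw) (N-sym Nuv) (u≢w ∘ sym) (Linked-reverse (Conn⇒Linked Nuv c)))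

  consistent : ∀ {d} → ¬ Conn d true d
  consistent c = case Conn⇒N c of λ Nd →
    let p , t , trail , odd-t , same , same′ = Conn⇒Linked Nd c in
    ¬closed-trail (<-wellFounded t) p trail odd-t (SameEdge-trans same same′)
    where
    Conn⇒N : ∀ {u v e} → Conn (u , v) true e → N u v
    Conn⇒N (step (inj₁ (rev Nuv)) _ _)      = Nuv
    Conn⇒N (step (inj₁ (turn Nuv _ _)) _ _) = Nuv
    Conn⇒N (step (inj₂ (rev Nvu)) _ _)      = N-sym Nvu
    Conn⇒N (step (inj₂ (turn _ Nvw _)) _ _) = Nvw
    SameEdge-trans : ∀ {d e f} → SameEdge d e → SameEdge d f → SameEdge e f
    SameEdge-trans (inj₁ (refl , refl)) s = s
    SameEdge-trans (inj₂ (refl , refl)) (inj₁ (p , q)) = inj₂ (q , p)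
    SameEdge-trans (inj₂ (refl , refl)) (inj₂ (p , q)) = inj₁ (q , p)

  Anchor : Dart → Set
  Anchor (u , v) = N u v × (InTriangle u ⊎ InTriangle v)

  anchor? : Decidable Anchor
  anchor? (u , v) = N? u v ×-dec (inTriangle? u ⊎-dec inTriangle? v)

  -- The linking trail has at least one turn, so each of the two edges has one inner vertex, which
  -- lies in no triangle. The triangles are therefore at the outer ends, as `¬odd-anchored` needs
  -- them.
  ¬odd-anchors : ∀ {d e} → Anchor d → Anchor e → ¬ Conn d true e
  ¬odd-anchors {d} {e} (Nd , △d) (_ , △e) c with Conn⇒Linked Nd c
  ... | p , suc t , trail , odd-t , same , same′ = ¬odd-anchored trail odd-t
    (case on-edge same △d of λ where
      (inj₁ △0) → △0
      (inj₂ △1) → contradiction △1 (interior-¬inTriangle z<s))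
    (case on-edge same′ △e of λ where
      (inj₁ △t) → contradiction △t (interior-¬inTriangle (ℕ.n<1+n t))
      (inj₂ △ℓ) → △ℓ)
    where
    open TrailProperties trail
    on-edge : ∀ {u v x y} → SameEdge (u , v) (x , y) → InTriangle u ⊎ InTriangle v → InTriangle x ⊎ InTriangle y
    on-edge (inj₁ (refl , refl)) △ = △
    on-edge (inj₂ (refl , refl)) △ = [ inj₂ , inj₁ ]′ △

  open Solution (solve (≡-dec _≟_ _≟_) constraint? consistent (cartesianProduct (allFin n) (allFin n))
    (λ (u , v) → ∈-cartesianProduct⁺ (∈-allFin u) (∈-allFin v)))

  Flipped : Dart → Set
  Flipped r = ∃₂ λ u v → Anchor (u , v) × root (u , v) ≡ r × parity (u , v) ≡ false

  flipped? : Decidable Flipped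
  flipped? r = any? λ u → any? λ v → anchor? (u , v) ×-dec ≡-dec _≟_ _≟_ (root (u , v)) r ×-dec parity (u , v) ≟ᵇ false

  abstract
    -- Each class of darts is flipped, if necessary, so that its anchors become true.
    value : Dart → Bool
    value d = parity d xor ⌊ flipped? (root d) ⌋

    value-respects : ∀ {d s e} → Constraint d s e → value d ≡ s xor value e
    value-respects {d} {s} {e} c with respects c
    ... | root≡ , parity≡ rewrite root≡ | parity≡ = xor-assoc s (parity e) ⌊ flipped? (root e) ⌋

    anchor-value : ∀ {d} → Anchor d → value d ≡ true
    anchor-value {d} A with parity d in eq | flipped? (root d)
    ... | true  | no _   = refl
    ... | false | yes _  = refl
    ... | false | no ¬f  = contradiction (proj₁ d , proj₂ d , A , refl , eq) ¬f
    -- The class is flipped because of another anchor, of parity `false`; the walk between the two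
    -- anchors through the root is odd.
    ... | true  | yes (u , v , A′ , root≡ , parity≡) = contradiction
      (Conn-trans (subst₂ (λ s r → Conn d s r) eq (sym root≡) (connected d))
                  (subst (λ s → Conn (root (u , v)) s (u , v)) parity≡ (Conn-sym (connected (u , v)))))
      (¬odd-anchors A A′)

  module _ (S : Subset n) (no-diamond : ∀ {a b c d} → c ∈ S → ¬ Diamond a b c d) where

    private
      Matched : Fin n → Fin n → Set
      Matched u v = N u v × T (value (u , v))

      matched? : B.Decidable Matched
      matched? u v = N? u v ×-dec T? (value (u , v))

      turn-value : ∀ {u v w} → N v u → N v w → u ≢ w → value (v , u) ≡ not (value (v , w))
      turn-value Nvu Nvw u≢w = trans (value-respects (rev Nvu)) (value-respects (turn (N-sym Nvu) Nvw u≢w))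

      matched : Fin n → Fin n → Bool
      matched u v = ⌊ matched? u v ⌋

      matched⁺ : ∀ {u v} → Matched u v → T (matched u v)
      matched⁺ {u} {v} = fromWitness {a? = matched? u v}

      matched⁻ : ∀ {u v} → T (matched u v) → Matched u v
      matched⁻ {u} {v} = toWitness {a? = matched? u v}

      match : ∀ {u v w} → Matched v u → Matched v w → u ≡ w
      match {u} {v} {w} (Nvu , p) (Nvw , q) with u ≟ w
      ... | yes u≡w = u≡w
      ... | no u≢w with value (v , u) | value (v , w) | turn-value Nvu Nvw u≢w
      ...   | true | true | ()

      anchored : ∀ {u v} → N v u → InTriangle v → Matched v u
      anchored Nvu △ = Nvu , from T-≡ (anchor-value (Nvu , inj₁ △))

      -- Two triangular edges would give a diamond with `v` of degree 3. If just one edge is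
      -- triangular, `v` is in a triangle and the other edge is an anchor. If neither is, the two
      -- edges form a turn and have opposite values.
      cover : ∀ {u v w} → v ∈ S → v — u → v — w → u ⌿ w → Matched v u ⊎ Matched v w
      cover {u} {v} {w} v∈S vu vw u⌿w with triangular? {G = G} v u | triangular? {G = G} v w
      ... | yes △u | yes △w = contradiction (proj₂ (two-triangles vu vw u⌿w △u △w)) (no-diamond v∈S)
      ... | yes △u | no ¬△w = inj₂ (anchored (vw , ¬△w) (triangular⇒inTriangle vu △u))
      ... | no ¬△u | yes △w = inj₁ (anchored (vu , ¬△u) (triangular⇒inTriangle vw △w))
      ... | no ¬△u | no ¬△w = decide (value (v , w)) refl
        where
        decide : ∀ b → value (v , w) ≡ b → Matched v u ⊎ Matched v w
        decide true  eq = inj₂ ((vw , ¬△w) , from T-≡ eq)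
        decide false eq = inj₁ ((vu , ¬△u) , from T-≡ (trans (turn-value (vu , ¬△u) (vw , ¬△w) (proj₁ u⌿w)) (cong not eq)))

    free⇒good : GoodMatching (induced G S)
    free⇒good = record
      { m        = λ u v → matched (proj₁ u) (proj₁ v)
      ; m-sym    = λ {u} {v} _ p → let Nuv , q = matched⁻ {proj₁ u} {proj₁ v} p in
          matched⁺ (N-sym Nuv , subst T (value-respects (rev Nuv)) q)
      ; matching = λ {u} {v} {w} _ _ p q →
          Members-≡ (match (matched⁻ {proj₁ v} {proj₁ u} p) (matched⁻ {proj₁ v} {proj₁ w} q))
      ; covering = λ { {u} {v , v∈S} {w} vu vw u≢w u≁w → [ inj₁ ∘ matched⁺ , inj₂ ∘ matched⁺ ]′
          (cover {proj₁ u} {v} {proj₁ w} v∈S vu vw (u≢w ∘ Members-≡ , u≁w)) }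
      }

𝓕₄-free⇒components : ∀ {G : Graph (Fin n)} → Free 𝓕₄ G → ∀ S → IsComponent G S → GoodMatching (induced G S)
𝓕₄-free⇒components {G = G} free S comp
  with any? (λ a → any? λ b → any? λ c → any? λ d → (c ∈? S) ×-dec Diamond? {G = G} a b c d)
... | yes (a , b , c , d , c∈S , D) = diamond⇒good (diamond-component (Adjacency.Diamond.embedding D) comp (# 2) c∈S)
  where open DiamondClosed free
... | no ∄D = Darts.free⇒good free S (λ {a} {b} {c} {d} c∈S D → ∄D (a , b , c , d , c∈S , D))

proposition17 : ∀ (n : ℕ) (G : Graph (Fin n)) →
    let
    ⟨1⟩ = AdmitsFreeColouring (｛ ᵇP₃ ｝ ∪ ｛ ʳP₃ ｝ ∪ ｛ ᵇK₃ ｝ ∪ ｛ ʳᵇᵇK₃ ｝) G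
    ⟨2⟩ = AdmitsFreeColouring (｛ ᵇP₃ ｝ ∪ ｛ ʳP₃ ｝ ∪ ｛ ʳK₃ ｝ ∪ ｛ ʳʳᵇK₃ ｝) G
    ⟨3⟩ = ∀ S → IsComponent G S → IsLineGraphOfIncidenceGraph (induced G S) ⊎ IsDiamond (induced G S)
    ⟨4⟩ = Free (｛ claw ｝ ∪ ｛ 4-wheel ｝ ∪ ｛ gem ｝ ∪ ｛ kite ｝ ∪ ｛ X₁ ｝ ∪ ｛ X₂ ｝ ∪ ｛ K₅-e ｝ ∪ OddHole ∪ EvenButterfly) G
    in (⟨1⟩ ⇔ ⟨2⟩) × (⟨2⟩ ⇔ ⟨3⟩) × (⟨3⟩ ⇔ ⟨4⟩)
proposition17 n G =
  mk⇔ (good⇒𝓕₂-free ∘ 𝓕₁-free⇒good) (good⇒𝓕₁-free ∘ 𝓕₂-free⇒good) ,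
  mk⇔ (good⇒components ∘ 𝓕₂-free⇒good) (good⇒𝓕₂-free ∘ components⇒good) ,
  -- From ⟨4⟩ the matchings of the components are glued to one of `G`, and the structure of the
  -- components is read off from it.
  mk⇔ (good⇒𝓕₄-free ∘ components⇒good) (good⇒components ∘ glue ∘ 𝓕₄-free⇒components)
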